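{- For all integers $r \ge 2$ and every real $\beta > 0$, there exist an integer $D_{r,\beta}\ge 0$ and a real $\alpha > 0$ such that the following holds for all $D\ge D_{r,\beta}$. If $G$ is an $r$-bounded hypergraph of maximum degree at most $D$ in which every pair of distinct vertices has codegree at most $D^{1-\beta}$, and $L$ is a list assignment to the edges of $G$ such that $|L(e)|\ge D(1+D^{ -\alpha})$ for each edge $e$ of $G$, then $G$ has $D$ pairwise disjoint $L$-colorings, that is, there exist $L$-colorings $\phi_1,\ldots, \phi_D$ such that $\phi_i(e)\ne \phi_j(e)$ for every $i\ne j \in [D]$ and every $e\in E(G)$.
   Context: A hypergraph is $r$-bounded if every edge has at most $r$ vertices; the codegree of two vertices is the number of edges containing both. An $L$-coloring of the edges of $G$ is an assignment $\phi$ of a color $\phi(e)\in L(e)$ to each edge $e$ such that any two distinct edges sharing a vertex receive different colors. -}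

module Defs where

open import Data.Nat using (ℕ; _≤_; _*_; _^_; _∸_)
open import Data.Fin using (Fin)
open import Data.Fin.Subset using (Subset; _∈_; ∣_∣)
open import Data.Fin.Subset.Properties using (_∈?_)
open import Data.List using (List; length; filter; allFin)
open import Data.List.Membership.Propositional renaming (_∈_ to _∈ₗ_)
open import Data.Product using (_×_; ∃)
open import Relation.Nullary using (¬_)
open import Relation.Nullary.Decidable using (_×-dec_)
open import Relation.Binary.PropositionalEquality using (_≡_; _≢_)
open import Function.Definitions using (Injective)

record Hypergraph (n m : ℕ) : Set where
  field
    edge     : Fin m → Subset n
    distinct : Injective _≡_ _≡_ edge
open Hypergraph public

RBounded : ∀ {n m} → ℕ → Hypergraph n m → Set
RBounded r G = ∀ i → ∣ edge G i ∣ ≤ r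

degree : ∀ {n m} → Hypergraph n m → Fin n → ℕ
degree {m = m} G v = length (filter (λ i → v ∈? edge G i) (allFin m))

codegree : ∀ {n m} → Hypergraph n m → Fin n → Fin n → ℕ
codegree {m = m} G u v =
  length (filter (λ i → (u ∈? edge G i) ×-dec (v ∈? edge G i)) (allFin m))

Meet : ∀ {n m} → Hypergraph n m → Fin m → Fin m → Set
Meet G e f = ∃ λ v → v ∈ edge G e × v ∈ edge G f

IsLColoring : ∀ {n m} → (G : Hypergraph n m) → (Fin m → List ℕ) → (Fin m → ℕ) → Set
IsLColoring G L φ =
  (∀ e → φ e ∈ₗ L e) ×
  (∀ e f → e ≢ f → Meet G e f → φ e ≢ φ f)

{-# OPTIONS --safe #-}

-- D disjoint L-colorings of G are a single list edge-coloring of D copies of G in which all copies of an edge e are glued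
-- at a new vertex; this hypergraph is (r+1)-bounded, has maximum degree at most D, and its codegrees are still small. It is
-- coloured by the semi-random method. Let all lists have at least l colours, and let every colour be available at at most d
-- of the uncoloured edges at any vertex. In one round each pair (edge e, available colour c) is activated with probability
-- ε/l, independently. An edge is coloured by an activated c if no edge meeting it has c activated, and c is deleted from
-- the lists of all edges meeting an edge with c activated; additional coin flips make all survival probabilities equal.
-- With d = (1-g)l the list size shrinks by the factor 1 - Rε(1-g), and g grows by about the factor 1 + ε(1-g)/2, where
-- R = r+1. So l·g^(16R) never decreases while g grows from D^(-α) to almost 1, and l stays above D^(1-16Rα). Once d/l is
-- tiny, one more round colours every edge.
--
-- The rounds are controlled by the local lemma. The concentration it needs comes from k-th moments with k a small power
-- of D: the probability that k given edges at v all keep c and stay uncoloured is at most the k-th power of the one-edge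
-- probability, because for every other colour at most one of them can be coloured by it (the events exclude each other,
-- and 1 - kx ≤ (1-x)^k), while for c itself the small codegrees make their neighbourhoods nearly disjoint.
module Submission where

open import Data.Bool using (Bool; true; false; not; _∧_; _∨_; if_then_else_)
open import Data.Bool.ListAction using (any; all)
import Data.Bool.Properties as Bool
open import Data.Empty using (⊥-elim)
open import Data.List using (List; []; _∷_; length)
open import Data.List.Membership.Propositional using (_∈_)
open import Data.List.Relation.Unary.Any using (here; there)
open import Data.List.Relation.Unary.Unique.Propositional using (Unique)
open import Data.Nat as ℕ using (ℕ; zero; suc)
import Data.Nat.Properties as ℕ
open import Data.Product using (_×_; _,_; ∃; proj₁; proj₂)
import Data.Rational.Properties as ℚ
open import Data.Sum using (_⊎_; inj₁; inj₂)
open import Relation.Binary.PropositionalEquality hiding (J)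
open import Relation.Nullary.Decidable using (⌊_⌋; from-yes; yes; no)
open import Tactic.RingSolver using (solve-∀)

-- The surplus in the lists drives everything. If an edge at `v` activates `c`, all edges at `v`
-- lose `c` and the load of `c` at `v` drops to 0; such jumps would spoil any concentration, so the
-- load analysis ignores activations at `v` itself. This overestimates the survival of a pair by the
-- factor (1-θ)^(-d), about 1 + ε(1-g), where θ = ε/l. An edge stays uncoloured with probability
-- about 1 - ε, and the product of the two is about 1 - εg: loads shrink faster than lists only in
-- proportion to the gap g. Hence a gap must exist at the start, it grows slowly, and every error of
-- a round has to be below εg even when g is only D^(-α). Only upper tails occur: loads must not be
-- too large, and neither must the number of colours lost by an edge. One moment bound serves both.
-- Real powers are avoided. With an even integer S = 2s, where s is D^(1/b) rounded up, all small
-- quantities are powers of 1/S and α is 1/b; Bernoulli's inequality replaces estimates of the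
-- exponential function.

module Rationals where

  -- Rational arithmetic and Bernoulli-type inequalities

  open import Data.Rational public using (ℚ; 0ℚ; 1ℚ; ½; _+_; _*_; _-_; -_; _≤_; _<_)
  open import Data.Rational as ℚ using (nonNegative; positive)
  open import Data.Rational.Properties as ℚ public
    using (≤-refl; ≤-trans; ≤-reflexive; <⇒≤; +-mono-≤; +-monoʳ-≤; +-monoˡ-≤; *-comm; *-assoc; *-identityˡ; *-identityʳ;
           +-comm; +-assoc; +-identityˡ; +-identityʳ; *-zeroˡ; *-zeroʳ; *-distribˡ-+; *-distribʳ-+; <-≤-trans; ≤-<-trans; module ≤-Reasoning)
  open import Relation.Nullary.Decidable using (dec⇒maybe)
  open import Tactic.RingSolver.Core.AlmostCommutativeRing using (AlmostCommutativeRing; fromCommutativeRing)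

  ring : AlmostCommutativeRing _ _
  ring = fromCommutativeRing ℚ.+-*-commutativeRing (λ x → dec⇒maybe (0ℚ ℚ.≟ x))

  0≤1 : 0ℚ ≤ 1ℚ
  0≤1 = from-yes (0ℚ ℚ.≤? 1ℚ)

  0≤½ : 0ℚ ≤ ½
  0≤½ = from-yes (0ℚ ℚ.≤? ½)

  0<1 : 0ℚ < 1ℚ
  0<1 = from-yes (0ℚ ℚ.<? 1ℚ)

  0≤+ : ∀ {a b} → 0ℚ ≤ a → 0ℚ ≤ b → 0ℚ ≤ a + b
  0≤+ p q = +-mono-≤ p q

  *-monoʳ : ∀ {a b c} → 0ℚ ≤ c → a ≤ b → c * a ≤ c * b
  *-monoʳ {c = c} 0≤c = ℚ.*-monoˡ-≤-nonNeg c {{nonNegative 0≤c}}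

  *-monoˡ : ∀ {a b c} → 0ℚ ≤ c → a ≤ b → a * c ≤ b * c
  *-monoˡ {c = c} 0≤c = ℚ.*-monoʳ-≤-nonNeg c {{nonNegative 0≤c}}

  0≤* : ∀ {a b} → 0ℚ ≤ a → 0ℚ ≤ b → 0ℚ ≤ a * b
  0≤* {a} p q = ≤-trans (≤-reflexive (sym (*-zeroʳ a))) (*-monoʳ p q)

  0<* : ∀ {a b} → 0ℚ < a → 0ℚ < b → 0ℚ < a * b
  0<* {a} {b} p q = subst (_< a * b) (*-zeroʳ a) (ℚ.*-monoʳ-<-pos a {{positive p}} q)

  *-mono : ∀ {a b c d} → 0ℚ ≤ a → 0ℚ ≤ d → a ≤ b → c ≤ d → a * c ≤ b * d
  *-mono 0≤a 0≤d a≤b c≤d = ≤-trans (*-monoʳ 0≤a c≤d) (*-monoˡ 0≤d a≤b)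

  *-cancelʳ : ∀ {a b c} → 0ℚ < c → a * c ≤ b * c → a ≤ b
  *-cancelʳ {c = c} 0<c = ℚ.*-cancelʳ-≤-pos c {{positive 0<c}}

  diff : ∀ {a b} → a ≤ b → 0ℚ ≤ b - a
  diff {a} {b} a≤b = ≤-trans (≤-reflexive (sym (ℚ.+-inverseʳ a))) (+-monoˡ-≤ (- a) a≤b)

  from-diff : ∀ {a b} → 0ℚ ≤ b - a → a ≤ b
  from-diff {a} {b} h = ≤-trans (≤-reflexive (sym (+-identityʳ a))) (≤-trans (+-monoʳ-≤ a h) (≤-reflexive (e a b)))
    where
    e : ∀ a b → a + (b - a) ≡ b
    e = solve-∀ ring

  ≤-by : ∀ {a b} c → 0ℚ ≤ c → b - a ≡ c → a ≤ b
  ≤-by c 0≤c e = from-diff (subst (0ℚ ≤_) (sym e) 0≤c)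

  a≤a+b : ∀ {a b} → 0ℚ ≤ b → a ≤ a + b
  a≤a+b {a} h = ≤-trans (≤-reflexive (sym (+-identityʳ a))) (+-monoʳ-≤ a h)

  1-anti : ∀ {a b} → a ≤ b → 1ℚ - b ≤ 1ℚ - a
  1-anti h = +-monoʳ-≤ 1ℚ (ℚ.neg-antimono-≤ h)

  1-≤1 : ∀ {a} → 0ℚ ≤ a → 1ℚ - a ≤ 1ℚ
  1-≤1 h = ≤-trans (1-anti h) (≤-reflexive (+-identityʳ 1ℚ))

  <-by : ∀ {a b c} → 0ℚ < c → a + c ≤ b → a < b
  <-by {a} {b} {c} 0<c h =
    <-≤-trans (subst (_< a + c) (+-identityʳ a) (ℚ.+-monoʳ-< a 0<c)) h

  inverse : ∀ {q} → 0ℚ < q → ∃ λ r → 0ℚ < r × r * q ≡ 1ℚ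
  inverse {q} 0<q = (ℚ.1/ q) {{nz}} , ℚ.positive⁻¹ _ {{ℚ.1/pos⇒pos q {{ps}}}} , ℚ.*-inverseˡ q {{nz}}
    where
    ps = positive 0<q
    nz = ℚ.pos⇒nonZero q {{ps}}

  ι : ℕ → ℚ
  ι zero    = 0ℚ
  ι (suc n) = 1ℚ + ι n

  ι-+ : ∀ m n → ι (m ℕ.+ n) ≡ ι m + ι n
  ι-+ zero    n = sym (+-identityˡ (ι n))
  ι-+ (suc m) n = trans (cong (1ℚ +_) (ι-+ m n)) (sym (+-assoc 1ℚ (ι m) (ι n)))

  ι-* : ∀ m n → ι (m ℕ.* n) ≡ ι m * ι n
  ι-* zero    n = sym (*-zeroˡ (ι n))
  ι-* (suc m) n = trans (ι-+ n (m ℕ.* n)) (trans (cong (ι n +_) (ι-* m n)) (e (ι m) (ι n)))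
    where
    e : ∀ a b → b + a * b ≡ (1ℚ + a) * b
    e = solve-∀ ring

  0≤ι : ∀ n → 0ℚ ≤ ι n
  0≤ι zero    = ≤-refl
  0≤ι (suc n) = 0≤+ 0≤1 (0≤ι n)

  ι-mono : ∀ {m n} → m ℕ.≤ n → ι m ≤ ι n
  ι-mono {n = n} ℕ.z≤n = 0≤ι n
  ι-mono (ℕ.s≤s p)     = +-monoʳ-≤ 1ℚ (ι-mono p)

  1≤ι : ∀ {n} → 1 ℕ.≤ n → 1ℚ ≤ ι n
  1≤ι h = ≤-trans (≤-reflexive (sym (+-identityʳ 1ℚ))) (ι-mono h)

  0<ι : ∀ {n} → 0 ℕ.< n → 0ℚ < ι n
  0<ι h = <-≤-trans 0<1 (1≤ι h)

  ι-cancel : ∀ {m n} → ι m ≤ ι n → m ℕ.≤ n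
  ι-cancel {m} {n} h with m ℕ.≤? n
  ... | yes m≤n = m≤n
  ... | no  m≰n = ⊥-elim (ℚ.<-irrefl refl (<-≤-trans (<-by 0<1 (≤-trans (≤-reflexive (+-comm (ι n) 1ℚ)) (ι-mono (ℕ.≰⇒> m≰n)))) h))

  ι-floor : ∀ N {q} → 0ℚ ≤ q → q ≤ ι N → ∃ λ j → ι j ≤ q × q ≤ ι (suc j)
  ι-floor zero    0≤q q≤ = 0 , 0≤q , ≤-trans q≤ 0≤1
  ι-floor (suc N) {q} 0≤q q≤ with ℚ.≤-total q (ι N)
  ... | inj₁ q≤N = ι-floor N 0≤q q≤N
  ... | inj₂ N≤q = N , N≤q , q≤

  infixr 8 _^_
  _^_ : ℚ → ℕ → ℚ
  q ^ zero  = 1ℚ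
  q ^ suc n = q * q ^ n

  0≤^ : ∀ {q} n → 0ℚ ≤ q → 0ℚ ≤ q ^ n
  0≤^ zero    h = 0≤1
  0≤^ (suc n) h = 0≤* h (0≤^ n h)

  0<^ : ∀ {q} n → 0ℚ < q → 0ℚ < q ^ n
  0<^ zero    h = 0<1
  0<^ (suc n) h = 0<* h (0<^ n h)

  ^-mono : ∀ {p q} n → 0ℚ ≤ p → p ≤ q → p ^ n ≤ q ^ n
  ^-mono zero    h p≤q = ≤-refl
  ^-mono (suc n) h p≤q = *-mono h (0≤^ n (≤-trans h p≤q)) p≤q (^-mono n h p≤q)

  1^ : ∀ n → 1ℚ ^ n ≡ 1ℚ
  1^ zero    = refl
  1^ (suc n) = trans (*-identityˡ _) (1^ n)

  ^≤1 : ∀ {p} n → 0ℚ ≤ p → p ≤ 1ℚ → p ^ n ≤ 1ℚ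
  ^≤1 n h p≤1 = ≤-trans (^-mono n h p≤1) (≤-reflexive (1^ n))

  1≤^ : ∀ {p} n → 1ℚ ≤ p → 1ℚ ≤ p ^ n
  1≤^ n h = ≤-trans (≤-reflexive (sym (1^ n))) (^-mono n 0≤1 h)

  ^-+ : ∀ p m n → p ^ (m ℕ.+ n) ≡ p ^ m * p ^ n
  ^-+ p zero    n = sym (*-identityˡ _)
  ^-+ p (suc m) n = trans (cong (p *_) (^-+ p m n)) (sym (*-assoc p (p ^ m) (p ^ n)))

  ^-* : ∀ p m n → p ^ (m ℕ.* n) ≡ (p ^ n) ^ m
  ^-* p zero    n = refl
  ^-* p (suc m) n = trans (^-+ p n (m ℕ.* n)) (cong (p ^ n *_) (^-* p m n))

  *-^ : ∀ p q n → (p * q) ^ n ≡ p ^ n * q ^ n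
  *-^ p q zero    = refl
  *-^ p q (suc n) = trans (cong (p * q *_) (*-^ p q n)) (e p q (p ^ n) (q ^ n))
    where
    e : ∀ a b c d → a * b * (c * d) ≡ a * c * (b * d)
    e = solve-∀ ring

  ^-anti : ∀ {p m n} → 0ℚ ≤ p → p ≤ 1ℚ → m ℕ.≤ n → p ^ n ≤ p ^ m
  ^-anti {n = n} h k ℕ.z≤n = ^≤1 n h k
  ^-anti h k (ℕ.s≤s le)    = *-monoʳ h (^-anti h k le)

  ^-monoʳ : ∀ {p m n} → 1ℚ ≤ p → m ℕ.≤ n → p ^ m ≤ p ^ n
  ^-monoʳ {n = n} h ℕ.z≤n    = 1≤^ n h
  ^-monoʳ h (ℕ.s≤s le) = *-monoʳ (≤-trans 0≤1 h) (^-monoʳ h le)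

  ι-^ : ∀ m n → ι (m ℕ.^ n) ≡ ι m ^ n
  ι-^ m zero    = +-identityʳ 1ℚ
  ι-^ m (suc n) = trans (ι-* m (m ℕ.^ n)) (cong (ι m *_) (ι-^ m n))

  -- Multiplying by 1 + x ≥ 0 leaves the nonnegative excess n x². Negative `x` is allowed, and
  -- `bernoulli⁻` depends on that.
  bernoulli : ∀ x n → 0ℚ ≤ 1ℚ + x → 1ℚ + ι n * x ≤ (1ℚ + x) ^ n
  bernoulli x zero    h = ≤-reflexive (trans (cong (1ℚ +_) (*-zeroˡ x)) (+-identityʳ 1ℚ))
  bernoulli x (suc n) h = ≤-trans (≤-by (ι n * (x * x)) (0≤* (0≤ι n) (sq x)) (e (ι n) x)) (*-monoʳ h (bernoulli x n h))
    where
    e : ∀ m x → (1ℚ + x) * (1ℚ + m * x) - (1ℚ + (1ℚ + m) * x) ≡ m * (x * x)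
    e = solve-∀ ring
    sq : ∀ x → 0ℚ ≤ x * x
    sq x with ℚ.≤-total 0ℚ x
    ... | inj₁ p = 0≤* p p
    ... | inj₂ p = subst (0ℚ ≤_) (e2 x) (0≤* (ℚ.neg-antimono-≤ p) (ℚ.neg-antimono-≤ p))
      where
      e2 : ∀ x → (- x) * (- x) ≡ x * x
      e2 = solve-∀ ring

  bernoulli⁻ : ∀ x n → x ≤ 1ℚ → 1ℚ - ι n * x ≤ (1ℚ - x) ^ n
  bernoulli⁻ x n h = ≤-trans (≤-reflexive (e (ι n) x)) (bernoulli (- x) n (diff h))
    where
    e : ∀ m x → 1ℚ - m * x ≡ 1ℚ + m * (- x)
    e = solve-∀ ring

  -- The rational substitute for (1-x)^n ≤ exp(-nx): apply Bernoulli to 1 + x and use (1+x)(1-x) ≤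
  -- 1.
  ^-decay : ∀ x n → 0ℚ ≤ x → x ≤ 1ℚ → (1ℚ + ι n * x) * (1ℚ - x) ^ n ≤ 1ℚ
  ^-decay x n 0≤x x≤1 = begin
    (1ℚ + ι n * x) * (1ℚ - x) ^ n ≤⟨ *-monoˡ (0≤^ n (diff x≤1)) (bernoulli x n (0≤+ 0≤1 0≤x)) ⟩
    (1ℚ + x) ^ n * (1ℚ - x) ^ n ≡⟨ *-^ (1ℚ + x) (1ℚ - x) n ⟨
    ((1ℚ + x) * (1ℚ - x)) ^ n ≤⟨ ^≤1 n (0≤* (0≤+ 0≤1 0≤x) (diff x≤1)) (≤-by (x * x) (0≤* 0≤x 0≤x) (e x)) ⟩
    1ℚ ∎
    where
    open ≤-Reasoning
    e : ∀ x → 1ℚ - (1ℚ + x) * (1ℚ - x) ≡ x * x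
    e = solve-∀ ring

-- Finite sums, products, indicators and counting

module Sums where

  open Rationals

  private variable
    A B : Set

  ∧₁ : ∀ a {b} → a ∧ b ≡ true → a ≡ true
  ∧₁ true e = refl

  ∧₂ : ∀ a {b} → a ∧ b ≡ true → b ≡ true
  ∧₂ true e = e

  ∧-intro : ∀ {a b} → a ≡ true → b ≡ true → a ∧ b ≡ true
  ∧-intro refl refl = refl

  ∨-introˡ : ∀ {a b} → a ≡ true → a ∨ b ≡ true
  ∨-introˡ refl = refl

  ∨-introʳ : ∀ {a b} → b ≡ true → a ∨ b ≡ true
  ∨-introʳ {true}  _ = refl
  ∨-introʳ {false} e = e

  not-true : ∀ {a} → not a ≡ true → a ≡ false
  not-true {false} _ = refl

  true≢false : {P : Set} {a : Bool} → a ≡ true → a ≡ false → P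
  true≢false refl ()

  any-true : (p : A → Bool) (xs : List A) → any p xs ≡ true → ∃ λ x → x ∈ xs × p x ≡ true
  any-true p (x ∷ xs) e with p x in px
  ... | true  = x , here refl , px
  ... | false = let y , y∈ , py = any-true p xs e in y , there y∈ , py

  any-intro : (p : A → Bool) {xs : List A} {x : A} → x ∈ xs → p x ≡ true → any p xs ≡ true
  any-intro p (here refl) e rewrite e = refl
  any-intro p (there i)   e = ∨-introʳ (any-intro p i e)

  any-false : (p : A → Bool) {xs : List A} {x : A} → any p xs ≡ false → x ∈ xs → p x ≡ false
  any-false p {x = x} e i with p x in px
  ... | false = refl
  ... | true  = true≢false (any-intro p i px) e

  all-true : (p : A → Bool) {xs : List A} {x : A} → all p xs ≡ true → x ∈ xs → p x ≡ true
  all-true p {x ∷ _} e (here refl) = ∧₁ (p x) e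
  all-true p {x ∷ _} e (there i)   = all-true p (∧₂ (p x) e) i

  opaque
    _<ᵇ_ : ℚ → ℚ → Bool
    a <ᵇ b = ⌊ a ℚ.<? b ⌋

    <ᵇ-true : ∀ {a b} → a <ᵇ b ≡ true → a < b
    <ᵇ-true {a} {b} e with a ℚ.<? b
    ... | yes p = p

    <ᵇ-false : ∀ {a b} → a <ᵇ b ≡ false → b ≤ a
    <ᵇ-false {a} {b} e with a ℚ.<? b
    ... | no p = ℚ.≮⇒≥ p

  ∑ : List A → (A → ℚ) → ℚ
  ∑ []       f = 0ℚ
  ∑ (x ∷ xs) f = f x + ∑ xs f

  ∏ : List A → (A → ℚ) → ℚ
  ∏ []       f = 1ℚ
  ∏ (x ∷ xs) f = f x * ∏ xs f

  ind : Bool → ℚ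
  ind true  = 1ℚ
  ind false = 0ℚ

  cnt : List A → (A → Bool) → ℕ
  cnt []       p = 0
  cnt (x ∷ xs) p = (if p x then 1 else 0) ℕ.+ cnt xs p

  ∑-cong : (xs : List A) {f g : A → ℚ} → (∀ x → f x ≡ g x) → ∑ xs f ≡ ∑ xs g
  ∑-cong []       h = refl
  ∑-cong (x ∷ xs) h = cong₂ _+_ (h x) (∑-cong xs h)

  ∑-mono : (xs : List A) {f g : A → ℚ} → (∀ x → f x ≤ g x) → ∑ xs f ≤ ∑ xs g
  ∑-mono []       h = ≤-refl
  ∑-mono (x ∷ xs) h = +-mono-≤ (h x) (∑-mono xs h)

  ∑-+ : (xs : List A) (f g : A → ℚ) → ∑ xs (λ x → f x + g x) ≡ ∑ xs f + ∑ xs g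
  ∑-+ []       f g = refl
  ∑-+ (x ∷ xs) f g = trans (cong (f x + g x +_) (∑-+ xs f g)) (e (f x) (g x) (∑ xs f) (∑ xs g))
    where
    e : ∀ a b c d → a + b + (c + d) ≡ a + c + (b + d)
    e = solve-∀ ring

  ∑-*ʳ : (xs : List A) (f : A → ℚ) (c : ℚ) → ∑ xs (λ x → f x * c) ≡ ∑ xs f * c
  ∑-*ʳ []       f c = sym (*-zeroˡ c)
  ∑-*ʳ (x ∷ xs) f c = trans (cong (f x * c +_) (∑-*ʳ xs f c)) (sym (*-distribʳ-+ c (f x) (∑ xs f)))

  0≤∑ : (xs : List A) {f : A → ℚ} → (∀ x → 0ℚ ≤ f x) → 0ℚ ≤ ∑ xs f
  0≤∑ []       h = ≤-refl
  0≤∑ (x ∷ xs) h = 0≤+ (h x) (0≤∑ xs h)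

  ∏-cong : (xs : List A) {f g : A → ℚ} → (∀ x → f x ≡ g x) → ∏ xs f ≡ ∏ xs g
  ∏-cong []       h = refl
  ∏-cong (x ∷ xs) h = cong₂ _*_ (h x) (∏-cong xs h)

  0≤∏ : (xs : List A) {f : A → ℚ} → (∀ x → 0ℚ ≤ f x) → 0ℚ ≤ ∏ xs f
  0≤∏ []       h = 0≤1
  0≤∏ (x ∷ xs) h = 0≤* (h x) (0≤∏ xs h)

  ∏-mono : (xs : List A) {f g : A → ℚ} → (∀ x → 0ℚ ≤ f x) → (∀ x → f x ≤ g x) → ∏ xs f ≤ ∏ xs g
  ∏-mono []       0≤f h = ≤-refl
  ∏-mono (x ∷ xs) 0≤f h = *-mono (0≤f x) (0≤∏ xs (λ y → ≤-trans (0≤f y) (h y))) (h x) (∏-mono xs 0≤f h)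

  ∏-* : (xs : List A) (f g : A → ℚ) → ∏ xs (λ x → f x * g x) ≡ ∏ xs f * ∏ xs g
  ∏-* []       f g = refl
  ∏-* (x ∷ xs) f g = trans (cong (f x * g x *_) (∏-* xs f g)) (e (f x) (g x) (∏ xs f) (∏ xs g))
    where
    e : ∀ a b c d → a * b * (c * d) ≡ a * c * (b * d)
    e = solve-∀ ring

  ∏-1 : (xs : List A) → ∏ xs (λ _ → 1ℚ) ≡ 1ℚ
  ∏-1 []       = refl
  ∏-1 (x ∷ xs) = trans (*-identityˡ _) (∏-1 xs)

  ∏-swap : (xs : List A) (ys : List B) (f : A → B → ℚ) → ∏ xs (λ x → ∏ ys (f x)) ≡ ∏ ys (λ y → ∏ xs (λ x → f x y))
  ∏-swap []       ys f = sym (∏-1 ys)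
  ∏-swap (x ∷ xs) ys f = trans (cong (∏ ys (f x) *_) (∏-swap xs ys f)) (sym (∏-* ys (f x) _))

  ∏≤1 : (xs : List A) {f : A → ℚ} → (∀ x → 0ℚ ≤ f x) → (∀ x → f x ≤ 1ℚ) → ∏ xs f ≤ 1ℚ
  ∏≤1 xs 0≤f h = ≤-trans (∏-mono xs 0≤f h) (≤-reflexive (∏-1 xs))

  ∏-const : (xs : List A) (q : ℚ) → ∏ xs (λ _ → q) ≡ q ^ length xs
  ∏-const []       q = refl
  ∏-const (x ∷ xs) q = cong (q *_) (∏-const xs q)

  0≤ind : ∀ b → 0ℚ ≤ ind b
  0≤ind true  = 0≤1
  0≤ind false = ≤-refl

  ind≤1 : ∀ b → ind b ≤ 1ℚ
  ind≤1 true  = ≤-refl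
  ind≤1 false = 0≤1

  ind-∧ : ∀ a b → ind (a ∧ b) ≡ ind a * ind b
  ind-∧ true  b = sym (*-identityˡ (ind b))
  ind-∧ false b = sym (*-zeroˡ (ind b))

  ind-∨ : ∀ a b → ind (a ∨ b) ≤ ind a + ind b
  ind-∨ true  b = a≤a+b (0≤ind b)
  ind-∨ false b = ≤-reflexive (sym (+-identityˡ (ind b)))

  ind-not : ∀ a → ind (not a) ≡ 1ℚ - ind a
  ind-not true  = refl
  ind-not false = refl

  ind-≤ : ∀ {b q} → 0ℚ ≤ q → (b ≡ true → 1ℚ ≤ q) → ind b ≤ q
  ind-≤ {true}  0≤q h = h refl
  ind-≤ {false} 0≤q h = 0≤q

  ind-any : (p : A → Bool) (xs : List A) → ind (any p xs) ≤ ∑ xs (λ x → ind (p x))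
  ind-any p []       = ≤-refl
  ind-any p (x ∷ xs) = ≤-trans (ind-∨ (p x) _) (+-monoʳ-≤ (ind (p x)) (ind-any p xs))

  ind-all : (p : A → Bool) (xs : List A) → ind (all p xs) ≡ ∏ xs (λ x → ind (p x))
  ind-all p []       = refl
  ind-all p (x ∷ xs) = trans (ind-∧ (p x) _) (cong (ind (p x) *_) (ind-all p xs))

  ι-cnt : (xs : List A) (p : A → Bool) → ι (cnt xs p) ≡ ∑ xs (λ x → ind (p x))
  ι-cnt []       p = refl
  ι-cnt (x ∷ xs) p with p x
  ... | true  = cong (1ℚ +_) (ι-cnt xs p)
  ... | false = trans (ι-cnt xs p) (sym (+-identityˡ _))

  ∏-if : (xs : List A) (p : A → Bool) (q : ℚ) → ∏ xs (λ x → if p x then q else 1ℚ) ≡ q ^ cnt xs p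
  ∏-if []       p q = refl
  ∏-if (x ∷ xs) p q with p x
  ... | true  = cong (q *_) (∏-if xs p q)
  ... | false = trans (*-identityˡ _) (∏-if xs p q)

  cnt-mono : (xs : List A) {p q : A → Bool} → (∀ x → p x ≡ true → q x ≡ true) → cnt xs p ℕ.≤ cnt xs q
  cnt-mono []       h = ℕ.z≤n
  cnt-mono (x ∷ xs) {p} {q} h with p x in px | q x in qx
  ... | true  | true  = ℕ.s≤s (cnt-mono xs h)
  ... | true  | false = true≢false (h x px) qx
  ... | false | true  = ℕ.m≤n⇒m≤1+n (cnt-mono xs h)
  ... | false | false = cnt-mono xs h

  cnt-∨ : (xs : List A) (p q : A → Bool) → cnt xs (λ x → p x ∨ q x) ℕ.≤ cnt xs p ℕ.+ cnt xs q
  cnt-∨ []       p q = ℕ.z≤n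
  cnt-∨ (x ∷ xs) p q with p x | q x
  ... | true  | true  = ℕ.s≤s (ℕ.≤-trans (cnt-∨ xs p q) (ℕ.+-monoʳ-≤ (cnt xs p) (ℕ.n≤1+n _)))
  ... | true  | false = ℕ.s≤s (cnt-∨ xs p q)
  ... | false | true  = subst (suc (cnt xs (λ x → p x ∨ q x)) ℕ.≤_) (sym (ℕ.+-suc (cnt xs p) (cnt xs q))) (ℕ.s≤s (cnt-∨ xs p q))
  ... | false | false = cnt-∨ xs p q

  cnt-∨-∧ : (xs : List A) (p q : A → Bool) → cnt xs p ℕ.+ cnt xs q ℕ.≤ cnt xs (λ x → p x ∨ q x) ℕ.+ cnt xs (λ x → p x ∧ q x)
  cnt-∨-∧ []       p q = ℕ.z≤n
  cnt-∨-∧ (x ∷ xs) p q with p x | q x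
  ... | true  | true  = ℕ.s≤s (subst₂ ℕ._≤_ (sym (ℕ.+-suc (cnt xs p) (cnt xs q))) (sym (ℕ.+-suc _ _)) (ℕ.s≤s (cnt-∨-∧ xs p q)))
  ... | true  | false = ℕ.s≤s (cnt-∨-∧ xs p q)
  ... | false | true  = ℕ.≤-trans (ℕ.≤-reflexive (ℕ.+-suc (cnt xs p) (cnt xs q))) (ℕ.s≤s (cnt-∨-∧ xs p q))
  ... | false | false = cnt-∨-∧ xs p q

  cnt-false : (xs : List A) → cnt xs (λ _ → false) ≡ 0
  cnt-false []       = refl
  cnt-false (x ∷ xs) = cnt-false xs

  cnt≤length : (xs : List A) (p : A → Bool) → cnt xs p ℕ.≤ length xs
  cnt≤length []       p = ℕ.z≤n
  cnt≤length (x ∷ xs) p with p x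
  ... | true  = ℕ.s≤s (cnt≤length xs p)
  ... | false = ℕ.m≤n⇒m≤1+n (cnt≤length xs p)

  cnt-any : (xs : List A) (ys : List B) (q : B → A → Bool) {k : ℕ} → (∀ y → cnt xs (q y) ℕ.≤ k) →
            cnt xs (λ x → any (λ y → q y x) ys) ℕ.≤ length ys ℕ.* k
  cnt-any xs []       q h = ℕ.≤-reflexive (cnt-false xs)
  cnt-any xs (y ∷ ys) q h = ℕ.≤-trans (cnt-∨ xs (q y) _) (ℕ.+-mono-≤ (h y) (cnt-any xs ys q h))

  cnt-any-∧ : (xs : List A) (ys : List B) (p : B → Bool) (q : B → A → Bool) {k : ℕ} → (∀ y → cnt xs (q y) ℕ.≤ k) →
              cnt xs (λ x → any (λ y → p y ∧ q y x) ys) ℕ.≤ cnt ys p ℕ.* k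
  cnt-any-∧ xs []       p q h = ℕ.≤-reflexive (cnt-false xs)
  cnt-any-∧ xs (y ∷ ys) p q h with p y
  ... | true  = ℕ.≤-trans (cnt-∨ xs (q y) _) (ℕ.+-mono-≤ (h y) (cnt-any-∧ xs ys p q h))
  ... | false = cnt-any-∧ xs ys p q h

  ∑-ind-* : (xs : List A) (p : A → Bool) {f : A → ℚ} {c : ℚ} → (∀ x → p x ≡ true → f x ≤ c) →
            ∑ xs (λ x → ind (p x) * f x) ≤ ι (cnt xs p) * c
  ∑-ind-* xs p {f} {c} h = begin
    ∑ xs (λ x → ind (p x) * f x) ≤⟨ ∑-mono xs termwise ⟩
    ∑ xs (λ x → ind (p x) * c) ≡⟨ ∑-*ʳ xs _ c ⟩
    ∑ xs (λ x → ind (p x)) * c ≡⟨ cong (_* c) (ι-cnt xs p) ⟨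
    ι (cnt xs p) * c ∎
    where
    open ≤-Reasoning
    termwise : ∀ x → ind (p x) * f x ≤ ind (p x) * c
    termwise x with p x in px
    ... | true  = *-monoʳ 0≤1 (h x px)
    ... | false = ≤-reflexive (trans (*-zeroˡ (f x)) (sym (*-zeroˡ c)))

  ∑-≤-length : (xs : List A) {f : A → ℚ} {c : ℚ} → (∀ {x} → x ∈ xs → f x ≤ c) → ∑ xs f ≤ ι (length xs) * c
  ∑-≤-length []       {c = c} h = ≤-reflexive (sym (*-zeroˡ c))
  ∑-≤-length (x ∷ xs) {c = c} h = ≤-trans (+-mono-≤ (h (here refl)) (∑-≤-length xs (λ i → h (there i)))) (≤-reflexive (e c (ι (length xs))))
    where
    e : ∀ c l → c + l * c ≡ (1ℚ + l) * c
    e = solve-∀ ring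

-- Expectation and independence for finitely many biased bits

module Expectation where

  open import Data.Fin using (Fin; zero; suc)
  open import Data.List.Relation.Unary.All as All using (All)
  open import Data.List.Relation.Unary.AllPairs using ([]; _∷_)
  open import Data.Vec using (Vec; []; _∷_; lookup)
  open Rationals
  open Sums

  module Cube where

    average : ℚ → ℚ → ℚ → ℚ
    average t a b = t * a + (1ℚ - t) * b

    tl : ∀ {N} → (Fin (suc N) → ℚ) → Fin N → ℚ
    tl θ i = θ (suc i)

    -- The product measure with success probabilities `θ`, evaluated by conditioning on one bit
    -- after the other, so that every identity below is an induction on the number of bits.
    E : ∀ {N} → (Fin N → ℚ) → (Vec Bool N → ℚ) → ℚ
    E {zero}  θ f = f []
    E {suc N} θ f = average (θ zero) (E (tl θ) (λ ω → f (true ∷ ω))) (E (tl θ) (λ ω → f (false ∷ ω)))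

    E-cong : ∀ {N} (θ : Fin N → ℚ) {f g} → (∀ ω → f ω ≡ g ω) → E θ f ≡ E θ g
    E-cong {zero}  θ h = h []
    E-cong {suc N} θ h = cong₂ (average (θ zero))
      (E-cong _ (λ ω → h (true ∷ ω))) (E-cong _ (λ ω → h (false ∷ ω)))

    E-mono : ∀ {N} (θ : Fin N → ℚ) → (∀ i → 0ℚ ≤ θ i) → (∀ i → θ i ≤ 1ℚ) → ∀ {f g} → (∀ ω → f ω ≤ g ω) → E θ f ≤ E θ g
    E-mono {zero}  θ l u h = h []
    E-mono {suc N} θ l u h = +-mono-≤
      (*-monoʳ (l zero) (E-mono _ (λ i → l (suc i)) (λ i → u (suc i)) (λ ω → h (true ∷ ω))))
      (*-monoʳ (diff (u zero)) (E-mono _ (λ i → l (suc i)) (λ i → u (suc i)) (λ ω → h (false ∷ ω))))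

    E-const : ∀ {N} (θ : Fin N → ℚ) c → E θ (λ _ → c) ≡ c
    E-const {zero}  θ c = refl
    E-const {suc N} θ c = trans (cong₂ (average (θ zero)) (E-const (tl θ) c) (E-const (tl θ) c)) (e (θ zero) c)
      where
      e : ∀ t c → t * c + (1ℚ - t) * c ≡ c
      e = solve-∀ ring

    E-+ : ∀ {N} (θ : Fin N → ℚ) f g → E θ (λ ω → f ω + g ω) ≡ E θ f + E θ g
    E-+ {zero}  θ f g = refl
    E-+ {suc N} θ f g = trans (cong₂ (average (θ zero)) (E-+ (tl θ) _ _) (E-+ (tl θ) _ _)) (e (θ zero) _ _ _ _)
      where
      e : ∀ t a b c d → t * (a + b) + (1ℚ - t) * (c + d) ≡ t * a + (1ℚ - t) * c + (t * b + (1ℚ - t) * d)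
      e = solve-∀ ring

    E-*ˡ : ∀ {N} (θ : Fin N → ℚ) c f → E θ (λ ω → c * f ω) ≡ c * E θ f
    E-*ˡ {zero}  θ c f = refl
    E-*ˡ {suc N} θ c f = trans (cong₂ (average (θ zero)) (E-*ˡ (tl θ) c _) (E-*ˡ (tl θ) c _)) (e (θ zero) c _ _)
      where
      e : ∀ t c a b → t * (c * a) + (1ℚ - t) * (c * b) ≡ c * (t * a + (1ℚ - t) * b)
      e = solve-∀ ring

    E-lookup : ∀ {N} (θ : Fin N → ℚ) i (F : Bool → ℚ) → E θ (λ ω → F (lookup ω i)) ≡ θ i * F true + (1ℚ - θ i) * F false
    E-lookup {suc N} θ zero    F = cong₂ (average (θ zero)) (E-const (tl θ) (F true)) (E-const (tl θ) (F false))
    E-lookup {suc N} θ (suc i) F = trans (cong₂ (average (θ zero)) (E-lookup (tl θ) i F) (E-lookup (tl θ) i F)) (e (θ zero) _)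
      where
      e : ∀ t c → t * c + (1ℚ - t) * c ≡ c
      e = solve-∀ ring

    DependsOn : ∀ {N} {B : Set} → (Fin N → Bool) → (Vec Bool N → B) → Set
    DependsOn S f = ∀ ω ω' → (∀ i → S i ≡ true → lookup ω i ≡ lookup ω' i) → f ω ≡ f ω'

    -- The first bit is seen by at most one of the two functions. For the other one both conditional
    -- expectations agree (`flip`), so it factors out of the average.
    E-indep : ∀ {N} (θ : Fin N → ℚ) (S : Fin N → Bool) f g → DependsOn S f → DependsOn (λ i → not (S i)) g →
              E θ (λ ω → f ω * g ω) ≡ E θ f * E θ g
    E-indep {zero}  θ S f g df dg = refl
    E-indep {suc N} θ S f g df dg = helper (S zero) refl
      where
      θ' = tl θ
      tail-dep : ∀ (T : Fin (suc N) → Bool) h → DependsOn T h → ∀ b → DependsOn (λ i → T (suc i)) (λ ω → h (b ∷ ω))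
      tail-dep T h dh b ω ω' eq = dh _ _ λ { zero _ → refl ; (suc i) s → eq i s }
      tails : ∀ b → E θ' (λ ω → f (b ∷ ω) * g (b ∷ ω)) ≡ E θ' (λ ω → f (b ∷ ω)) * E θ' (λ ω → g (b ∷ ω))
      tails b = E-indep θ' (λ i → S (suc i)) _ _ (tail-dep S f df b) (tail-dep (λ i → not (S i)) g dg b)
      flip : ∀ (T : Fin (suc N) → Bool) h → DependsOn T h → T zero ≡ false → E θ' (λ ω → h (false ∷ ω)) ≡ E θ' (λ ω → h (true ∷ ω))
      flip T h dh T0 = E-cong θ' λ ω → dh _ _ λ { zero s → true≢false s T0 ; (suc i) _ → refl }
      helper : ∀ b → S zero ≡ b → E θ (λ ω → f ω * g ω) ≡ E θ f * E θ g
      helper true  S0 = trans (cong₂ (average (θ zero)) (tails true) (tails false))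
                        (e (θ zero) _ _ _ _ (flip _ g dg (cong not S0)))
        where
        e : ∀ t a b c d → d ≡ b → t * (a * b) + (1ℚ - t) * (c * d) ≡ (t * a + (1ℚ - t) * c) * (t * b + (1ℚ - t) * d)
        e t a b c _ refl = p t a b c
          where
          p : ∀ t a b c → t * (a * b) + (1ℚ - t) * (c * b) ≡ (t * a + (1ℚ - t) * c) * (t * b + (1ℚ - t) * b)
          p = solve-∀ ring
      helper false S0 = trans (cong₂ (average (θ zero)) (tails true) (tails false))
                        (e (θ zero) _ _ _ _ (flip _ f df S0))
        where
        e : ∀ t a b c d → c ≡ a → t * (a * b) + (1ℚ - t) * (c * d) ≡ (t * a + (1ℚ - t) * c) * (t * b + (1ℚ - t) * d)
        e t a b _ d refl = p t a b d
          where
          p : ∀ t a b d → t * (a * b) + (1ℚ - t) * (a * d) ≡ (t * a + (1ℚ - t) * a) * (t * b + (1ℚ - t) * d)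
          p = solve-∀ ring

    -- The probabilistic method: an average of two nonpositive conditional expectations is not
    -- positive, so one half of the cube can always be chosen.
    E-exists : ∀ {N} (θ : Fin N → ℚ) → (∀ i → 0ℚ ≤ θ i) → (∀ i → θ i ≤ 1ℚ) → ∀ f → 0ℚ < E θ f → ∃ λ ω → 0ℚ < f ω
    E-exists {zero}  θ l u f h = [] , h
    E-exists {suc N} θ l u f h with 0ℚ ℚ.<? E (tl θ) (λ ω → f (true ∷ ω)) | 0ℚ ℚ.<? E (tl θ) (λ ω → f (false ∷ ω))
    ... | yes p | _ = let ω , q = E-exists _ (λ i → l (suc i)) (λ i → u (suc i)) _ p in true ∷ ω , q
    ... | no _  | yes p = let ω , q = E-exists _ (λ i → l (suc i)) (λ i → u (suc i)) _ p in false ∷ ω , q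
    ... | no p  | no q = ⊥-elim (ℚ.<-irrefl refl (<-≤-trans h (≤-trans (+-mono-≤ (nonpos (l zero) (ℚ.≮⇒≥ p)) (nonpos (diff (u zero)) (ℚ.≮⇒≥ q))) (≤-reflexive (+-identityˡ 0ℚ)))))
      where
      nonpos : ∀ {a b} → 0ℚ ≤ a → b ≤ 0ℚ → a * b ≤ 0ℚ
      nonpos {a} h k = ≤-trans (*-monoʳ h k) (≤-reflexive (*-zeroʳ a))

  -- Only `dec` after `enc` has to be the identity, which makes `enc` injective. Coordinates outside
  -- its image would merely be bits that no `bit` reads.
  record BitSpace : Set₁ where
    field
      I       : Set
      N       : ℕ
      enc     : I → Fin N
      dec     : Fin N → I
      dec-enc : ∀ x → dec (enc x) ≡ x
      pr      : I → ℚ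
      0≤pr    : ∀ x → 0ℚ ≤ pr x
      pr≤1    : ∀ x → pr x ≤ 1ℚ

  module Space (X : BitSpace) where
    open BitSpace X public

    Ω : Set
    Ω = Vec Bool N

    bit : I → Ω → Bool
    bit x ω = lookup ω (enc x)

    opaque
      𝔼 : (Ω → ℚ) → ℚ
      𝔼 = Cube.E (λ i → pr (dec i))

    DependsOn : {B : Set} → (I → Bool) → (Ω → B) → Set
    DependsOn S f = ∀ ω ω' → (∀ x → S x ≡ true → bit x ω ≡ bit x ω') → f ω ≡ f ω'

    opaque
      unfolding 𝔼

      𝔼-cong : ∀ {f g} → (∀ ω → f ω ≡ g ω) → 𝔼 f ≡ 𝔼 g
      𝔼-cong = Cube.E-cong _

      𝔼-mono : ∀ {f g} → (∀ ω → f ω ≤ g ω) → 𝔼 f ≤ 𝔼 g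
      𝔼-mono = Cube.E-mono _ (λ i → 0≤pr (dec i)) (λ i → pr≤1 (dec i))

      𝔼-const : ∀ c → 𝔼 (λ _ → c) ≡ c
      𝔼-const = Cube.E-const (λ i → pr (dec i))

      𝔼-+ : ∀ f g → 𝔼 (λ ω → f ω + g ω) ≡ 𝔼 f + 𝔼 g
      𝔼-+ = Cube.E-+ _

      𝔼-*ˡ : ∀ c f → 𝔼 (λ ω → c * f ω) ≡ c * 𝔼 f
      𝔼-*ˡ = Cube.E-*ˡ _

      𝔼-bit : ∀ x (F : Bool → ℚ) → 𝔼 (λ ω → F (bit x ω)) ≡ pr x * F true + (1ℚ - pr x) * F false
      𝔼-bit x F = trans (Cube.E-lookup _ (enc x) F) (cong (λ y → pr y * F true + (1ℚ - pr y) * F false) (dec-enc x))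

      𝔼-exists : ∀ f → 0ℚ < 𝔼 f → ∃ λ ω → 0ℚ < f ω
      𝔼-exists = Cube.E-exists _ (λ i → 0≤pr (dec i)) (λ i → pr≤1 (dec i))

      𝔼-indep : ∀ S {f g} → DependsOn S f → DependsOn (λ x → not (S x)) g → 𝔼 (λ ω → f ω * g ω) ≡ 𝔼 f * 𝔼 g
      𝔼-indep S {f} {g} df dg = Cube.E-indep _ (λ i → S (dec i)) _ _ (transfer S f df) (transfer (λ x → not (S x)) g dg)
        where
        transfer : ∀ T (h : Ω → ℚ) → DependsOn T h → Cube.DependsOn (λ i → T (dec i)) h
        transfer T h dh ω ω' eq = dh ω ω' λ x Tx → eq (enc x) (trans (cong T (dec-enc x)) Tx)

    0≤𝔼 : ∀ {f} → (∀ ω → 0ℚ ≤ f ω) → 0ℚ ≤ 𝔼 f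
    0≤𝔼 h = ≤-trans (≤-reflexive (sym (𝔼-const 0ℚ))) (𝔼-mono h)

    𝔼-∑ : {A : Set} (xs : List A) (f : A → Ω → ℚ) → 𝔼 (λ ω → ∑ xs (λ x → f x ω)) ≡ ∑ xs (λ x → 𝔼 (f x))
    𝔼-∑ []       f = 𝔼-const 0ℚ
    𝔼-∑ (x ∷ xs) f = trans (𝔼-+ (f x) (λ ω → ∑ xs (λ y → f y ω))) (cong (𝔼 (f x) +_) (𝔼-∑ xs f))

    𝔼-1- : ∀ f → 𝔼 (λ ω → 1ℚ - f ω) ≡ 1ℚ - 𝔼 f
    𝔼-1- f = trans (𝔼-cong (λ ω → e (f ω))) (trans (𝔼-+ (λ _ → 1ℚ) _) (trans (cong₂ _+_ (𝔼-const 1ℚ) (𝔼-*ˡ (- 1ℚ) f)) (sym (e (𝔼 f)))))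
      where
      e : ∀ a → 1ℚ - a ≡ 1ℚ + (- 1ℚ) * a
      e = solve-∀ ring

    weaken : ∀ {B : Set} {S T : I → Bool} {f : Ω → B} → (∀ x → S x ≡ true → T x ≡ true) → DependsOn S f → DependsOn T f
    weaken S⊆T df ω ω' eq = df ω ω' λ x Sx → eq x (S⊆T x Sx)

    ∏-dep : ∀ {A : Set} {S} (xs : List A) {g : A → Ω → ℚ} → (∀ {x} → x ∈ xs → DependsOn S (g x)) → DependsOn S (λ ω → ∏ xs (λ x → g x ω))
    ∏-dep []       h ω ω' eq = refl
    ∏-dep (x ∷ xs) h ω ω' eq = cong₂ _*_ (h (here refl) ω ω' eq) (∏-dep xs (λ i → h (there i)) ω ω' eq)

    𝔼-∏ : ∀ {A : Set} {xs : List A} (S : A → I → Bool) {g : A → Ω → ℚ} → Unique xs → (∀ x → DependsOn (S x) (g x)) →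
          (∀ {x y} → x ≢ y → ∀ i → S y i ≡ true → S x i ≡ false) → 𝔼 (λ ω → ∏ xs (λ x → g x ω)) ≡ ∏ xs (λ x → 𝔼 (g x))
    𝔼-∏ S []                   dg disj = 𝔼-const 1ℚ
    𝔼-∏ {xs = x ∷ xs} S {g} (x∉ ∷ u) dg disj = trans
      (𝔼-indep (S x) (dg x) (∏-dep xs (λ {y} y∈ → weaken (λ i Syi → cong not (disj (All.lookup x∉ y∈) i Syi)) (dg y))))
      (cong (𝔼 (g x) *_) (𝔼-∏ S u dg disj))

-- The symmetric Lovász local lemma

module LocalLemma where

  open import Data.List using (filterᵇ)
  open Rationals
  open Sums
  open Expectation

  private variable
    A : Set

  length-filterᵇ : (p : A → Bool) (xs : List A) → length (filterᵇ p xs) ≡ cnt xs p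
  length-filterᵇ p []       = refl
  length-filterᵇ p (x ∷ xs) with p x
  ... | true  = cong suc (length-filterᵇ p xs)
  ... | false = length-filterᵇ p xs

  length-filterᵇ-split : (p : A → Bool) (xs : List A) → length (filterᵇ p xs) ℕ.+ length (filterᵇ (λ x → not (p x)) xs) ≡ length xs
  length-filterᵇ-split p []       = refl
  length-filterᵇ-split p (x ∷ xs) with p x
  ... | true  = cong suc (length-filterᵇ-split p xs)
  ... | false = trans (ℕ.+-suc _ _) (cong suc (length-filterᵇ-split p xs))

  cnt-filterᵇ : (p q : A → Bool) (xs : List A) → cnt (filterᵇ p xs) q ℕ.≤ cnt xs q
  cnt-filterᵇ p q []       = ℕ.z≤n
  cnt-filterᵇ p q (x ∷ xs) with p x
  ... | true  = ℕ.+-monoʳ-≤ _ (cnt-filterᵇ p q xs)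
  ... | false = ℕ.≤-trans (cnt-filterᵇ p q xs) (ℕ.m≤n+m _ _)

  ∈-filterᵇ : (p : A → Bool) (xs : List A) {x : A} → x ∈ filterᵇ p xs → p x ≡ true
  ∈-filterᵇ p (y ∷ ys) i with p y in py
  ∈-filterᵇ p (y ∷ ys) (here refl) | true = py
  ∈-filterᵇ p (y ∷ ys) (there i)   | true = ∈-filterᵇ p ys i
  ∈-filterᵇ p (y ∷ ys) i           | false = ∈-filterᵇ p ys i

  module _ (X : BitSpace) where
    open Space X

    -- The hypothesis is 4pΔ ≤ 1, with 4 in the place of the usual constant e. Since `near` must
    -- hold whenever two events share a bit, Δ normally counts the event itself as well.
    module LLL
      {J : Set} (A : J → Ω → Bool) (S : J → I → Bool) (A-dep : ∀ j → DependsOn (S j) (A j))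
      (near : J → J → Bool) (far : ∀ {i j} → near i j ≡ false → ∀ x → S j x ≡ true → S i x ≡ false)
      (p : ℚ) (0≤p : 0ℚ ≤ p) (Pr≤p : ∀ j → 𝔼 (λ ω → ind (A j ω)) ≤ p)
      (Δ : ℕ) (1≤Δ : 1 ℕ.≤ Δ) (4pΔ≤1 : ι Δ * (p + p) ≤ ½)
      where

      none : List J → Ω → ℚ
      none T ω = ∏ T (λ j → ind (not (A j ω)))

      0≤none : ∀ T ω → 0ℚ ≤ none T ω
      0≤none T ω = 0≤∏ T (λ j → 0≤ind (not (A j ω)))

      nearby others : J → List J → List J
      nearby i T = filterᵇ (near i) T
      others i T = filterᵇ (λ j → not (near i j)) T

      P : List J → ℚ
      P T = 𝔼 (none T)

      none-far : ∀ i T ω → none T ω ≤ none (others i T) ω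
      none-far i []      ω = ≤-refl
      none-far i (j ∷ T) ω with near i j
      ... | true  = ≤-trans (*-monoˡ (0≤none T ω) (ind≤1 (not (A j ω)))) (≤-trans (≤-reflexive (*-identityˡ _)) (none-far i T ω))
      ... | false = *-monoʳ (0≤ind (not (A j ω))) (none-far i T ω)

      -- A union bound: if all far events fail, then either all events of `T` fail or some nearby
      -- event occurs while the far ones fail.
      none-near : ∀ i T ω → none (others i T) ω ≤
                  none T ω + ∑ (nearby i T) (λ j → ind (A j ω) * none (others i T) ω)
      none-near i []      ω = ≤-reflexive (sym (+-identityʳ 1ℚ))
      none-near i (j ∷ T) ω with near i j
      ... | true  = absorb (A j ω) (none-near i T ω) (0≤∑ (nearby i T) (λ k → 0≤* (0≤ind (A k ω)) (0≤none (others i T) ω)))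
        where
        absorb : ∀ a {n f s} → f ≤ n + s → 0ℚ ≤ s → f ≤ ind (not a) * n + (ind a * f + s)
        absorb true  {n} {f} {s} h 0≤s = ≤-by s 0≤s (e n f s)
          where
          e : ∀ n f s → 0ℚ * n + (1ℚ * f + s) - f ≡ s
          e = solve-∀ ring
        absorb false {n} {f} {s} h 0≤s = ≤-trans h (≤-reflexive (e n f s))
          where
          e : ∀ n f s → n + s ≡ 1ℚ * n + (0ℚ * f + s)
          e = solve-∀ ring
      ... | false = begin
        a * F ≤⟨ *-monoʳ (0≤ind (not (A j ω))) (none-near i T ω) ⟩
        a * (none T ω + ∑ (nearby i T) (λ j → ind (A j ω) * F))
          ≡⟨ *-distribˡ-+ a (none T ω) _ ⟩
        a * none T ω + a * ∑ (nearby i T) (λ j → ind (A j ω) * F)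
          ≡⟨ cong (a * none T ω +_) (trans (*-comm a _) (sym (∑-*ʳ (nearby i T) _ a))) ⟩
        a * none T ω + ∑ (nearby i T) (λ j → ind (A j ω) * F * a)
          ≡⟨ cong (a * none T ω +_) (∑-cong (nearby i T) (λ k → e (ind (A k ω)) F a)) ⟩
        a * none T ω + ∑ (nearby i T) (λ j → ind (A j ω) * (a * F)) ∎
        where
        open ≤-Reasoning
        a = ind (not (A j ω))
        F = none (others i T) ω
        e : ∀ x y z → x * y * z ≡ x * (z * y)
        e = solve-∀ ring

      Sparse : List J → Set
      Sparse T = ∀ i → cnt T (near i) ℕ.≤ Δ

      2p≤½ : p + p ≤ ½
      2p≤½ = ≤-trans (≤-reflexive (sym (*-identityˡ (p + p)))) (≤-trans (*-monoˡ (0≤+ 0≤p 0≤p) (1≤ι (1≤Δ))) 4pΔ≤1)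

      0≤P : ∀ T → 0ℚ ≤ P T
      0≤P T = 0≤𝔼 (0≤none T)

      -- The bound 2p on the probability of `A i` given that nothing in `T` occurs, with the
      -- denominator cleared so that no positivity is required.
      Conditional : List J → Set
      Conditional T = ∀ i → 𝔼 (λ ω → ind (A i ω) * none T ω) ≤ (p + p) * P T

      -- `A i` is independent of the far part `T₂`, so it remains to see that `P T₂` is at most
      -- twice `P T`. By induction each of the at most Δ nearby events takes away at most 2p `P T₂`,
      -- together at most half of `P T₂`.
      conditional-step : ∀ T → Sparse T → (∀ T' → length T' ℕ.< length T → Sparse T' → Conditional T') → Conditional T
      conditional-step T sp rec i = begin
        𝔼 (λ ω → ind (A i ω) * none T ω) ≤⟨ 𝔼-mono (λ ω → *-monoʳ (0≤ind (A i ω)) (none-far i T ω)) ⟩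
        𝔼 (λ ω → ind (A i ω) * none T₂ ω) ≡⟨ 𝔼-indep (S i) (λ ω ω' eq → cong ind (A-dep i ω ω' eq)) none-dep ⟩
        𝔼 (λ ω → ind (A i ω)) * P₂ ≤⟨ *-monoˡ (0≤P T₂) (Pr≤p i) ⟩
        p * P₂ ≤⟨ *-monoʳ 0≤p P₂≤2P ⟩
        p * (P T + P T) ≡⟨ e p (P T) ⟩
        (p + p) * P T ∎
        where
        open ≤-Reasoning
        T₁ = nearby i T
        T₂ = others i T
        P₂ = P T₂
        e : ∀ p q → p * (q + q) ≡ (p + p) * q
        e = solve-∀ ring
        e2 : ∀ q → ½ * q + ½ * q ≡ q
        e2 = solve-∀ ring
        none-dep : DependsOn (λ x → not (S i x)) (none T₂)
        none-dep = ∏-dep T₂ λ {j} j∈ ω ω' eq → cong (λ b → ind (not b))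
          (weaken (λ x Sjx → cong not (far (not-true (∈-filterᵇ _ T j∈)) x Sjx)) (A-dep j) ω ω' eq)
        -- The induction hypothesis is called only for members of `T₁`, and the presence of one
        -- makes `T₂` strictly shorter than `T`.
        smaller : ∀ {j} → j ∈ T₁ → length T₂ ℕ.< length T
        smaller j∈ = ℕ.≤-trans (ℕ.+-monoˡ-≤ (length T₂) (nonempty j∈)) (ℕ.≤-reflexive (length-filterᵇ-split (near i) T))
          where
          nonempty : ∀ {xs : List J} {x} → x ∈ xs → 1 ℕ.≤ length xs
          nonempty (here _)  = ℕ.s≤s ℕ.z≤n
          nonempty (there _) = ℕ.s≤s ℕ.z≤n
        ih : ∀ {j} → j ∈ T₁ → 𝔼 (λ ω → ind (A j ω) * none T₂ ω) ≤ (p + p) * P₂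
        ih {j} j∈ = rec T₂ (smaller j∈) (λ i' → ℕ.≤-trans (cnt-filterᵇ _ (near i') T) (sp i')) j
        P₂≤P+½P₂ : P₂ ≤ P T + ½ * P₂
        P₂≤P+½P₂ = begin
          P₂ ≤⟨ 𝔼-mono (none-near i T) ⟩
          𝔼 (λ ω → none T ω + ∑ T₁ (λ j → ind (A j ω) * none T₂ ω))
              ≡⟨ 𝔼-+ (none T) _ ⟩
          P T + 𝔼 (λ ω → ∑ T₁ (λ j → ind (A j ω) * none T₂ ω))
              ≡⟨ cong (P T +_) (𝔼-∑ T₁ (λ j ω → ind (A j ω) * none T₂ ω)) ⟩
          P T + ∑ T₁ (λ j → 𝔼 (λ ω → ind (A j ω) * none T₂ ω))
              ≤⟨ +-monoʳ-≤ (P T) (∑-≤-length T₁ ih) ⟩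
          P T + ι (length T₁) * ((p + p) * P₂)
              ≤⟨ +-monoʳ-≤ (P T) (*-monoˡ (0≤* (0≤+ 0≤p 0≤p) (0≤P T₂)) (ι-mono (ℕ.≤-trans (ℕ.≤-reflexive (length-filterᵇ (near i) T)) (sp i)))) ⟩
          P T + ι Δ * ((p + p) * P₂)
              ≡⟨ cong (P T +_) (*-assoc (ι Δ) (p + p) P₂) ⟨
          P T + ι Δ * (p + p) * P₂
              ≤⟨ +-monoʳ-≤ (P T) (*-monoˡ (0≤P T₂) 4pΔ≤1) ⟩
          P T + ½ * P₂ ∎
        ½P₂≤P : ½ * P₂ ≤ P T
        ½P₂≤P = from-diff (subst (0ℚ ≤_) (e3 (P T) P₂) (diff P₂≤P+½P₂))
          where
          e3 : ∀ a b → a + ½ * b - b ≡ a - ½ * b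
          e3 = solve-∀ ring
        P₂≤2P : P₂ ≤ P T + P T
        P₂≤2P = ≤-trans (≤-reflexive (sym (e2 P₂))) (+-mono-≤ ½P₂≤P ½P₂≤P)

      conditional : ∀ n T → length T ℕ.≤ n → Sparse T → Conditional T
      conditional zero    T h sp = conditional-step T sp λ T' lt → ⊥-elim (ℕ.<⇒≱ lt (ℕ.≤-trans h ℕ.z≤n))
      conditional (suc n) T h sp = conditional-step T sp λ T' lt → conditional n T' (ℕ.s≤s⁻¹ (ℕ.≤-trans lt h))

      -- Each further event costs at most the factor 1 - 2p, which is at least ½.
      positive-probability : ∀ T → Sparse T → 0ℚ < P T
      positive-probability []      sp = subst (0ℚ <_) (sym (𝔼-const 1ℚ)) 0<1
      positive-probability (i ∷ T) sp = <-≤-trans (0<* 0<½ (positive-probability T sp')) (begin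
        ½ * P T ≤⟨ *-monoˡ (0≤P T) (from-diff {½} {1ℚ - (p + p)} (subst (0ℚ ≤_) (e½ (p + p)) (diff 2p≤½))) ⟩
        (1ℚ - (p + p)) * P T ≡⟨ e1 (p + p) (P T) ⟩
        P T - (p + p) * P T ≤⟨ from-diff (subst (0ℚ ≤_) (e2 (P T) _ _) (diff (conditional (length T) T ℕ.≤-refl sp' i))) ⟩
        P T - 𝔼 (λ ω → ind (A i ω) * none T ω) ≡⟨ e3 _ _ _ (trans (sym (𝔼-+ (none (i ∷ T)) (λ ω → ind (A i ω) * none T ω))) (𝔼-cong pointwise)) ⟩
        P (i ∷ T) ∎)
        where
        open ≤-Reasoning
        sp' : Sparse T
        sp' j = ℕ.≤-trans (ℕ.m≤n+m _ _) (sp j)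
        0<½ : 0ℚ < ½
        0<½ = from-yes (0ℚ ℚ.<? ½)
        e½ : ∀ a → ½ - a ≡ 1ℚ - a - ½
        e½ = solve-∀ ring
        e1 : ∀ a b → (1ℚ - a) * b ≡ b - a * b
        e1 = solve-∀ ring
        e2 : ∀ a b c → c - b ≡ a - b - (a - c)
        e2 = solve-∀ ring
        e3 : ∀ a b c → c + b ≡ a → a - b ≡ c
        e3 a b c refl = p' b c
          where
          p' : ∀ b c → c + b - b ≡ c
          p' = solve-∀ ring
        pointwise : ∀ ω → none (i ∷ T) ω + ind (A i ω) * none T ω ≡ none T ω
        pointwise ω with A i ω
        ... | true  = q (none T ω)
          where
          q : ∀ a → 0ℚ * a + 1ℚ * a ≡ a
          q = solve-∀ ring
        ... | false = q (none T ω)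
          where
          q : ∀ a → 1ℚ * a + 0ℚ * a ≡ a
          q = solve-∀ ring

      avoid : ∀ T → Sparse T → ∃ λ ω → ∀ {j} → j ∈ T → A j ω ≡ false
      avoid T sp = let ω , h = 𝔼-exists (none T) (positive-probability T sp) in ω , λ j∈ → all-false T ω h j∈
        where
        all-false : ∀ T ω → 0ℚ < none T ω → ∀ {j} → j ∈ T → A j ω ≡ false
        all-false (i ∷ T) ω h j∈ with A i ω in Ai
        all-false (i ∷ T) ω h j∈          | true  = ⊥-elim (ℚ.<-irrefl refl (subst (0ℚ <_) (*-zeroˡ (none T ω)) h))
        all-false (i ∷ T) ω h (here refl) | false = Ai
        all-false (i ∷ T) ω h (there j∈)  | false = all-false T ω (subst (0ℚ <_) (*-identityˡ (none T ω)) h) j∈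

-- High moments of sums of dependent variables

module Moments where

  open Rationals
  open Sums
  open Expectation

  module _ (X : BitSpace) where
    open Space X

    -- The K-th moment of Σ f is expanded over K-tuples, built up one entry at a time: an entry that is ok relative to the
    -- chain W of earlier ones gains a factor Q, and the at most B others are estimated by 1. With B much smaller than the
    -- mean, this is sharp to first order.
    module MomentBound
      {A : Set} (xs : List A) (m : A → Bool) (f : A → Ω → ℚ) (0≤f : ∀ x ω → 0ℚ ≤ f x ω) (f≤1 : ∀ x ω → f x ω ≤ 1ℚ)
      (ok : List A → A → Bool) (K B : ℕ) (1≤B : 1 ℕ.≤ B)
      (bad : ∀ W → length W ℕ.≤ K → cnt xs (λ x → m x ∧ not (ok W x)) ℕ.≤ B)
      (Q : ℚ) (0≤Q : 0ℚ ≤ Q)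
      where

      data Chain : List A → Set where
        []  : Chain []
        _∷_ : ∀ {x W} → m x ≡ true → ok W x ≡ true → Chain W → Chain (x ∷ W)

      total : Ω → ℚ
      total ω = ∑ xs (λ x → ind (m x) * f x ω)

      μ : ℚ
      μ = ι (cnt xs m) * Q + ι B

      0≤total : ∀ ω → 0ℚ ≤ total ω
      0≤total ω = 0≤∑ xs (λ x → 0≤* (0≤ind (m x)) (0≤f x ω))

      0<μ : 0ℚ < μ
      0<μ = <-≤-trans (0<ι 1≤B) (≤-trans (≤-reflexive (sym (+-identityˡ _))) (+-monoˡ-≤ (ι B) (0≤* (0≤ι (cnt xs m)) 0≤Q)))

      module _ (joint : ∀ {W} → Chain W → length W ℕ.≤ K → 𝔼 (λ ω → ∏ W (λ x → f x ω)) ≤ Q ^ length W) where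

        -- The weight given by the product over `W` carries the entries chosen so far. Splitting off
        -- one factor of `total` either lengthens the chain or, for an entry that is not ok, returns
        -- to the same chain with a smaller exponent.
        moment-with : ∀ k {W} → Chain W → k ℕ.+ length W ℕ.≤ K →
                      𝔼 (λ ω → total ω ^ k * ∏ W (λ x → f x ω)) ≤ μ ^ k * Q ^ length W
        moment-with zero    {W} ch h = ≤-trans (≤-reflexive (𝔼-cong (λ ω → *-identityˡ _))) (≤-trans (joint ch h) (≤-reflexive (sym (*-identityˡ _))))
        moment-with (suc k) {W} ch h = begin
          𝔼 (λ ω → total ω ^ suc k * Π W ω)
            ≡⟨ 𝔼-cong (λ ω → trans (*-assoc (total ω) _ _) (sym (∑-*ʳ xs _ _))) ⟩
          𝔼 (λ ω → ∑ xs (λ x → ind (m x) * f x ω * (total ω ^ k * Π W ω)))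
            ≡⟨ 𝔼-∑ xs (λ x ω → ind (m x) * f x ω * (total ω ^ k * Π W ω)) ⟩
          ∑ xs (λ x → 𝔼 (λ ω → ind (m x) * f x ω * (total ω ^ k * Π W ω)))
            ≤⟨ ∑-mono xs term ⟩
          ∑ xs (λ x → (ind (m x) * Q + ind (m x ∧ not (ok W x))) * R)
            ≡⟨ ∑-*ʳ xs _ R ⟩
          ∑ xs (λ x → ind (m x) * Q + ind (m x ∧ not (ok W x))) * R
            ≡⟨ cong (_* R) (∑-+ xs _ _) ⟩
          (∑ xs (λ x → ind (m x) * Q) + ∑ xs (λ x → ind (m x ∧ not (ok W x)))) * R
            ≡⟨ cong₂ (λ a b → (a + b) * R) (trans (∑-*ʳ xs _ Q) (cong (_* Q) (sym (ι-cnt xs m)))) (sym (ι-cnt xs _)) ⟩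
          (ι (cnt xs m) * Q + ι (cnt xs (λ x → m x ∧ not (ok W x)))) * R
            ≤⟨ *-monoˡ 0≤R (+-monoʳ-≤ (ι (cnt xs m) * Q) (ι-mono (bad W (ℕ.≤-trans (ℕ.m≤n+m _ (suc k)) h)))) ⟩
          μ * R
            ≡⟨ *-assoc μ _ _ ⟨
          μ ^ suc k * Q ^ length W ∎
          where
          open ≤-Reasoning
          Π : List A → Ω → ℚ
          Π W ω = ∏ W (λ x → f x ω)
          R = μ ^ k * Q ^ length W
          0≤R : 0ℚ ≤ R
          0≤R = 0≤* (0≤^ k (<⇒≤ 0<μ)) (0≤^ (length W) 0≤Q)
          0≤Π : ∀ W ω → 0ℚ ≤ Π W ω
          0≤Π W ω = 0≤∏ W (λ x → 0≤f x ω)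
          rearrange : ∀ a b c → 1ℚ * a * (b * c) ≡ b * (a * c)
          rearrange = solve-∀ ring
          extended : ∀ x → m x ≡ true → ok W x ≡ true → 𝔼 (λ ω → 1ℚ * f x ω * (total ω ^ k * Π W ω)) ≤ (1ℚ * Q + 0ℚ) * R
          extended x mx okx = ≤-trans (≤-reflexive (𝔼-cong (λ ω → rearrange (f x ω) (total ω ^ k) (Π W ω))))
            (≤-trans (moment-with k (_∷_ mx okx ch) (ℕ.≤-trans (ℕ.≤-reflexive (ℕ.+-suc k _)) h)) (≤-reflexive (e Q (μ ^ k) (Q ^ length W))))
            where
            e : ∀ q a b → a * (q * b) ≡ (1ℚ * q + 0ℚ) * (a * b)
            e = solve-∀ ring
          dropped : ∀ x → 𝔼 (λ ω → 1ℚ * f x ω * (total ω ^ k * Π W ω)) ≤ (1ℚ * Q + 1ℚ) * R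
          dropped x = ≤-trans (𝔼-mono (λ ω → ≤-trans (*-monoˡ (0≤* (0≤^ k (0≤total ω)) (0≤Π W ω)) (≤-trans (≤-reflexive (*-identityˡ _)) (f≤1 x ω))) (≤-reflexive (*-identityˡ _))))
            (≤-trans (moment-with k ch (ℕ.≤-trans (ℕ.n≤1+n _) h)) (≤-by (Q * R) (0≤* 0≤Q 0≤R) (e Q R)))
            where
            e : ∀ q r → (1ℚ * q + 1ℚ) * r - r ≡ q * r
            e = solve-∀ ring
          term : ∀ x → 𝔼 (λ ω → ind (m x) * f x ω * (total ω ^ k * Π W ω)) ≤ (ind (m x) * Q + ind (m x ∧ not (ok W x))) * R
          term x with m x in mx | ok W x in okx
          ... | true  | true  = extended x mx okx
          ... | true  | false = dropped x
          ... | false | _     = ≤-reflexive (trans (𝔼-cong (λ ω → e (f x ω) _)) (trans (𝔼-const 0ℚ) (sym (e' Q R))))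
            where
            e : ∀ a b → 0ℚ * a * b ≡ 0ℚ
            e = solve-∀ ring
            e' : ∀ a b → (0ℚ * a + 0ℚ) * b ≡ 0ℚ
            e' = solve-∀ ring

        -- Markov's inequality for the K-th power of `total`, written without dividing by c^K.
        tail-bound : ∀ {c y} → 0ℚ ≤ c → c * μ ≤ y → 𝔼 (λ ω → ind (y <ᵇ total ω)) * c ^ K ≤ 1ℚ
        tail-bound {c} {y} 0≤c cμ≤y = *-cancelʳ (0<^ K 0<μ) (begin
          P * c ^ K * μ ^ K ≡⟨ trans (*-assoc P _ _) (cong (P *_) (sym (*-^ c μ K))) ⟩
          P * (c * μ) ^ K ≤⟨ *-monoʳ (0≤𝔼 (λ ω → 0≤ind (y <ᵇ total ω))) (^-mono K 0≤cμ cμ≤y) ⟩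
          P * y ^ K ≡⟨ trans (*-comm P _) (sym (𝔼-*ˡ (y ^ K) _)) ⟩
          𝔼 (λ ω → y ^ K * ind (y <ᵇ total ω)) ≤⟨ 𝔼-mono markov ⟩
          𝔼 (λ ω → total ω ^ K * 1ℚ) ≤⟨ moment-with K [] (ℕ.≤-reflexive (ℕ.+-identityʳ K)) ⟩
          μ ^ K * 1ℚ ≡⟨ *-comm (μ ^ K) 1ℚ ⟩
          1ℚ * μ ^ K ∎)
          where
          open ≤-Reasoning
          P = 𝔼 (λ ω → ind (y <ᵇ total ω))
          0≤cμ : 0ℚ ≤ c * μ
          0≤cμ = 0≤* 0≤c (<⇒≤ 0<μ)
          0≤y : 0ℚ ≤ y
          0≤y = ≤-trans 0≤cμ cμ≤y
          markov : ∀ ω → y ^ K * ind (y <ᵇ total ω) ≤ total ω ^ K * 1ℚ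
          markov ω with y <ᵇ total ω in e
          ... | true  = *-monoˡ 0≤1 (^-mono K 0≤y (<⇒≤ (<ᵇ-true e)))
          ... | false = ≤-trans (≤-reflexive (*-zeroʳ (y ^ K))) (0≤* (0≤^ K (0≤total ω)) 0≤1)

-- Abstract hypergraph instances and partial colouring states

module Hypergraphs where

  open import Data.Fin using (Fin)
  open import Data.List.Relation.Unary.All using (All; []; _∷_)
  open import Data.List.Relation.Unary.AllPairs using ([]; _∷_)
  open import Relation.Binary.Definitions using (DecidableEquality)
  open Rationals
  open Sums
  open Expectation
  open LocalLemma
  open Moments

  is : {A : Set} (_≟_ : DecidableEquality A) → A → A → Bool
  is _≟_ x y = ⌊ x ≟ y ⌋

  module _ {A : Set} (_≟_ : DecidableEquality A) where

    is-true : ∀ {x y} → is _≟_ x y ≡ true → x ≡ y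
    is-true {x} {y} e with x ≟ y
    ... | yes p = p

    is-refl : ∀ x → is _≟_ x x ≡ true
    is-refl x with x ≟ x
    ... | yes _ = refl
    ... | no ¬p = ⊥-elim (¬p refl)

    is-false : ∀ {x y} → x ≢ y → is _≟_ x y ≡ false
    is-false {x} {y} x≢y with x ≟ y
    ... | yes p = ⊥-elim (x≢y p)
    ... | no _  = refl

    cnt-is≤1 : ∀ {xs} x → Unique xs → cnt xs (λ y → is _≟_ y x) ℕ.≤ 1
    cnt-is≤1 x [] = ℕ.z≤n
    cnt-is≤1 {y ∷ ys} x (y∉ ∷ u) with y ≟ x
    ... | no _     = cnt-is≤1 x u
    ... | yes refl = ℕ.s≤s (ℕ.≤-reflexive (none ys y∉))
      where
      none : ∀ ys → All (x ≢_) ys → cnt ys (λ y → is _≟_ y x) ≡ 0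
      none []       []       = refl
      none (y ∷ ys) (p ∷ ps) with y ≟ x
      ... | yes e = ⊥-elim (p (sym e))
      ... | no _  = none ys ps

  cnt-∈ : {A : Set} {xs : List A} {x : A} (p : A → Bool) → x ∈ xs → p x ≡ true → 1 ℕ.≤ cnt xs p
  cnt-∈ p (here refl) e rewrite e = ℕ.s≤s ℕ.z≤n
  cnt-∈ p (there i)   e = ℕ.≤-trans (cnt-∈ p i e) (ℕ.m≤n+m _ _)

  -- Weierstrass' product inequality: the mixed terms that expansion adds at each step are
  -- nonnegative.
  ∏-1-∑ : {A : Set} (xs : List A) {f : A → ℚ} → (∀ x → 0ℚ ≤ f x) → (∀ x → f x ≤ 1ℚ) → 1ℚ - ∑ xs f ≤ ∏ xs (λ x → 1ℚ - f x)
  ∏-1-∑ []       l u = ≤-refl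
  ∏-1-∑ (x ∷ xs) {f} l u = ≤-trans (≤-by (f x * ∑ xs f) (0≤* (l x) (0≤∑ xs l)) (e (f x) (∑ xs f))) (*-monoʳ (diff (u x)) (∏-1-∑ xs l u))
    where
    e : ∀ a b → (1ℚ - a) * (1ℚ - b) - (1ℚ - (a + b)) ≡ a * b
    e = solve-∀ ring

  -- `R`, `Dg` and `κ` bound edge sizes, degrees and codegrees. `enc` numbers the random bits of a
  -- round, two for each pair of an edge and a colour. `vs-nonempty` makes `meet` reflexive, so an
  -- edge is among its own conflicts. `c₀` is a default for edges that need no colour.
  record Instance : Set₁ where
    field
      J V C       : Set
      _≟J_        : DecidableEquality J
      _≟V_        : DecidableEquality V
      _≟C_        : DecidableEquality C
      js          : List J
      js-unique   : Unique js
      js-complete : ∀ j → j ∈ js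
      cs          : List C
      cs-unique   : Unique cs
      cs-complete : ∀ c → c ∈ cs
      c₀          : C
      N           : ℕ
      enc         : J × C × Bool → Fin N
      dec         : Fin N → J × C × Bool
      dec-enc     : ∀ x → dec (enc x) ≡ x
      vs          : J → List V
      vs-nonempty : ∀ j → ∃ λ v → v ∈ vs j
      R κ Dg      : ℕ
      |vs|≤R      : ∀ j → length (vs j) ℕ.≤ R

    inc : V → J → Bool
    inc v j = any (is _≟V_ v) (vs j)

    field
      degree≤Dg  : ∀ v → cnt js (inc v) ℕ.≤ Dg
      codegree≤κ : ∀ {u v} → u ≢ v → cnt js (λ j → inc u j ∧ inc v j) ℕ.≤ κ

    ∈⇒inc : ∀ {v j} → v ∈ vs j → inc v j ≡ true
    ∈⇒inc {v} v∈ = any-intro (is _≟V_ v) v∈ (is-refl _≟V_ v)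

    inc⇒∈ : ∀ {v j} → inc v j ≡ true → v ∈ vs j
    inc⇒∈ {v} {j} e = let u , u∈ , q = any-true _ (vs j) e in subst (_∈ vs j) (sym (is-true _≟V_ q)) u∈

    meet : J → J → Bool
    meet i j = any (λ v → inc v j) (vs i)

    meet-intro : ∀ {v i j} → inc v i ≡ true → inc v j ≡ true → meet i j ≡ true
    meet-intro p q = any-intro _ (inc⇒∈ p) q

    meet-elim : ∀ {i j} → meet i j ≡ true → ∃ λ v → inc v i ≡ true × inc v j ≡ true
    meet-elim {i} e = let v , v∈ , q = any-true _ (vs i) e in v , ∈⇒inc v∈ , q

    meet-sym : ∀ {i j} → meet i j ≡ true → meet j i ≡ true
    meet-sym e = let v , p , q = meet-elim e in meet-intro q p

    meet-refl : ∀ j → meet j j ≡ true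
    meet-refl j = let v , v∈ = vs-nonempty j in meet-intro (∈⇒inc v∈) (∈⇒inc v∈)

    meetOff : V → J → J → Bool
    meetOff v i j = any (λ u → not (is _≟V_ u v) ∧ inc u j) (vs i)

    near₂ : J → J → Bool
    near₂ i k = any (λ j → meet i j ∧ meet j k) js

    near₂-intro : ∀ {i j k} → meet i j ≡ true → meet j k ≡ true → near₂ i k ≡ true
    near₂-intro {j = j} p q = any-intro _ (js-complete j) (∧-intro p q)

    meet⇒near₂ : ∀ {i j} → meet i j ≡ true → near₂ i j ≡ true
    meet⇒near₂ {i} = near₂-intro (meet-refl i)

    -- A bad event at an edge reads bits within two steps: the load at one of its vertices involves
    -- the edges there and everything they meet. Two such events can share a bit only if their
    -- two-step neighbourhoods intersect; `Δ₄` counts walks of length four.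
    near₄ : J → J → Bool
    near₄ i j = any (λ k → near₂ i k ∧ near₂ j k) js

    Δ₁ Δ₄ : ℕ
    Δ₁ = R ℕ.* Dg
    Δ₄ = (Δ₁ ℕ.* Δ₁) ℕ.* (Δ₁ ℕ.* Δ₁)

    cnt-meet : ∀ i → cnt js (meet i) ℕ.≤ Δ₁
    cnt-meet i = ℕ.≤-trans (cnt-any js (vs i) inc degree≤Dg) (ℕ.*-monoˡ-≤ Dg (|vs|≤R i))

    cnt-near₂ : ∀ i → cnt js (near₂ i) ℕ.≤ Δ₁ ℕ.* Δ₁
    cnt-near₂ i = ℕ.≤-trans (cnt-any-∧ js js (meet i) meet cnt-meet) (ℕ.*-monoˡ-≤ Δ₁ (cnt-meet i))

    cnt-near₂ʳ : ∀ k → cnt js (λ i → near₂ i k) ℕ.≤ Δ₁ ℕ.* Δ₁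
    cnt-near₂ʳ k = ℕ.≤-trans (cnt-mono js {q = near₂ k} flip) (cnt-near₂ k)
      where
      flip : ∀ i → near₂ i k ≡ true → near₂ k i ≡ true
      flip i e = let j , _ , q = any-true _ js e in near₂-intro (meet-sym (∧₂ (meet i j) q)) (meet-sym (∧₁ (meet i j) q))

    cnt-near₄ : ∀ i → cnt js (near₄ i) ℕ.≤ Δ₄
    cnt-near₄ i = ℕ.≤-trans (cnt-mono js {q = λ j → any (λ k → near₂ i k ∧ near₂ j k) js} (λ _ e → e))
      (ℕ.≤-trans (cnt-any-∧ js js (near₂ i) (λ k j → near₂ j k) cnt-near₂ʳ) (ℕ.*-monoˡ-≤ (Δ₁ ℕ.* Δ₁) (cnt-near₂ i)))

    near₄-far : ∀ {i j} → near₄ i j ≡ false → ∀ k → near₂ j k ≡ true → near₂ i k ≡ false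
    near₄-far {i} {j} e k q with near₂ i k in r
    ... | false = refl
    ... | true  = true≢false (any-intro (λ k → near₂ i k ∧ near₂ j k) (js-complete k) (∧-intro r q)) e

    -- U marks the edges still to be coloured, a j c the colours c still available at j.
    record State : Set where
      field
        U : J → Bool
        a : J → C → Bool

    Colorable : State → Set
    Colorable st = ∃ λ (φ : J → C) → (∀ j → U j ≡ true → a j (φ j) ≡ true)
      × (∀ i j → U i ≡ true → U j ≡ true → i ≢ j → meet i j ≡ true → φ i ≢ φ j)
      where open State st

    colourDegree : State → V → C → ℕ
    colourDegree st v c = cnt js (λ j → inc v j ∧ State.a st j c)

    conflicts : State → J → C → ℕ
    conflicts st i c = cnt js (λ j → meet i j ∧ State.a st j c)

-- One random round: activations, survival and extension of colourings

module Randomness where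

  open import Data.List.Relation.Unary.All using ([]; _∷_)
  open import Data.List.Relation.Unary.AllPairs using ([]; _∷_)
  open import Data.Product.Properties using (≡-dec)
  open import Relation.Binary.Definitions using (DecidableEquality)
  open Rationals
  open Sums
  open Expectation
  open LocalLemma
  open Moments
  open Hypergraphs

  module Round (G : Instance) (st : Instance.State G)
    (θ σ t : ℚ) (0≤θ : 0ℚ ≤ θ) (θ≤1 : θ ≤ 1ℚ) (0≤t : 0ℚ ≤ t) (tτ≡1 : t * (1ℚ - θ) ≡ 1ℚ) (0≤σ : 0ℚ ≤ σ)
    (σ≤ : ∀ e c → σ ≤ (1ℚ - θ) ^ Instance.conflicts G st e c)
    where

    open Instance G
    open State st

    τ : ℚ
    τ = 1ℚ - θ

    0≤τ : 0ℚ ≤ τ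
    0≤τ = diff θ≤1

    τ≤1 : τ ≤ 1ℚ
    τ≤1 = 1-≤1 0≤θ

    tτ^ : ∀ n → t ^ n * τ ^ n ≡ 1ℚ
    tτ^ n = trans (sym (*-^ t τ n)) (trans (cong (_^ n) tτ≡1) (1^ n))

    -- The bit (e, c, false) activates the pair (e, c); the bit (e, c, true) is a coin which equalizes the survival
    -- probabilities of all pairs to σ.
    prob : J × C × Bool → ℚ
    prob (e , c , false) = θ
    prob (e , c , true)  = σ * t ^ conflicts st e c

    bits : BitSpace
    bits = record
      { I = J × C × Bool ; N = N ; enc = enc ; dec = dec ; dec-enc = dec-enc ; pr = prob
      ; 0≤pr = λ { (e , c , false) → 0≤θ ; (e , c , true) → 0≤* 0≤σ (0≤^ (conflicts st e c) 0≤t) }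
      ; pr≤1 = λ { (e , c , false) → θ≤1
                 ; (e , c , true)  → ≤-trans (*-monoˡ (0≤^ (conflicts st e c) 0≤t) (σ≤ e c))
                                     (≤-reflexive (trans (*-comm (τ ^ conflicts st e c) _) (tτ^ (conflicts st e c)))) } }

    open Space bits public hiding (N; enc; dec; dec-enc)

    _≟I_ : DecidableEquality I
    _≟I_ = ≡-dec _≟J_ (≡-dec _≟C_ Bool._≟_)

    b coin : J → C → Ω → Bool
    b e c    = bit (e , c , false)
    coin e c = bit (e , c , true)

    off : (J → Bool) → C → Ω → Bool
    off s c ω = all (λ f → not (s f ∧ b f c ω)) js

    rival : J → J → Bool
    rival e f = meet e f ∧ not (is _≟J_ e f)

    -- `surv` counts `e` among the edges meeting it, `succ` does not. An available colour activated
    -- at `e` is thus used up: either it colours `e`, or a rival has activated it too and it is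
    -- lost.
    surv succ : J → C → Ω → Bool
    surv e c ω = coin e c ω ∧ off (λ f → meet e f ∧ a f c) c ω
    succ e c ω = a e c ∧ (b e c ω ∧ off (λ f → rival e f ∧ a f c) c ω)

    off-elim : ∀ {s c ω f} → off s c ω ≡ true → s f ≡ true → b f c ω ≡ false
    off-elim {s} {c} {ω} {f} o sf with b f c ω in bf
    ... | false = refl
    ... | true  = true≢false (all-true (λ f → not (s f ∧ b f c ω)) o (js-complete f)) (cong not (∧-intro sf bf))

    off-dep : ∀ {S : I → Bool} s c → (∀ g → s g ≡ true → S (g , c , false) ≡ true) → DependsOn S (off s c)
    off-dep s c h ω ω' eq = go js
      where
      go : ∀ xs → all (λ f → not (s f ∧ b f c ω)) xs ≡ all (λ f → not (s f ∧ b f c ω')) xs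
      go []       = refl
      go (f ∷ xs) with s f in sf
      ... | true  = cong₂ (λ x y → not x ∧ y) (eq (f , c , false) (h f sf)) (go xs)
      ... | false = go xs

    bit-dep : ∀ {S : I → Bool} x → S x ≡ true → DependsOn S (bit x)
    bit-dep x Sx ω ω' eq = eq x Sx

    ∧-dep : ∀ {S : I → Bool} {f g : Ω → Bool} → DependsOn S f → DependsOn S g → DependsOn S (λ ω → f ω ∧ g ω)
    ∧-dep df dg ω ω' eq = cong₂ _∧_ (df ω ω' eq) (dg ω ω' eq)

    ind-dep : ∀ {S : I → Bool} {f : Ω → Bool} → DependsOn S f → DependsOn S (λ ω → ind (f ω))
    ind-dep df ω ω' eq = cong ind (df ω ω' eq)

    surv-dep : ∀ {S : I → Bool} e c → S (e , c , true) ≡ true → (∀ g → meet e g ≡ true → S (g , c , false) ≡ true) → DependsOn S (surv e c)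
    surv-dep e c p q = ∧-dep (bit-dep _ p) (off-dep _ c λ g sg → q g (∧₁ (meet e g) sg))

    succ-dep : ∀ {S : I → Bool} e c → (∀ g → meet e g ≡ true → S (g , c , false) ≡ true) → DependsOn S (succ e c)
    succ-dep e c q = ∧-dep {f = λ _ → a e c} (λ _ _ _ → refl) (∧-dep (bit-dep _ (q e (meet-refl e)))
      (off-dep _ c λ g sg → q g (∧₁ (meet e g) (∧₁ (rival e g) sg))))

    𝔼-off : ∀ s c → 𝔼 (λ ω → ind (off s c ω)) ≡ τ ^ cnt js s
    𝔼-off s c = begin
      𝔼 (λ ω → ind (off s c ω)) ≡⟨ 𝔼-cong (λ ω → ind-all _ js) ⟩
      𝔼 (λ ω → ∏ js (λ f → ind (not (s f ∧ b f c ω))))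
        ≡⟨ 𝔼-∏ (λ f x → is _≟I_ x (f , c , false)) js-unique (λ f ω ω' eq → cong (λ x → ind (not (s f ∧ x))) (eq _ (is-refl _≟I_ _))) disjoint ⟩
      ∏ js (λ f → 𝔼 (λ ω → ind (not (s f ∧ b f c ω)))) ≡⟨ ∏-cong js single ⟩
      ∏ js (λ f → if s f then τ else 1ℚ) ≡⟨ ∏-if js s τ ⟩
      τ ^ cnt js s ∎
      where
      open ≡-Reasoning
      disjoint : ∀ {f g} → f ≢ g → ∀ x → is _≟I_ x (g , c , false) ≡ true → is _≟I_ x (f , c , false) ≡ false
      disjoint f≢g x e = is-false _≟I_ λ p → f≢g (cong proj₁ (trans (sym p) (is-true _≟I_ e)))
      single : ∀ f → 𝔼 (λ ω → ind (not (s f ∧ b f c ω))) ≡ (if s f then τ else 1ℚ)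
      single f with s f
      ... | true  = trans (𝔼-bit (f , c , false) (λ x → ind (not x))) (e θ)
        where
        e : ∀ a → a * 0ℚ + (1ℚ - a) * 1ℚ ≡ 1ℚ - a
        e = solve-∀ ring
      ... | false = 𝔼-const 1ℚ

    𝔼-coin : ∀ e c → 𝔼 (λ ω → ind (coin e c ω)) ≡ σ * t ^ conflicts st e c
    𝔼-coin e c = trans (𝔼-bit (e , c , true) ind) (p (prob (e , c , true)))
      where
      p : ∀ a → a * 1ℚ + (1ℚ - a) * 0ℚ ≡ a
      p = solve-∀ ring

    𝔼-surv : ∀ e c → 𝔼 (λ ω → ind (surv e c ω)) ≡ σ
    𝔼-surv e c = begin
      𝔼 (λ ω → ind (surv e c ω)) ≡⟨ 𝔼-cong (λ ω → ind-∧ (coin e c ω) _) ⟩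
      𝔼 (λ ω → ind (coin e c ω) * ind (off (λ f → meet e f ∧ a f c) c ω))
        ≡⟨ 𝔼-indep (λ x → proj₂ (proj₂ x)) (ind-dep (bit-dep _ refl)) (ind-dep (off-dep _ c λ _ _ → refl)) ⟩
      𝔼 (λ ω → ind (coin e c ω)) * 𝔼 (λ ω → ind (off (λ f → meet e f ∧ a f c) c ω))
        ≡⟨ cong₂ _*_ (𝔼-coin e c) (𝔼-off _ c) ⟩
      σ * t ^ n * τ ^ n ≡⟨ *-assoc σ _ _ ⟩
      σ * (t ^ n * τ ^ n) ≡⟨ cong (σ *_) (tτ^ n) ⟩
      σ * 1ℚ ≡⟨ *-identityʳ σ ⟩
      σ ∎
      where
      open ≡-Reasoning
      n = conflicts st e c

    -- Rivals having `c` are among the conflicts, so all of them stay inactive with probability at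
    -- least τ^conflicts ≥ σ, independently of the activation at `e`.
    θσ≤𝔼-succ : ∀ e c → a e c ≡ true → θ * σ ≤ 𝔼 (λ ω → ind (succ e c ω))
    θσ≤𝔼-succ e c aec = begin
      θ * σ ≤⟨ *-monoʳ 0≤θ (≤-trans (σ≤ e c) (^-anti 0≤τ τ≤1 (cnt-mono js λ f s → ∧-intro (∧₁ (meet e f) (∧₁ (rival e f) s)) (∧₂ (rival e f) s)))) ⟩
      θ * τ ^ cnt js s ≡⟨ cong₂ _*_ (trans (𝔼-bit (e , c , false) ind) (p θ)) (𝔼-off s c) ⟨
      𝔼 (λ ω → ind (b e c ω)) * 𝔼 (λ ω → ind (off s c ω))
        ≡⟨ 𝔼-indep (λ x → is _≟I_ x (e , c , false)) (ind-dep (bit-dep _ (is-refl _≟I_ _)))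
            (ind-dep (off-dep s c λ g sg → cong not (is-false _≟I_ λ q → true≢false (is-refl _≟J_ g) (trans (cong (λ x → is _≟J_ x g) (cong proj₁ q)) (not-true (∧₂ (meet e g) (∧₁ (rival e g) sg)))))))  ⟨
      𝔼 (λ ω → ind (b e c ω) * ind (off s c ω))
        ≡⟨ 𝔼-cong (λ ω → trans (sym (ind-∧ (b e c ω) _)) (cong (λ x → ind (x ∧ (b e c ω ∧ off s c ω))) (sym aec))) ⟩
      𝔼 (λ ω → ind (succ e c ω)) ∎
      where
      open ≤-Reasoning
      s = λ f → rival e f ∧ a f c
      p : ∀ a → a * 1ℚ + (1ℚ - a) * 0ℚ ≡ a
      p = solve-∀ ring

    ofColour : C → I → Bool
    ofColour c x = is _≟C_ (proj₁ (proj₂ x)) c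

    ofColour-disjoint : ∀ {c d} → c ≢ d → ∀ x → ofColour d x ≡ true → ofColour c x ≡ false
    ofColour-disjoint c≢d x e = is-false _≟C_ λ p → c≢d (trans (sym p) (is-true _≟C_ e))

    -- A coloured edge gives up all its colours, so it no longer contributes to any load.
    next : Ω → State
    next ω = record
      { U = λ e → U e ∧ not (any (λ c → succ e c ω) cs)
      ; a = λ e c → a e c ∧ (surv e c ω ∧ not (any (λ c → succ e c ω) cs)) }

    -- Two meeting edges coloured alike in this round would both have activated the colour, so
    -- neither could have succeeded. An edge coloured later uses a colour that survived, hence one
    -- that no neighbour having it activated in this round.
    extend : ∀ ω → Colorable (next ω) → Colorable st
    extend ω (φ , φ∈ , proper) = ψ , ψ∈ , ψ-proper
      where
      coloured : J → Bool
      coloured e = any (λ c → succ e c ω) cs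
      choose : ∀ e x → coloured e ≡ x → C
      choose e true  q = proj₁ (any-true _ cs q)
      choose e false q = φ e
      ψ : J → C
      ψ e = choose e (coloured e) refl
      data View (e : J) : Set where
        new : succ e (ψ e) ω ≡ true → View e
        old : coloured e ≡ false → ψ e ≡ φ e → View e
      view : ∀ e → View e
      view e = go (coloured e) refl refl
        where
        go : ∀ x (q : coloured e ≡ x) → ψ e ≡ choose e x q → View e
        go true  q r = new (subst (λ c → succ e c ω ≡ true) (sym r) (proj₂ (proj₂ (any-true _ cs q))))
        go false q r = old q r
      stillU : ∀ {e} → U e ≡ true → coloured e ≡ false → U e ∧ not (coloured e) ≡ true
      stillU u q = ∧-intro u (cong not q)
      ψ∈ : ∀ e → U e ≡ true → a e (ψ e) ≡ true
      ψ∈ e u with view e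
      ... | new s   = ∧₁ (a e (ψ e)) s
      ... | old q r = subst (λ c → a e c ≡ true) (sym r) (∧₁ (a e (φ e)) (φ∈ e (stillU u q)))
      active : ∀ {e c} → succ e c ω ≡ true → a e c ≡ true × b e c ω ≡ true
      active {e} {c} s = ∧₁ (a e c) s , ∧₁ (b e c ω) (∧₂ (a e c) s)
      clash : ∀ {i j c} → i ≢ j → meet i j ≡ true → succ i c ω ≡ true → succ j c ω ≡ true → ψ i ≢ ψ j
      clash {i} {j} {c} i≢j mij si sj = true≢false (proj₂ (active sj))
        (off-elim {λ f → rival i f ∧ a f c} {c} {ω} {j} (∧₂ (b i c ω) (∧₂ (a i c) si)) (∧-intro (∧-intro mij (cong not (is-false _≟J_ i≢j))) (proj₁ (active sj))))
      blocked : ∀ {i j c} → U i ≡ true → coloured i ≡ false → φ i ≡ c → meet i j ≡ true → succ j c ω ≡ true → ψ i ≢ ψ j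
      blocked {i} {j} u q refl mij sj = true≢false (proj₂ (active sj))
        (off-elim {λ f → meet i f ∧ a f (φ i)} {φ i} {ω} {j} (∧₂ (coin i (φ i) ω) (∧₁ (surv i (φ i) ω) (∧₂ (a i (φ i)) (φ∈ i (stillU u q))))) (∧-intro mij (proj₁ (active sj))))
      ψ-proper : ∀ i j → U i ≡ true → U j ≡ true → i ≢ j → meet i j ≡ true → ψ i ≢ ψ j
      ψ-proper i j ui uj i≢j mij eq with view i | view j
      ... | new si   | new sj   = clash i≢j mij si (subst (λ c → succ j c ω ≡ true) (sym eq) sj) eq
      ... | old q r  | new sj   = blocked ui q (trans (sym r) eq) mij sj eq
      ... | new si   | old q r  = blocked uj q (trans (sym r) (sym eq)) (meet-sym mij) si (sym eq)
      ... | old q r  | old q' r' = proper i j (stillU ui q) (stillU uj q') i≢j mij (trans (sym r) (trans eq r'))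

-- Upper tail of the load of one colour at one vertex

module DegreeBound where

  open import Data.List.Relation.Unary.All as All using (All; []; _∷_)
  open import Data.List.Relation.Unary.AllPairs using ([]; _∷_)
  open Rationals
  open Sums
  open Expectation
  open LocalLemma
  open Moments
  open Hypergraphs
  open Randomness

  -- `Qc` bounds the contribution of the colour `c`, `Q` that of all colours of an edge. The coin of
  -- `e` compensates for all its conflicts in `c`, whereas `alive` tests only those off `v`; the
  -- excess is at most t to the power of the load at `v`. The rest of the exponent pays for
  -- conflicts shared by several edges of a chain.
  module DegreeTail (G : Instance) (st : Instance.State G)
    (θ σ t : ℚ) (0≤θ : 0ℚ ≤ θ) (θ≤1 : θ ≤ 1ℚ) (0≤t : 0ℚ ≤ t) (tτ≡1 : t * (1ℚ - θ) ≡ 1ℚ) (0≤σ : 0ℚ ≤ σ)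
    (σ≤ : ∀ e c → σ ≤ (1ℚ - θ) ^ Instance.conflicts G st e c)
    (K : ℕ) (1≤K : 1 ℕ.≤ K) (Qc Q : ℚ) (0≤Qc : 0ℚ ≤ Qc) (0≤Q : 0ℚ ≤ Q)
    (v : Instance.V G) (c : Instance.C G)
    (σt≤Qc : σ * t ^ (Instance.colourDegree G st v c ℕ.+ K ℕ.* (Instance.R G ℕ.* (Instance.R G ℕ.* Instance.κ G))) ≤ Qc)
    (Qc-Q : ∀ e n → Instance.inc G v e ≡ true → Instance.State.a st e c ≡ true → cnt (Instance.cs G) (Instance.State.a st e) ℕ.≤ suc n →
            Qc * (1ℚ - θ * σ) ^ n ≤ Q)
    (θσ≤1 : θ * σ ≤ 1ℚ)
    where

    open Instance G
    open State st
    open Round G st θ σ t 0≤θ θ≤1 0≤t tτ≡1 0≤σ σ≤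

    O = K ℕ.* (R ℕ.* (R ℕ.* κ))
    dv = colourDegree st v c
    x = θ * σ

    0≤x : 0ℚ ≤ x
    0≤x = 0≤* 0≤θ 0≤σ

    F : J → J → Bool
    F e f = meetOff v e f ∧ a f c

    factor : J → C → Ω → ℚ
    factor e c' ω = if is _≟C_ c' c then ind (coin e c ω) * ind (off (F e) c ω) else ind (not (succ e c' ω))

    -- alive e is at least the indicator that (e, c) survives the round with e uncoloured, and it is a product of
    -- independent factors, one per colour. The edges through v are left out: they matter only if v loses c altogether.
    alive : J → Ω → ℚ
    alive e ω = ∏ cs (λ c' → factor e c' ω)

    0≤factor : ∀ e c' ω → 0ℚ ≤ factor e c' ω
    0≤factor e c' ω with is _≟C_ c' c
    ... | true  = 0≤* (0≤ind (coin e c ω)) (0≤ind (off (F e) c ω))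
    ... | false = 0≤ind (not (succ e c' ω))

    factor≤1 : ∀ e c' ω → factor e c' ω ≤ 1ℚ
    factor≤1 e c' ω with is _≟C_ c' c
    ... | true  = *-mono {ind (coin e c ω)} {1ℚ} {ind (off (F e) c ω)} {1ℚ} (0≤ind (coin e c ω)) 0≤1 (ind≤1 (coin e c ω)) (ind≤1 (off (F e) c ω))
    ... | false = ind≤1 (not (succ e c' ω))

    0≤alive : ∀ e ω → 0ℚ ≤ alive e ω
    0≤alive e ω = 0≤∏ cs (λ c' → 0≤factor e c' ω)

    alive≤1 : ∀ e ω → alive e ω ≤ 1ℚ
    alive≤1 e ω = ∏≤1 cs (λ c' → 0≤factor e c' ω) (λ c' → factor≤1 e c' ω)

    F⇒meet : ∀ {e g} → meetOff v e g ≡ true → meet e g ≡ true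
    F⇒meet {e} {g} q = let u , u∈ , r = any-true _ (vs e) q in any-intro (λ u → inc u g) u∈ (∧₂ (not (is _≟V_ u v)) r)

    factor-dep : ∀ {S : I → Bool} e c' → S (e , c' , true) ≡ true → (∀ g → meet e g ≡ true → S (g , c' , false) ≡ true) → DependsOn S (factor e c')
    factor-dep e c' p q with is _≟C_ c' c in eq
    ... | false = λ ω ω' h → cong (λ s → ind (not s)) (succ-dep e c' q ω ω' h)
    ... | true with is-true _≟C_ eq
    ... | refl = λ ω ω' h → cong₂ (λ s r → ind s * ind r) (bit-dep (e , c , true) p ω ω' h)
                   (off-dep (F e) c (λ g r → q g (F⇒meet {e} (∧₁ (meetOff v e g) r))) ω ω' h)

    alive-dep : ∀ {S : I → Bool} e → (∀ c' → S (e , c' , true) ≡ true) → (∀ g c' → meet e g ≡ true → S (g , c' , false) ≡ true) → DependsOn S (alive e)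
    alive-dep e p q = ∏-dep cs (λ {c'} _ → factor-dep e c' (p c') (λ g → q g c'))

    -- Among edges through `v`, a clash means equality or a second common vertex. By the codegree
    -- bound each earlier edge excludes at most 1 + Rκ candidates.
    clashes : J → J → Bool
    clashes e w = is _≟J_ e w ∨ meetOff v w e

    ok : List J → J → Bool
    ok W e = not (any (clashes e) W)

    m : J → Bool
    m e = inc v e ∧ a e c

    B = K ℕ.* (1 ℕ.+ R ℕ.* κ)

    cnt-meetOff : ∀ w → cnt js (λ e → inc v e ∧ meetOff v w e) ℕ.≤ R ℕ.* κ
    cnt-meetOff w = ℕ.≤-trans (cnt-mono js {q = λ e → any (λ u → inc v e ∧ (not (is _≟V_ u v) ∧ inc u e)) (vs w)} distr)
      (ℕ.≤-trans (cnt-any js (vs w) _ each) (ℕ.*-monoˡ-≤ κ (|vs|≤R w)))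
      where
      distr : ∀ e → inc v e ∧ meetOff v w e ≡ true → any (λ u → inc v e ∧ (not (is _≟V_ u v) ∧ inc u e)) (vs w) ≡ true
      distr e q = let u , u∈ , r = any-true _ (vs w) (∧₂ (inc v e) q) in any-intro (λ u → inc v e ∧ (not (is _≟V_ u v) ∧ inc u e)) u∈ (∧-intro (∧₁ (inc v e) q) r)
      each : ∀ u → cnt js (λ e → inc v e ∧ (not (is _≟V_ u v) ∧ inc u e)) ℕ.≤ κ
      each u with u ≟V v
      ... | yes _  = ℕ.≤-trans (cnt-mono js {q = λ _ → false} (λ e r → ∧₂ (inc v e) r)) (ℕ.≤-trans (ℕ.≤-reflexive (cnt-false js)) ℕ.z≤n)
      ... | no u≢v = codegree≤κ (λ p → u≢v (sym p))

    bad : ∀ W → length W ℕ.≤ K → cnt js (λ e → m e ∧ not (ok W e)) ℕ.≤ B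
    bad W |W|≤K = ℕ.≤-trans (cnt-mono js {q = λ e → any (λ w → inc v e ∧ clashes e w) W} distr)
      (ℕ.≤-trans (cnt-any js W _ each) (ℕ.*-monoˡ-≤ _ |W|≤K))
      where
      distr : ∀ e → m e ∧ not (ok W e) ≡ true → any (λ w → inc v e ∧ clashes e w) W ≡ true
      distr e q = let w , w∈ , r = any-true (clashes e) W (trans (sym (Bool.not-involutive _)) (∧₂ (m e) q)) in
        any-intro (λ w → inc v e ∧ clashes e w) w∈ (∧-intro (∧₁ (inc v e) (∧₁ (m e) q)) r)
      each : ∀ w → cnt js (λ e → inc v e ∧ clashes e w) ℕ.≤ 1 ℕ.+ R ℕ.* κ
      each w = ℕ.≤-trans (cnt-mono js {q = λ e → is _≟J_ e w ∨ (inc v e ∧ meetOff v w e)} split)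
        (ℕ.≤-trans (cnt-∨ js _ _) (ℕ.+-mono-≤ (cnt-is≤1 _≟J_ w js-unique) (cnt-meetOff w)))
        where
        split : ∀ e → inc v e ∧ clashes e w ≡ true → is _≟J_ e w ∨ (inc v e ∧ meetOff v w e) ≡ true
        split e q with is _≟J_ e w
        ... | true  = refl
        ... | false = q

    1≤B : 1 ℕ.≤ B
    1≤B = ℕ.*-mono-≤ 1≤K (ℕ.s≤s ℕ.z≤n)

    module M = MomentBound bits js m alive 0≤alive alive≤1 ok K B 1≤B bad Q 0≤Q
    open M using (Chain; []; _∷_)

    chain-∉ : ∀ {W e} → ok W e ≡ true → ∀ {w} → w ∈ W → e ≢ w
    chain-∉ {W} {e} q w∈ refl = true≢false (∨-introˡ (is-refl _≟J_ e)) (any-false (clashes e) (not-true q) w∈)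

    ok-meetOff : ∀ {W e} → ok W e ≡ true → ∀ {w} → w ∈ W → meetOff v w e ≡ false
    ok-meetOff {W} {e} q {w} w∈ with meetOff v w e in r
    ... | false = refl
    ... | true  = true≢false (∨-introʳ {is _≟J_ e w} r) (any-false (clashes e) (not-true q) w∈)

    chain-m : ∀ {W} → Chain W → ∀ {w} → w ∈ W → m w ≡ true
    chain-m (_∷_ p _ ch) (here refl) = p
    chain-m (_∷_ p _ ch) (there i)   = chain-m ch i

    chain-unique : ∀ {W} → Chain W → Unique W
    chain-unique []           = []
    chain-unique (_∷_ p q ch) = All.tabulate (chain-∉ q) ∷ chain-unique ch

    -- All these edges contain `v`, so those of `W` are rivals of `e`: they succeed in `c'` only if
    -- `e` did not activate it.
    exclusive : ∀ {W e c' ω} → inc v e ≡ true → (∀ {w} → w ∈ W → inc v w ≡ true) → (∀ {w} → w ∈ W → e ≢ w) →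
                ind (succ e c' ω) * ∑ W (λ w → ind (succ w c' ω)) ≡ 0ℚ
    exclusive {W} {e} {c'} {ω} ie iW e∉ with succ e c' ω in se
    ... | false = *-zeroˡ (∑ W (λ w → ind (succ w c' ω)))
    ... | true  = trans (*-identityˡ _) (go W iW e∉)
      where
      ae : a e c' ≡ true
      ae = ∧₁ (a e c') se
      be : b e c' ω ≡ true
      be = ∧₁ (b e c' ω) (∧₂ (a e c') se)
      go : ∀ W → (∀ {w} → w ∈ W → inc v w ≡ true) → (∀ {w} → w ∈ W → e ≢ w) → ∑ W (λ w → ind (succ w c' ω)) ≡ 0ℚ
      go []      iW e∉ = refl
      go (w ∷ W) iW e∉ with succ w c' ω in sw
      ... | false = trans (+-identityˡ _) (go W (λ i → iW (there i)) (λ i → e∉ (there i)))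
      ... | true  = true≢false be (off-elim {λ f → rival w f ∧ a f c'} {c'} {ω} {e} (∧₂ (b w c' ω) (∧₂ (a w c') sw))
                      (∧-intro (∧-intro (meet-intro (iW (here refl)) ie) (cong not (is-false _≟J_ (λ p → e∉ (here refl) (sym p))))) ae))

    none-succ : ∀ {W} → Chain W → ∀ c' ω → ∏ W (λ e → ind (not (succ e c' ω))) ≡ 1ℚ - ∑ W (λ e → ind (succ e c' ω))
    none-succ []                    c' ω = refl
    none-succ {e ∷ W} (_∷_ p q ch)  c' ω = trans (cong₂ _*_ (ind-not (succ e c' ω)) (none-succ ch c' ω))
      (trans (alg s Σ) (trans (cong (λ z → 1ℚ - (s + Σ) + z) (exclusive {ω = ω} (∧₁ (inc v e) p) (λ {w} w∈ → ∧₁ (inc v w) (chain-m ch w∈)) (chain-∉ q))) (+-identityʳ _)))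
      where
      s = ind (succ e c' ω)
      Σ = ∑ W (λ e → ind (succ e c' ω))
      alg : ∀ a b → (1ℚ - a) * (1ℚ - b) ≡ 1ℚ - (a + b) + a * b
      alg = solve-∀ ring

    -- By exclusivity the expectation of the product involves only single-edge probabilities. Going
    -- back from 1 - Σ to a product over edges is what lets `joint` regroup the bounds by edge.
    other-colours : ∀ {W} → Chain W → ∀ c' → 𝔼 (λ ω → ∏ W (λ e → ind (not (succ e c' ω)))) ≤ ∏ W (λ e → if a e c' then 1ℚ - x else 1ℚ)
    other-colours {W} ch c' = begin
      𝔼 (λ ω → ∏ W (λ e → ind (not (succ e c' ω)))) ≡⟨ 𝔼-cong (none-succ ch c') ⟩
      𝔼 (λ ω → 1ℚ - ∑ W (λ e → ind (succ e c' ω))) ≡⟨ 𝔼-1- _ ⟩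
      1ℚ - 𝔼 (λ ω → ∑ W (λ e → ind (succ e c' ω))) ≡⟨ cong (λ z → 1ℚ - z) (𝔼-∑ W (λ e ω → ind (succ e c' ω))) ⟩
      1ℚ - ∑ W (λ e → 𝔼 (λ ω → ind (succ e c' ω))) ≤⟨ 1-anti ((∑-mono W lower)) ⟩
      1ℚ - ∑ W xa ≤⟨ ∏-1-∑ W 0≤xa xa≤1 ⟩
      ∏ W (λ e → 1ℚ - xa e) ≡⟨ ∏-cong W conv ⟩
      ∏ W (λ e → if a e c' then 1ℚ - x else 1ℚ) ∎
      where
      open ≤-Reasoning
      xa : J → ℚ
      xa e = if a e c' then x else 0ℚ
      lower : ∀ e → xa e ≤ 𝔼 (λ ω → ind (succ e c' ω))
      lower e with a e c' in ae
      ... | true  = subst (λ z → x ≤ 𝔼 (λ ω → ind (z ∧ (b e c' ω ∧ off (λ f → rival e f ∧ a f c') c' ω)))) ae (θσ≤𝔼-succ e c' ae)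
      ... | false = 0≤𝔼 (λ ω → ≤-refl)
      0≤xa : ∀ e → 0ℚ ≤ xa e
      0≤xa e with a e c'
      ... | true  = 0≤x
      ... | false = ≤-refl
      xa≤1 : ∀ e → xa e ≤ 1ℚ
      xa≤1 e with a e c'
      ... | true  = θσ≤1
      ... | false = 0≤1
      conv : ∀ e → 1ℚ - xa e ≡ (if a e c' then 1ℚ - x else 1ℚ)
      conv e with a e c'
      ... | true  = refl
      ... | false = refl

    F* : List J → J → Bool
    F* W f = any (λ e → F e f) W

    -- By the codegree bound, the sets F e for e in a chain are nearly disjoint.
    overlap≤O : ∀ {W e} → ok W e ≡ true → length W ℕ.≤ K → cnt js (λ f → F e f ∧ F* W f) ℕ.≤ O
    overlap≤O {W} {e} q |W|≤K = ℕ.≤-trans (cnt-mono js {q = λ f → any (λ w → both w f) W} distr)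
      (ℕ.≤-trans (bound W (λ i → ok-meetOff q i)) (ℕ.*-monoˡ-≤ (R ℕ.* (R ℕ.* κ)) |W|≤K))
      where
      both : J → J → Bool
      both w f = meetOff v e f ∧ meetOff v w f
      distr : ∀ f → F e f ∧ F* W f ≡ true → any (λ w → both w f) W ≡ true
      distr f r = let w , w∈ , z = any-true (λ w → F w f) W (∧₂ (F e f) r) in
        any-intro (λ w → both w f) w∈ (∧-intro (∧₁ (meetOff v e f) (∧₁ (F e f) r)) (∧₁ (meetOff v w f) z))
      single : ∀ w → meetOff v w e ≡ false → cnt js (both w) ℕ.≤ R ℕ.* (R ℕ.* κ)
      single w off-w = ℕ.≤-trans (cnt-mono js {q = λ f → any (λ u → any (λ u' → guarded u u' f) (vs w)) (vs e)} distr2)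
        (ℕ.≤-trans (cnt-any js (vs e) _ (λ u → ℕ.≤-trans (cnt-any js (vs w) _ (pairs u)) (ℕ.*-monoˡ-≤ κ (|vs|≤R w)))) (ℕ.*-monoˡ-≤ (R ℕ.* κ) (|vs|≤R e)))
        where
        guarded : V → V → J → Bool
        guarded u u' f = not (is _≟V_ u u') ∧ (inc u f ∧ inc u' f)
        pairs : ∀ u u' → cnt js (guarded u u') ℕ.≤ κ
        pairs u u' with u ≟V u'
        ... | yes _ = ℕ.≤-trans (ℕ.≤-reflexive (cnt-false js)) ℕ.z≤n
        ... | no p  = codegree≤κ p
        distr2 : ∀ f → both w f ≡ true → any (λ u → any (λ u' → guarded u u' f) (vs w)) (vs e) ≡ true
        distr2 f r =
          let u , u∈ , p    = any-true (λ u → not (is _≟V_ u v) ∧ inc u f) (vs e) (∧₁ (meetOff v e f) r)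
              u' , u'∈ , p' = any-true (λ u → not (is _≟V_ u v) ∧ inc u f) (vs w) (∧₂ (meetOff v e f) r)
              -- A common vertex would make `e` meet `w` off `v`, which `ok` rules out. So `f` joins
              -- two distinct vertices, and their codegree bounds the number of such `f`.
              u≢u' : u ≢ u'
              u≢u' eq = true≢false (any-intro (λ u → not (is _≟V_ u v) ∧ inc u e) u'∈
                          (∧-intro (∧₁ (not (is _≟V_ u' v)) p') (∈⇒inc (subst (_∈ vs e) eq u∈)))) off-w
          in any-intro (λ u → any (λ u' → guarded u u' f) (vs w)) u∈ (any-intro (λ u' → guarded u u' f) u'∈
               (∧-intro (cong not (is-false _≟V_ u≢u')) (∧-intro (∧₂ (not (is _≟V_ u v)) p) (∧₂ (not (is _≟V_ u' v)) p'))))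
      bound : ∀ W → (∀ {w} → w ∈ W → meetOff v w e ≡ false) → cnt js (λ f → any (λ w → both w f) W) ℕ.≤ length W ℕ.* (R ℕ.* (R ℕ.* κ))
      bound []      h = ℕ.≤-reflexive (cnt-false js)
      bound (w ∷ W) h = ℕ.≤-trans (cnt-∨ js (both w) _) (ℕ.+-mono-≤ (single w (h (here refl))) (bound W (λ i → h (there i))))

    conflicts≤ : ∀ e → conflicts st e c ℕ.≤ cnt js (F e) ℕ.+ dv
    conflicts≤ e = ℕ.≤-trans (cnt-mono js {q = λ f → F e f ∨ (inc v f ∧ a f c)} split) (cnt-∨ js (F e) _)
      where
      split : ∀ f → meet e f ∧ a f c ≡ true → F e f ∨ (inc v f ∧ a f c) ≡ true
      split f q with any-true _ (vs e) (∧₁ (meet e f) q)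
      ... | u , u∈ , r with u ≟V v
      ... | yes refl = ∨-introʳ {F e f} (∧-intro r (∧₂ (meet e f) q))
      ... | no u≢v   = ∨-introˡ (∧-intro (any-intro (λ u → not (is _≟V_ u v) ∧ inc u f) u∈ (∧-intro (cong not (is-false _≟V_ u≢v)) r)) (∧₂ (meet e f) q))

    1≤t : 1ℚ ≤ t
    1≤t = ≤-trans (≤-reflexive (sym tτ≡1)) (≤-trans (*-monoʳ 0≤t τ≤1) (≤-reflexive (*-identityʳ t)))

    -- A new edge `e` brings the coin σ t^n with n at most |F e| plus the load at `v`, and enlarges
    -- the union `F*` by F e up to an overlap of at most `O`. So t^|F e| cancels against τ^|F e|.
    -- Inserting t^O τ^O = 1 keeps subtraction out of the exponents.
    coins-and-offs : ∀ {W} → Chain W → length W ℕ.≤ K → ∏ W (λ e → σ * t ^ conflicts st e c) * τ ^ cnt js (F* W) ≤ Qc ^ length W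
    coins-and-offs []                   h = ≤-reflexive (trans (*-identityˡ _) (cong (τ ^_) (cnt-false js)))
    coins-and-offs {e ∷ W} (_∷_ p q ch) h = begin
      σ * t ^ n * Π * τ ^ cnt js (F* (e ∷ W))
        ≡⟨ trans (*-comm (σ * t ^ n * Π) _) (trans (sym (*-identityˡ _)) (cong (_* (τ ^ c' * (σ * t ^ n * Π))) (sym (tτ^ O)))) ⟩
      t ^ O * τ ^ O * (τ ^ c' * (σ * t ^ n * Π))
        ≡⟨ alg (t ^ O) (τ ^ O) (τ ^ c') σ (t ^ n) Π ⟩
      σ * (t ^ n * t ^ O) * ((τ ^ c' * τ ^ O) * Π)
        ≡⟨ cong₂ (λ y z → σ * y * (z * Π)) (sym (^-+ t n O)) (sym (^-+ τ c' O)) ⟩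
      σ * t ^ (n ℕ.+ O) * (τ ^ (c' ℕ.+ O) * Π)
        ≤⟨ *-mono (0≤* 0≤σ (0≤^ (n ℕ.+ O) 0≤t)) (0≤* (0≤^ (cF ℕ.+ cW) 0≤τ) 0≤Π)
             (*-monoʳ 0≤σ (^-monoʳ 1≤t (ℕ.+-monoˡ-≤ O (conflicts≤ e))))
             (*-monoˡ 0≤Π (^-anti 0≤τ τ≤1 (ℕ.≤-trans (cnt-∨-∧ js (F e) (F* W)) (ℕ.+-monoʳ-≤ c' (overlap≤O {W} {e} q (ℕ.≤-trans (ℕ.n≤1+n _) h)))))) ⟩
      σ * t ^ (cF ℕ.+ dv ℕ.+ O) * (τ ^ (cF ℕ.+ cW) * Π)
        ≡⟨ cong₂ (λ y z → σ * y * (z * Π)) (trans (cong (t ^_) (ℕ.+-assoc cF dv O)) (^-+ t cF (dv ℕ.+ O))) (^-+ τ cF cW) ⟩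
      σ * (t ^ cF * t ^ (dv ℕ.+ O)) * (τ ^ cF * τ ^ cW * Π)
        ≡⟨ alg2 σ (t ^ cF) (t ^ (dv ℕ.+ O)) (τ ^ cF) (τ ^ cW) Π ⟩
      t ^ cF * τ ^ cF * (σ * t ^ (dv ℕ.+ O)) * (Π * τ ^ cW)
        ≡⟨ cong (_* (Π * τ ^ cW)) (trans (cong (_* (σ * t ^ (dv ℕ.+ O))) (tτ^ cF)) (*-identityˡ (σ * t ^ (dv ℕ.+ O)))) ⟩
      σ * t ^ (dv ℕ.+ O) * (Π * τ ^ cW)
        ≤⟨ *-mono (0≤* 0≤σ (0≤^ (dv ℕ.+ O) 0≤t)) (0≤^ (length W) 0≤Qc) σt≤Qc (coins-and-offs ch (ℕ.≤-trans (ℕ.n≤1+n _) h)) ⟩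
      Qc * Qc ^ length W ∎
      where
      open ≤-Reasoning
      n  = conflicts st e c
      c' = cnt js (F* (e ∷ W))
      cF = cnt js (F e)
      cW = cnt js (F* W)
      Π = ∏ W (λ e → σ * t ^ conflicts st e c)
      0≤Π : 0ℚ ≤ Π
      0≤Π = 0≤∏ W (λ e → 0≤* 0≤σ (0≤^ (conflicts st e c) 0≤t))
      alg : ∀ a b c d e f → a * b * (c * (d * e * f)) ≡ d * (e * a) * ((c * b) * f)
      alg = solve-∀ ring
      alg2 : ∀ a b c d e f → a * (b * c) * (d * e * f) ≡ b * d * (a * c) * (f * e)
      alg2 = solve-∀ ring

    -- Coins are independent of activations, and the tests of all edges in the chain merge into one
    -- test on the union `F*`; the tests need not be independent of each other.
    same-colour : ∀ {W} → Chain W → length W ℕ.≤ K → 𝔼 (λ ω → ∏ W (λ e → ind (coin e c ω) * ind (off (F e) c ω))) ≤ Qc ^ length W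
    same-colour {W} ch h = ≤-trans (≤-reflexive (begin
      𝔼 (λ ω → ∏ W (λ e → ind (coin e c ω) * ind (off (F e) c ω)))
        ≡⟨ 𝔼-cong (λ ω → trans (∏-* W _ _) (cong (∏ W (λ e → ind (coin e c ω)) *_) (offs W ω))) ⟩
      𝔼 (λ ω → ∏ W (λ e → ind (coin e c ω)) * ind (off (F* W) c ω))
        ≡⟨ 𝔼-indep (λ y → proj₂ (proj₂ y)) (∏-dep W (λ {e} _ → ind-dep {f = coin e c} (bit-dep (e , c , true) refl))) (ind-dep (off-dep (F* W) c λ _ _ → refl)) ⟩
      𝔼 (λ ω → ∏ W (λ e → ind (coin e c ω))) * 𝔼 (λ ω → ind (off (F* W) c ω))
        ≡⟨ cong₂ _*_ (𝔼-∏ (λ e y → is _≟I_ y (e , c , true)) {λ e ω → ind (coin e c ω)} (chain-unique ch) (λ e → ind-dep {f = coin e c} (bit-dep (e , c , true) (is-refl _≟I_ _))) disjoint) (𝔼-off (F* W) c) ⟩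
      ∏ W (λ e → 𝔼 (λ ω → ind (coin e c ω))) * τ ^ cnt js (F* W)
        ≡⟨ cong (_* τ ^ cnt js (F* W)) (∏-cong W (λ e → 𝔼-coin e c)) ⟩
      ∏ W (λ e → σ * t ^ conflicts st e c) * τ ^ cnt js (F* W) ∎)) (coins-and-offs ch h)
      where
      open ≡-Reasoning
      disjoint : ∀ {f g} → f ≢ g → ∀ y → is _≟I_ y (g , c , true) ≡ true → is _≟I_ y (f , c , true) ≡ false
      disjoint f≢g y e = is-false _≟I_ λ p → f≢g (cong proj₁ (trans (sym p) (is-true _≟I_ e)))
      offs : ∀ W ω → ∏ W (λ e → ind (off (F e) c ω)) ≡ ind (off (F* W) c ω)
      offs W ω = trans (∏-cong W (λ e → ind-all _ js)) (trans (∏-swap W js _) (trans (∏-cong js (λ f → col W f)) (sym (ind-all _ js))))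
        where
        col : ∀ W f → ∏ W (λ e → ind (not (F e f ∧ b f c ω))) ≡ ind (not (F* W f ∧ b f c ω))
        col []      f = refl
        col (e ∷ W) f with F e f | b f c ω | col W f
        ... | false | _     | r = trans (*-identityˡ _) r
        ... | true  | true  | r = *-zeroˡ (∏ W (λ e → ind (not (F e f ∧ true))))
        ... | true  | false | r = trans (*-identityˡ _) (trans r (cong (λ z → ind (not z)) (Bool.∧-zeroʳ (F* W f))))

    gain : J → C → ℚ
    gain e c' = if is _≟C_ c' c then Qc else (if a e c' then 1ℚ - x else 1ℚ)

    0≤1-x : 0ℚ ≤ 1ℚ - x
    0≤1-x = diff θσ≤1

    0≤gain : ∀ e c' → 0ℚ ≤ gain e c'
    0≤gain e c' with is _≟C_ c' c | a e c'
    ... | true  | _     = 0≤Qc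
    ... | false | true  = 0≤1-x
    ... | false | false = 0≤1

    ∏-gain : ∀ e → inc v e ≡ true → a e c ≡ true → ∏ cs (gain e) ≤ Q
    ∏-gain e ie ae = ≤-trans (≤-reflexive (begin
      ∏ cs (gain e) ≡⟨ ∏-cong cs split ⟩
      ∏ cs (λ c' → (if is _≟C_ c' c then Qc else 1ℚ) * (if a e c' ∧ not (is _≟C_ c' c) then 1ℚ - x else 1ℚ))
                                                       ≡⟨ ∏-* cs _ _ ⟩
      _ ≡⟨ cong₂ _*_ (∏-if cs _ Qc) (∏-if cs _ (1ℚ - x)) ⟩
      Qc ^ cnt cs (λ c' → is _≟C_ c' c) * (1ℚ - x) ^ n ≡⟨ cong (λ k → Qc ^ k * (1ℚ - x) ^ n) one ⟩
      Qc * 1ℚ * (1ℚ - x) ^ n ≡⟨ cong (_* (1ℚ - x) ^ n) (*-identityʳ Qc) ⟩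
      Qc * (1ℚ - x) ^ n ∎)) (Qc-Q e n ie ae count)
      where
      open ≡-Reasoning
      n = cnt cs (λ c' → a e c' ∧ not (is _≟C_ c' c))
      one : cnt cs (λ c' → is _≟C_ c' c) ≡ 1
      one = ℕ.≤-antisym (cnt-is≤1 _≟C_ c cs-unique) (cnt-∈ _ (cs-complete c) (is-refl _≟C_ c))
      split : ∀ c' → gain e c' ≡ (if is _≟C_ c' c then Qc else 1ℚ) * (if a e c' ∧ not (is _≟C_ c' c) then 1ℚ - x else 1ℚ)
      split c' with is _≟C_ c' c | a e c'
      ... | true  | true  = sym (*-identityʳ Qc)
      ... | true  | false = sym (*-identityʳ Qc)
      ... | false | true  = sym (*-identityˡ _)
      ... | false | false = refl
      -- The colour `c` is already accounted for by `Qc`, so one colour less than the list remains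
      -- to colour `e`; this is the `suc n` in `Qc-Q`.
      count : cnt cs (a e) ℕ.≤ suc n
      count = ℕ.≤-trans (cnt-mono cs {q = λ c' → is _≟C_ c' c ∨ (a e c' ∧ not (is _≟C_ c' c))} cover)
        (ℕ.≤-trans (cnt-∨ cs _ _) (ℕ.+-monoˡ-≤ n (ℕ.≤-reflexive one)))
        where
        cover : ∀ c' → a e c' ≡ true → is _≟C_ c' c ∨ (a e c' ∧ not (is _≟C_ c' c)) ≡ true
        cover c' q with is _≟C_ c' c
        ... | true  = refl
        ... | false = ∧-intro q refl

    -- Bits of different colours are independent, so the expectation factors by colour. Each factor
    -- is bounded by a product over edges, and exchanging the products collects one `Q` per edge.
    joint : ∀ {W} → Chain W → length W ℕ.≤ K → 𝔼 (λ ω → ∏ W (λ e → alive e ω)) ≤ Q ^ length W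
    joint {W} ch h = begin
      𝔼 (λ ω → ∏ W (λ e → alive e ω)) ≡⟨ 𝔼-cong (λ ω → ∏-swap W cs (λ e c' → factor e c' ω)) ⟩
      𝔼 (λ ω → ∏ cs (λ c' → ∏ W (λ e → factor e c' ω))) ≡⟨ 𝔼-∏ ofColour {λ c' ω → ∏ W (λ e → factor e c' ω)} cs-unique (λ c' → ∏-dep W (λ {e} _ → factor-dep e c' (is-refl _≟C_ c') (λ _ _ → is-refl _≟C_ c'))) ofColour-disjoint ⟩
      ∏ cs (λ c' → 𝔼 (λ ω → ∏ W (λ e → factor e c' ω))) ≤⟨ ∏-mono cs (λ c' → 0≤𝔼 (λ ω → 0≤∏ W (λ e → 0≤factor e c' ω))) per-colour ⟩
      ∏ cs (λ c' → ∏ W (λ e → gain e c')) ≡⟨ ∏-swap W cs gain ⟨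
      ∏ W (λ e → ∏ cs (gain e)) ≤⟨ along ch ⟩
      Q ^ length W ∎
      where
      open ≤-Reasoning
      per-colour : ∀ c' → 𝔼 (λ ω → ∏ W (λ e → factor e c' ω)) ≤ ∏ W (λ e → gain e c')
      per-colour c' with is _≟C_ c' c
      ... | true  = ≤-trans (same-colour ch h) (≤-reflexive (sym (∏-const W Qc)))
      ... | false = other-colours ch c'
      along : ∀ {W} → Chain W → ∏ W (λ e → ∏ cs (gain e)) ≤ Q ^ length W
      along []                   = ≤-refl
      along {e ∷ W} (_∷_ p q ch) = *-mono (0≤∏ cs (0≤gain e)) (0≤^ (length W) 0≤Q) (∏-gain e (∧₁ (inc v e) p) (∧₂ (inc v e) p)) (along ch)

    open M public using (total)

    degree-tail : ∀ {η y} → 0ℚ ≤ η → η * M.μ ≤ y → 𝔼 (λ ω → ind (y <ᵇ M.total ω)) * η ^ K ≤ 1ℚ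
    degree-tail = M.tail-bound joint

-- A successful round via the local lemma

module OneRound where

  open import Data.List.Relation.Unary.All as All using (All; []; _∷_)
  open import Data.List.Relation.Unary.AllPairs using ([]; _∷_)
  open Rationals
  open Sums
  open Expectation
  open LocalLemma
  open Moments
  open Hypergraphs
  open Randomness
  open DegreeBound

  -- `lists≤` limits the number of events attached to an edge, and `alive⇒U` ensures that loads
  -- count uncoloured edges only.
  record Good (G : Instance) (l d : ℚ) (Lmax : ℕ) (st : Instance.State G) : Set where
    open Instance G
    open State st
    field
      lists   : ∀ j → U j ≡ true → l ≤ ι (cnt cs (a j))
      lists≤  : ∀ j → cnt cs (a j) ℕ.≤ Lmax
      loads   : ∀ v c → ι (colourDegree st v c) ≤ d
      alive⇒U : ∀ j c → a j c ≡ true → U j ≡ true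

  module Step (G : Instance) (st : Instance.State G) {l d : ℚ} {Lmax : ℕ} (good : Good G l d Lmax st)
    (θ σ t : ℚ) (0≤θ : 0ℚ ≤ θ) (θ≤1 : θ ≤ 1ℚ) (0≤t : 0ℚ ≤ t) (tτ≡1 : t * (1ℚ - θ) ≡ 1ℚ) (0≤σ : 0ℚ ≤ σ)
    (0≤d : 0ℚ ≤ d) (H₁ : ∀ n → ι n ≤ ι (Instance.R G) * d → σ ≤ (1ℚ - θ) ^ n)
    where

    open Instance G
    open State st
    open Good good

    conflicts≤Rd : ∀ e c → ι (conflicts st e c) ≤ ι R * d
    conflicts≤Rd e c = ≤-trans (ι-mono (cnt-mono js {q = λ f → any (λ v → inc v f ∧ a f c) (vs e)} distr))
      (≤-trans (bound (vs e)) (*-monoˡ 0≤d (ι-mono (|vs|≤R e))))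
      where
      distr : ∀ f → meet e f ∧ a f c ≡ true → any (λ v → inc v f ∧ a f c) (vs e) ≡ true
      distr f q = let v , v∈ , r = any-true _ (vs e) (∧₁ (meet e f) q) in any-intro (λ v → inc v f ∧ a f c) v∈ (∧-intro r (∧₂ (meet e f) q))
      bound : ∀ us → ι (cnt js (λ f → any (λ v → inc v f ∧ a f c) us)) ≤ ι (length us) * d
      bound []       = ≤-trans (≤-reflexive (cong ι (cnt-false js))) (≤-reflexive (sym (*-zeroˡ d)))
      bound (u ∷ us) = ≤-trans (ι-mono (cnt-∨ js (λ f → inc u f ∧ a f c) _)) (≤-trans (≤-reflexive (ι-+ (colourDegree st u c) _)) (≤-trans (+-mono-≤ (loads u c) (bound us)) (≤-reflexive (e' d (ι (length us))))))
        where
        e' : ∀ c l → c + l * c ≡ (1ℚ + l) * c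
        e' = solve-∀ ring

    σ≤ : ∀ e c → σ ≤ (1ℚ - θ) ^ conflicts st e c
    σ≤ e c = H₁ (conflicts st e c) (conflicts≤Rd e c)

    σ≤1 : σ ≤ 1ℚ
    σ≤1 = H₁ 0 (0≤* (0≤ι R) 0≤d)

    open Round G st θ σ t 0≤θ θ≤1 0≤t tτ≡1 0≤σ σ≤

    x : ℚ
    x = θ * σ

    x≤1 : x ≤ 1ℚ
    x≤1 = ≤-trans (*-mono 0≤θ 0≤1 θ≤1 σ≤1) (≤-reflexive (*-identityˡ 1ℚ))

    S : J → I → Bool
    S e y = near₂ e (proj₁ y)

    succ-S : ∀ e c → DependsOn (S e) (succ e c)
    succ-S e c = succ-dep e c λ g q → meet⇒near₂ q

    module Finish (p : ℚ) (0≤p : 0ℚ ≤ p) (H : ∀ n → l ≤ ι n → (1ℚ - x) ^ n ≤ p) (1≤Δ : 1 ℕ.≤ Δ₄) (H₄ : ι Δ₄ * (p + p) ≤ ½) where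

      uncoloured : J → Ω → Bool
      uncoloured e ω = U e ∧ all (λ c → not (succ e c ω)) cs

      uncoloured-dep : ∀ e → DependsOn (S e) (uncoloured e)
      uncoloured-dep e = ∧-dep {f = λ _ → U e} (λ _ _ _ → refl) λ ω ω' eq → go cs λ c → succ-S e c ω ω' eq
        where
        go : ∀ cs {p q : C → Bool} → (∀ c → p c ≡ q c) → all (λ c → not (p c)) cs ≡ all (λ c → not (q c)) cs
        go []       h = refl
        go (c ∷ cs) h = cong₂ (λ u v → not u ∧ v) (h c) (go cs h)

      -- Successes of `e` in different colours depend on disjoint sets of bits, and each available
      -- colour fails with probability at most 1 - x.
      uncoloured≤p : ∀ e → 𝔼 (λ ω → ind (uncoloured e ω)) ≤ p
      uncoloured≤p e with U e in Ue
      ... | false = ≤-trans (≤-reflexive (𝔼-const 0ℚ)) 0≤p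
      ... | true  = begin
        𝔼 (λ ω → ind (all (λ c → not (succ e c ω)) cs)) ≡⟨ 𝔼-cong (λ ω → ind-all _ cs) ⟩
        𝔼 (λ ω → ∏ cs (λ c → ind (not (succ e c ω)))) ≡⟨ 𝔼-∏ ofColour {λ c ω → ind (not (succ e c ω))} cs-unique
                                                                (λ c ω ω' eq → cong (λ s → ind (not s)) (succ-dep e c (λ _ _ → is-refl _≟C_ c) ω ω' eq)) ofColour-disjoint ⟩
        ∏ cs (λ c → 𝔼 (λ ω → ind (not (succ e c ω)))) ≤⟨ ∏-mono cs (λ c → 0≤𝔼 (λ ω → 0≤ind (not (succ e c ω)))) each ⟩
        ∏ cs (λ c → if a e c then 1ℚ - x else 1ℚ) ≡⟨ ∏-if cs (a e) (1ℚ - x) ⟩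
        (1ℚ - x) ^ cnt cs (a e) ≤⟨ H (cnt cs (a e)) (lists e Ue) ⟩
        p ∎
        where
        open ≤-Reasoning
        each : ∀ c → 𝔼 (λ ω → ind (not (succ e c ω))) ≤ (if a e c then 1ℚ - x else 1ℚ)
        each c with a e c in ae
        ... | false = ≤-reflexive (𝔼-const 1ℚ)
        ... | true  = ≤-trans (≤-reflexive (trans (𝔼-cong (λ ω → ind-not (b e c ω ∧ off (λ f → rival e f ∧ a f c) c ω))) (𝔼-1- _)))
                        (1-anti ((subst (λ z → x ≤ 𝔼 (λ ω → ind (z ∧ (b e c ω ∧ off (λ f → rival e f ∧ a f c) c ω)))) ae (θσ≤𝔼-succ e c ae))))
          where import Data.Rational.Properties as ℚ

      open LLL bits uncoloured S uncoloured-dep near₄ (λ e y → near₄-far e (proj₁ y)) p 0≤p uncoloured≤p Δ₄ 1≤Δ H₄ using (avoid)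

      finish : Colorable st
      -- No edge is left uncoloured, so a constant colouring serves for the next state.
      finish = extend ω ((λ _ → c₀) , (λ j u → none j u) , (λ i j u → none i u))
        where
        avoided = avoid js cnt-near₄
        ω = proj₁ avoided
        all-not : ∀ e cs → any (λ c → succ e c ω) cs ≡ false → all (λ c → not (succ e c ω)) cs ≡ true
        all-not e []       q = refl
        all-not e (c ∷ cs) q with succ e c ω
        ... | false = all-not e cs q
        none : {P : Set} → ∀ j → U j ∧ not (any (λ c → succ j c ω) cs) ≡ true → P
        none j u = true≢false (∧-intro (∧₁ (U j) u) (all-not j cs (not-true (∧₂ (U j) u)))) (proj₂ avoided (js-complete j))

    -- For a single edge the losses of distinct colours are independent, so `ok` excludes only
    -- repetitions, and a chain of length at most K has at most K of them.
    module Loss (K : ℕ) (1≤K : 1 ℕ.≤ K) (e : J) where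

      lost : C → Ω → ℚ
      lost c ω = ind (not (surv e c ω))

      ok : List C → C → Bool
      ok W c = not (any (is _≟C_ c) W)

      bad : ∀ W → length W ℕ.≤ K → cnt cs (λ c → a e c ∧ not (ok W c)) ℕ.≤ K
      bad W |W|≤K = ℕ.≤-trans (cnt-mono cs {q = λ c → any (λ w → is _≟C_ c w) W} λ c q → trans (sym (Bool.not-involutive _)) (∧₂ (a e c) q))
        (ℕ.≤-trans (cnt-any cs W _ (λ w → cnt-is≤1 _≟C_ w cs-unique)) (ℕ.≤-trans (ℕ.≤-reflexive (ℕ.*-identityʳ _)) |W|≤K))

      open MomentBound bits cs (a e) lost (λ c ω → 0≤ind (not (surv e c ω))) (λ c ω → ind≤1 (not (surv e c ω))) ok K K 1≤K bad (1ℚ - σ) (diff σ≤1) public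

      chain-unique : ∀ {W} → Chain W → Unique W
      chain-unique []           = []
      chain-unique (_∷_ {c} {W} p q ch) = All.tabulate (λ w∈ c≡w → true≢false (is-refl _≟C_ c) (any-false (is _≟C_ c) (not-true q) (subst (_∈ W) (sym c≡w) w∈))) ∷ chain-unique ch

      joint : ∀ {W} → Chain W → length W ℕ.≤ K → 𝔼 (λ ω → ∏ W (λ c → lost c ω)) ≤ (1ℚ - σ) ^ length W
      joint {W} ch _ = ≤-reflexive (trans
        (𝔼-∏ ofColour {lost} (chain-unique ch) (λ c ω ω' eq → cong (λ s → ind (not s)) (surv-dep e c (is-refl _≟C_ c) (λ _ _ → is-refl _≟C_ c) ω ω' eq)) ofColour-disjoint)
        (trans (∏-cong W (λ c → trans (𝔼-cong (λ ω → ind-not (surv e c ω))) (trans (𝔼-1- (λ ω → ind (surv e c ω))) (cong (λ z → 1ℚ - z) (𝔼-surv e c))))) (∏-const W _)))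

      kept : ∀ ω → ι (cnt cs (λ c → a e c ∧ surv e c ω)) + total ω ≡ ι (cnt cs (a e))
      kept ω = trans (cong (_+ total ω) (ι-cnt cs _)) (trans (sym (∑-+ cs _ _)) (trans (∑-cong cs each) (sym (ι-cnt cs (a e)))))
        where
        each : ∀ c → ind (a e c ∧ surv e c ω) + ind (a e c) * lost c ω ≡ ind (a e c)
        each c with a e c | surv e c ω
        ... | true  | true  = refl
        ... | true  | false = refl
        ... | false | true  = refl
        ... | false | false = refl

      total-dep : DependsOn (S e) total
      total-dep ω ω' eq = ∑-cong cs λ c → cong (λ s → ind (a e c) * ind (not s))
        (surv-dep e c (meet⇒near₂ (meet-refl e)) (λ g q → meet⇒near₂ q) ω ω' eq)

    -- Thresholds are at least `h` times the moment bound, so 1 ≤ w h^K makes every tail at most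
    -- `w`. An edge carries one event for its list and at most R·Lmax for its vertices and colours,
    -- whence the factor in `H₄`. `H₅` and `H₆` translate the thresholds into the new list and load
    -- bounds.
    module Advance (K : ℕ) (1≤K : 1 ℕ.≤ K) (Qc Q : ℚ) (0≤Qc : 0ℚ ≤ Qc) (0≤Q : 0ℚ ≤ Q)
      (H₂ : ∀ n → ι n ≤ d → σ * t ^ (n ℕ.+ K ℕ.* (R ℕ.* (R ℕ.* κ))) ≤ Qc)
      (H₃ : ∀ n → l ≤ ι (suc n) → Qc * (1ℚ - θ * σ) ^ n ≤ Q)
      (h w : ℚ) (0<h : 0ℚ < h) (0≤w : 0ℚ ≤ w) (1≤whᴷ : 1ℚ ≤ w * h ^ K)
      (1≤Δ : 1 ℕ.≤ Δ₄) (H₄ : ι Δ₄ * ((1ℚ + ι R * ι Lmax) * w + (1ℚ + ι R * ι Lmax) * w) ≤ ½)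
      (l' d' : ℚ) (H₅ : ∀ k → l ≤ ι k → l' ≤ ι k - h * (ι k * (1ℚ - σ) + ι K))
      (H₆ : h * (d * Q + ι (K ℕ.* (1 ℕ.+ R ℕ.* κ))) ≤ d')
      where

      module L (e : J) = Loss K 1≤K e
      module D (v : V) (c : C) = DegreeTail G st θ σ t 0≤θ θ≤1 0≤t tτ≡1 0≤σ σ≤ K 1≤K Qc Q 0≤Qc 0≤Q v c (H₂ (colourDegree st v c) (loads v c))
        (λ e n _ ae q → H₃ n (≤-trans (lists e (alive⇒U e c ae)) (ι-mono q))) x≤1

      B : ℕ
      B = K ℕ.* (1 ℕ.+ R ℕ.* κ)

      threshold : J → ℚ
      threshold e = h * L.μ e

      lossy : J → Ω → Bool
      lossy e ω = threshold e <ᵇ L.total e ω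

      crowded : V → C → Ω → Bool
      crowded v c ω = d' <ᵇ D.total v c ω

      -- A load event belongs to a vertex and a colour, but is attached to every edge at that vertex
      -- having the colour. All events are then indexed by edges, and `near₄` describes their
      -- dependence.
      bad : J → Ω → Bool
      bad e ω = lossy e ω ∨ any (λ v → any (λ c → a e c ∧ crowded v c ω) cs) (vs e)

      unlikely : ∀ {P} → P * h ^ K ≤ 1ℚ → P ≤ w
      unlikely {P} q = *-cancelʳ (0<^ K 0<h) (≤-trans q 1≤whᴷ)

      lossy≤w : ∀ e → 𝔼 (λ ω → ind (lossy e ω)) ≤ w
      lossy≤w e = unlikely (L.tail-bound e (L.joint e) (<⇒≤ 0<h) ≤-refl)

      crowded≤w : ∀ v c → 𝔼 (λ ω → ind (crowded v c ω)) ≤ w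
      crowded≤w v c = unlikely (D.degree-tail v c (<⇒≤ 0<h) (≤-trans (*-monoʳ (<⇒≤ 0<h) (+-monoˡ-≤ (ι B) (*-monoˡ 0≤Q (loads v c)))) H₆))

      p : ℚ
      p = (1ℚ + ι R * ι Lmax) * w

      0≤p : 0ℚ ≤ p
      0≤p = 0≤* (0≤+ 0≤1 (0≤* (0≤ι R) (0≤ι Lmax))) 0≤w

      bad≤p : ∀ e → 𝔼 (λ ω → ind (bad e ω)) ≤ p
      bad≤p e = begin
        𝔼 (λ ω → ind (bad e ω))
          ≤⟨ 𝔼-mono (λ ω → ≤-trans (ind-∨ (lossy e ω) _) (+-monoʳ-≤ (ind (lossy e ω)) (union ω))) ⟩
        𝔼 (λ ω → ind (lossy e ω) + ∑ (vs e) (λ v → ∑ cs (λ c → ind (a e c) * ind (crowded v c ω))))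
          ≡⟨ trans (𝔼-+ (λ ω → ind (lossy e ω)) _) (cong (𝔼 (λ ω → ind (lossy e ω)) +_) (trans (𝔼-∑ (vs e) (λ v ω → ∑ cs (λ c → ind (a e c) * ind (crowded v c ω))))
               (∑-cong (vs e) (λ v → trans (𝔼-∑ cs (λ c ω → ind (a e c) * ind (crowded v c ω))) (∑-cong cs (λ c → 𝔼-*ˡ (ind (a e c)) _)))))) ⟩
        𝔼 (λ ω → ind (lossy e ω)) + ∑ (vs e) (λ v → ∑ cs (λ c → ind (a e c) * 𝔼 (λ ω → ind (crowded v c ω))))
          ≤⟨ +-mono-≤ (lossy≤w e) (∑-≤-length (vs e) (λ {v} _ → ≤-trans (∑-ind-* cs (a e) (λ c _ → crowded≤w v c)) (*-monoˡ 0≤w (ι-mono (lists≤ e))))) ⟩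
        w + ι (length (vs e)) * (ι Lmax * w)
          ≤⟨ +-monoʳ-≤ w (*-monoˡ (0≤* (0≤ι Lmax) 0≤w) (ι-mono (|vs|≤R e))) ⟩
        w + ι R * (ι Lmax * w)
          ≡⟨ alg (ι R) (ι Lmax) w ⟩
        p ∎
        where
        open ≤-Reasoning
        alg : ∀ a b c → c + a * (b * c) ≡ (1ℚ + a * b) * c
        alg = solve-∀ ring
        union : ∀ ω → ind (any (λ v → any (λ c → a e c ∧ crowded v c ω) cs) (vs e)) ≤ ∑ (vs e) (λ v → ∑ cs (λ c → ind (a e c) * ind (crowded v c ω)))
        union ω = ≤-trans (ind-any _ (vs e)) (∑-mono (vs e) (λ v → ≤-trans (ind-any _ cs) (≤-reflexive (∑-cong cs (λ c → ind-∧ (a e c) _)))))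

      crowded-dep : ∀ {v e} → v ∈ vs e → ∀ c → DependsOn (S e) (crowded v c)
      crowded-dep {v} {e} v∈ c ω ω' eq = cong (d' <ᵇ_) (∑-cong js term)
        where
        term : ∀ f → ind (D.m v c f) * D.alive v c f ω ≡ ind (D.m v c f) * D.alive v c f ω'
        term f with inc v f in vf
        ... | false = trans (*-zeroˡ (D.alive v c f ω)) (sym (*-zeroˡ (D.alive v c f ω')))
        ... | true  = cong (ind (a f c) *_) (D.alive-dep v c f (λ _ → meet⇒near₂ ef) (λ g _ q → near₂-intro ef q) ω ω' eq)
          where
          ef : meet e f ≡ true
          ef = meet-intro (∈⇒inc v∈) vf

      bad-dep : ∀ e → DependsOn (S e) (bad e)
      bad-dep e ω ω' eq = cong₂ _∨_ (cong (threshold e <ᵇ_) (L.total-dep e ω ω' eq))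
        (any-cong (vs e) λ v∈ → any-cong cs λ {c} _ → cong (a e c ∧_) (crowded-dep v∈ c ω ω' eq))
        where
        any-cong : {A : Set} (xs : List A) {p q : A → Bool} → (∀ {x} → x ∈ xs → p x ≡ q x) → any p xs ≡ any q xs
        any-cong []       h = refl
        any-cong (x ∷ xs) h = cong₂ _∨_ (h (here refl)) (any-cong xs (λ i → h (there i)))

      open LLL bits bad S bad-dep near₄ (λ e y → near₄-far e (proj₁ y)) p 0≤p bad≤p Δ₄ 1≤Δ H₄ using (avoid)

      module _ (ω : Ω) (no-bad : ∀ e → bad e ω ≡ false) where

        ∨-false : ∀ a {b} → a ∨ b ≡ false → a ≡ false × b ≡ false
        ∨-false false e = refl , e

        few-lost : ∀ e → L.total e ω ≤ threshold e
        few-lost e = <ᵇ-false (proj₁ (∨-false (lossy e ω) (no-bad e)))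

        not-crowded : ∀ {v c e} → inc v e ≡ true → a e c ≡ true → D.total v c ω ≤ d'
        not-crowded {v} {c} {e} ve ae with crowded v c ω in q
        ... | false = <ᵇ-false q
        ... | true  = true≢false
          (any-intro (λ v → any (λ c → a e c ∧ crowded v c ω) cs) (inc⇒∈ ve) (any-intro (λ c → a e c ∧ crowded v c ω) (cs-complete c) (∧-intro ae q)))
          (proj₂ (∨-false (lossy e ω) (no-bad e)))

        st' : State
        st' = next ω

        coloured : J → Bool
        coloured e = any (λ c → succ e c ω) cs

        lists' : ∀ e → State.U st' e ≡ true → l' ≤ ι (cnt cs (State.a st' e))
        lists' e u = begin
          l' ≤⟨ H₅ (cnt cs (a e)) (lists e (∧₁ (U e) u)) ⟩
          ι (cnt cs (a e)) - threshold e ≤⟨ +-monoʳ-≤ (ι (cnt cs (a e))) (ℚ.neg-antimono-≤ (few-lost e)) ⟩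
          ι (cnt cs (a e)) - L.total e ω ≡⟨ move (L.kept e ω) ⟩
          ι (cnt cs (λ c → a e c ∧ surv e c ω)) ≤⟨ ι-mono (cnt-mono cs λ c q → ∧-intro (∧₁ (a e c) q) (∧-intro (∧₂ (a e c) q) (∧₂ (U e) u))) ⟩
          ι (cnt cs (State.a st' e)) ∎
          where
          open ≤-Reasoning
          move : ∀ {a b c} → a + b ≡ c → c - b ≡ a
          move {a} {b} refl = alg a b
            where
            alg : ∀ a b → a + b - b ≡ a
            alg = solve-∀ ring

        survives : ∀ v c e → State.a st' e c ≡ true → D.alive v c e ω ≡ 1ℚ
        survives v c e q = trans (∏-cong cs factor≡1) (∏-1 cs)
          where
          s : surv e c ω ≡ true
          s = ∧₁ (surv e c ω) (∧₂ (a e c) q)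
          unc : coloured e ≡ false
          unc = not-true (∧₂ (surv e c ω) (∧₂ (a e c) q))
          off-mono : ∀ fs → all (λ f → not ((meet e f ∧ a f c) ∧ b f c ω)) fs ≡ true → all (λ f → not (D.F v c e f ∧ b f c ω)) fs ≡ true
          off-mono []       o = refl
          off-mono (f ∷ fs) o = ∧-intro (head (∧₁ (not ((meet e f ∧ a f c) ∧ b f c ω)) o)) (off-mono fs (∧₂ (not ((meet e f ∧ a f c) ∧ b f c ω)) o))
            where
            head : not ((meet e f ∧ a f c) ∧ b f c ω) ≡ true → not (D.F v c e f ∧ b f c ω) ≡ true
            head r with D.F v c e f in Ff
            ... | false = refl
            ... | true rewrite D.F⇒meet v c {e} {f} (∧₁ (meetOff v e f) Ff) | ∧₂ (meetOff v e f) Ff = r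
          factor≡1 : ∀ c' → D.factor v c e c' ω ≡ 1ℚ
          factor≡1 c' with is _≟C_ c' c
          ... | true  = cong₂ (λ y z → ind y * ind z) (∧₁ (coin e c ω) s) (off-mono js (∧₂ (coin e c ω) s))
          ... | false = cong (λ z → ind (not z)) (any-false (λ c → succ e c ω) unc (cs-complete c'))

        loads' : ∀ v c → ι (colourDegree st' v c) ≤ d'
        loads' v c = by-cases (any (λ e → inc v e ∧ a e c) js) refl
          where
          0≤d' : 0ℚ ≤ d'
          0≤d' = ≤-trans (0≤* (<⇒≤ 0<h) (0≤+ (0≤* 0≤d 0≤Q) (0≤ι B))) H₆
          still : ∀ {e} → inc v e ∧ State.a st' e c ≡ true → inc v e ∧ a e c ≡ true
          still {e} r = ∧-intro (∧₁ (inc v e) r) (∧₁ (a e c) (∧₂ (inc v e) r))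
          term : ∀ e → ind (inc v e ∧ State.a st' e c) ≤ ind (D.m v c e) * D.alive v c e ω
          term e = ind-≤ (0≤* (0≤ind (D.m v c e)) (D.0≤alive v c e ω)) λ r →
            ≤-reflexive (sym (trans (cong₂ (λ y z → ind y * z) (still {e} r) (survives v c e (∧₂ (inc v e) r))) (*-identityˡ 1ℚ)))
          by-cases : ∀ x → any (λ e → inc v e ∧ a e c) js ≡ x → ι (colourDegree st' v c) ≤ d'
          by-cases true  q = let e , _ , r = any-true (λ e → inc v e ∧ a e c) js q in
            ≤-trans (≤-reflexive (ι-cnt js (λ e → inc v e ∧ State.a st' e c))) (≤-trans (∑-mono js term) (not-crowded (∧₁ (inc v e) r) (∧₂ (inc v e) r)))
          -- If no edge at `v` has `c`, no event watches this load, but it is 0 already.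
          by-cases false q = ≤-trans (ι-mono (cnt-mono js {q = λ _ → false} λ e r → trans (sym (any-false (λ e → inc v e ∧ a e c) q (js-complete e))) (still {e} r)))
            (≤-trans (≤-reflexive (cong ι (cnt-false js))) 0≤d')

        good' : Good G l' d' Lmax st'
        good' = record
          { lists   = lists'
          ; lists≤  = λ e → ℕ.≤-trans (cnt-mono cs λ c q → ∧₁ (a e c) q) (lists≤ e)
          ; loads   = loads'
          ; alive⇒U = λ e c q → ∧-intro (alive⇒U e c (∧₁ (a e c) q)) (∧₂ (surv e c ω) (∧₂ (a e c) q)) }

      advance : ∃ λ st' → Good G l' d' Lmax st' × (Colorable st' → Colorable st)
      advance = let ω , q = avoid js cnt-near₄ in next ω , good' ω (λ e → q (js-complete e)) , extend ω

-- Polynomial inequalities behind one round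

module Arithmetic where

  open import Data.Integer using (+_)
  open import Data.Rational as ℚ using (_/_)
  open Rationals

  -- `c` is the ceiling for both u and Ru; four times `c` is exactly ⅛, as used in `4z≤⅛y`.
  ¼ ⅛ c : ℚ
  ¼ = + 1 / 4
  ⅛ = + 1 / 8
  c = + 1 / 32

  0≤¼ : 0ℚ ≤ ¼
  0≤¼ = from-yes (0ℚ ℚ.≤? ¼)

  0≤⅛ : 0ℚ ≤ ⅛
  0≤⅛ = from-yes (0ℚ ℚ.≤? ⅛)

  0≤c : 0ℚ ≤ c
  0≤c = from-yes (0ℚ ℚ.≤? c)

  ½≤1 : ½ ≤ 1ℚ
  ½≤1 = from-yes (½ ℚ.≤? 1ℚ)

  c≤½ : c ≤ ½
  c≤½ = from-yes (c ℚ.≤? ½)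

  2c≤1 : c + c ≤ 1ℚ
  2c≤1 = from-yes (c + c ℚ.≤? 1ℚ)

  c≤1 : c ≤ 1ℚ
  c≤1 = from-yes (c ℚ.≤? 1ℚ)

  -- With l = ε(1 - g) this bounds the survival probability of a pair by 1 - εg/2 times σ; e absorbs the overlaps and the
  -- replacement of the list size by one less.
  decay : ∀ {ε g ρ e} → 0ℚ ≤ ε → ε ≤ ½ → 0ℚ ≤ g → g ≤ 1ℚ → 0ℚ ≤ ρ → 0ℚ ≤ e →
          ρ * (ε * ε) + ε * ε + (e + e + e) ≤ ¼ * (ε * g) →
          1ℚ ≤ (1ℚ - ½ * (ε * g)) * ((1ℚ - ε * (1ℚ - g) - e) * (1ℚ + ε - ε * (ρ * (ε * (1ℚ - g))) - e))
  decay {ε} {g} {ρ} {e} 0≤ε ε≤½ 0≤g g≤1 0≤ρ 0≤e small = begin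
    -- The gain y minus errors of at most ¼y still outweighs the loss ½y, with a quadratic remainder
    -- that y ≤ ½ controls.
    1ℚ ≤⟨ ≤-by (y * (¼ * (½ - y) + ⅛ * (½ - y) + ¼ * ¼)) (0≤* 0≤y (0≤+ (0≤+ (0≤* 0≤¼ (diff y≤½)) (0≤* 0≤⅛ (diff y≤½))) (0≤* 0≤¼ 0≤¼))) (e₁ y) ⟩
    (1ℚ - ½ * y) * (1ℚ + y - ¼ * y) ≤⟨ *-monoʳ 0≤1-½y (+-monoʳ-≤ (1ℚ + y) (ℚ.neg-antimono-≤ small)) ⟩
    (1ℚ - ½ * y) * (1ℚ + y - (ρ * (ε * ε) + ε * ε + (e + e + e)))
                                            ≤⟨ *-monoʳ 0≤1-½y (≤-by _ cert≥0 (e₂ ε g ρ e)) ⟩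
    (1ℚ - ½ * y) * ((1ℚ - l - e) * (1ℚ + ε - ε * (ρ * l) - e)) ∎
    where
    open ≤-Reasoning
    y = ε * g
    l = ε * (1ℚ - g)
    0≤y : 0ℚ ≤ y
    0≤y = 0≤* 0≤ε 0≤g
    0≤l : 0ℚ ≤ l
    0≤l = 0≤* 0≤ε (diff g≤1)
    y≤½ : y ≤ ½
    y≤½ = ≤-trans (*-mono 0≤ε 0≤1 ε≤½ g≤1) (≤-reflexive (*-identityʳ ½))
    ε≤1 : ε ≤ 1ℚ
    ε≤1 = ≤-trans ε≤½ ½≤1
    0≤1-½y : 0ℚ ≤ 1ℚ - ½ * y
    0≤1-½y = subst (0ℚ ≤_) (e₃ y) (0≤+ (diff y≤½) (0≤+ 0≤½ (0≤* 0≤½ 0≤y)))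
      where
      e₃ : ∀ y → ½ - y + (½ + ½ * y) ≡ 1ℚ - ½ * y
      e₃ = solve-∀ ring
    e₁ : ∀ y → (1ℚ - ½ * y) * (1ℚ + y - ¼ * y) - 1ℚ ≡ y * (¼ * (½ - y) + ⅛ * (½ - y) + ¼ * ¼)
    e₁ = solve-∀ ring
    cert≥0 : 0ℚ ≤ l * (ε * (ρ * l)) + l * e + e * (ε * (ρ * l)) + e * e + ρ * ε * y + ε * y + e * (1ℚ - ε)
    cert≥0 = 0≤+ (0≤+ (0≤+ (0≤+ (0≤+ (0≤+ (0≤* 0≤l 0≤ερl) (0≤* 0≤l 0≤e)) (0≤* 0≤e 0≤ερl)) (0≤* 0≤e 0≤e)) (0≤* (0≤* 0≤ρ 0≤ε) 0≤y)) (0≤* 0≤ε 0≤y)) (0≤* 0≤e (diff ε≤1))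
      where
      0≤ερl : 0ℚ ≤ ε * (ρ * l)
      0≤ερl = 0≤* 0≤ε (0≤* 0≤ρ 0≤l)
    e₂ : ∀ ε g ρ e → (1ℚ - ε * (1ℚ - g) - e) * (1ℚ + ε - ε * (ρ * (ε * (1ℚ - g))) - e) - (1ℚ + ε * g - (ρ * (ε * ε) + ε * ε + (e + e + e)))
       ≡ ε * (1ℚ - g) * (ε * (ρ * (ε * (1ℚ - g)))) + ε * (1ℚ - g) * e + e * (ε * (ρ * (ε * (1ℚ - g)))) + e * e + ρ * ε * (ε * g) + ε * (ε * g) + e * (1ℚ - ε)
    e₂ = solve-∀ ring

  -- Of the gain ½y a part ¼y is kept. The other ¼y, worth at least ⅛y after multiplication by σ ≥
  -- ½, pays for all deviations, which amount to at most 4z.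
  loads-shrink : ∀ {z y σ q b} → 0ℚ ≤ z → z ≤ 1ℚ → 0ℚ ≤ y → ½ ≤ σ → σ ≤ 1ℚ → (z + z) + (z + z) ≤ ⅛ * y → 0ℚ ≤ q → b ≤ z * q →
                 (1ℚ + z) * (q * (σ * (1ℚ - ½ * y)) + b) ≤ (1ℚ - ¼ * y) * (q * (σ - z))
  loads-shrink {z} {y} {σ} {q} {b} 0≤z z≤1 0≤y ½≤σ σ≤1 4z≤ 0≤q b≤zq = begin
    (1ℚ + z) * (q * (σ * (1ℚ - ½ * y)) + b) ≤⟨ *-monoʳ (0≤+ 0≤1 0≤z) (+-monoʳ-≤ (q * (σ * (1ℚ - ½ * y))) b≤zq) ⟩
    (1ℚ + z) * (q * (σ * (1ℚ - ½ * y)) + z * q) ≤⟨ ≤-by _ (0≤* 0≤q (0≤+ (0≤+ (0≤+ (0≤+ (0≤+ (0≤* (0≤* 0≤¼ 0≤y) (diff ½≤σ)) (diff 4z≤)) (0≤* (0≤* 0≤¼ 0≤y) 0≤z)) (0≤* 0≤z (diff σ≤1))) (0≤* (0≤* (0≤* 0≤½ 0≤z) 0≤σ) 0≤y)) (0≤* 0≤z (diff z≤1)))) (e z y σ q) ⟩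
    (1ℚ - ¼ * y) * (q * (σ - z)) ∎
    where
    open ≤-Reasoning
    0≤σ : 0ℚ ≤ σ
    0≤σ = ≤-trans 0≤½ ½≤σ
    e : ∀ z y σ q → (1ℚ - ¼ * y) * (q * (σ - z)) - (1ℚ + z) * (q * (σ * (1ℚ - ½ * y)) + z * q)
      ≡ q * (¼ * y * (σ - ½) + (⅛ * y - (z + z + (z + z))) + ¼ * y * z + z * (1ℚ - σ) + ½ * z * σ * y + z * (1ℚ - z))
    e = solve-∀ ring

  -- Here r is the probability of losing a colour and b the moment error. For r ≤ ½ the right-hand
  -- side increases with k, so lists longer than l do no harm.
  lists-shrink : ∀ {z r l k b} → 0ℚ ≤ z → z ≤ 1ℚ → 0ℚ ≤ r → r ≤ ½ → 0ℚ ≤ l → l ≤ k → (b + b) + (b + b) ≤ l * z → 0ℚ ≤ b →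
                 l * ((1ℚ - r) - z) ≤ k - (1ℚ + z) * (k * r + b)
  lists-shrink {z} {r} {l} {k} {b} 0≤z z≤1 0≤r r≤½ 0≤l l≤k 4b≤ 0≤b = ≤-by _
    (0≤+ (0≤+ (0≤+ (0≤* (diff l≤k) (0≤+ (0≤* (0≤+ 0≤1 0≤1) (diff r≤½)) (0≤* 0≤r (diff z≤1)))) (0≤* (0≤* 0≤l 0≤z) (diff r≤½))) (0≤* 0≤½ (diff 4b≤))) (0≤* 0≤b (diff z≤1)))
    (e z r l k b)
    where
    e : ∀ z r l k b → k - (1ℚ + z) * (k * r + b) - l * ((1ℚ - r) - z)
      ≡ (k - l) * ((1ℚ + 1ℚ) * (½ - r) + r * (1ℚ - z)) + l * z * (½ - r) + ½ * (l * z - (b + b + (b + b))) + b * (1ℚ - z)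
    e = solve-∀ ring

  -- Origin of the exponent 16: with a = ny, Bernoulli turns the power into at least 1 + 4a, and
  -- (1-2a)(1+4a) ≥ 1 as long as 2a ≤ ½.
  potential : ∀ {y} n → 0ℚ ≤ y → (1ℚ + 1ℚ) * (ι n * y) ≤ ½ → 1ℚ ≤ (1ℚ - (ι n * y + ι n * y)) * (1ℚ + ¼ * y) ^ (16 ℕ.* n)
  potential {y} n 0≤y small = begin
    1ℚ ≤⟨ ≤-by _ (0≤* (0≤* (0≤+ 0≤1 0≤1) 0≤a) (0≤+ (diff small) (diff small))) (e a) ⟩
    (1ℚ - (a + a)) * (1ℚ + (a + a + (a + a))) ≡⟨ cong (λ b → (1ℚ - (a + a)) * (1ℚ + b)) 4a ⟩
    (1ℚ - (a + a)) * (1ℚ + ι (16 ℕ.* n) * (¼ * y)) ≤⟨ *-monoʳ 0≤1-2a (bernoulli (¼ * y) (16 ℕ.* n) (0≤+ 0≤1 (0≤* 0≤¼ 0≤y))) ⟩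
    (1ℚ - (a + a)) * (1ℚ + ¼ * y) ^ (16 ℕ.* n) ∎
    where
    open ≤-Reasoning
    a = ι n * y
    0≤a : 0ℚ ≤ a
    0≤a = 0≤* (0≤ι n) 0≤y
    e : ∀ a → (1ℚ - (a + a)) * (1ℚ + (a + a + (a + a))) - 1ℚ ≡ (1ℚ + 1ℚ) * a * ((½ - (1ℚ + 1ℚ) * a) + (½ - (1ℚ + 1ℚ) * a))
    e = solve-∀ ring
    0≤1-2a : 0ℚ ≤ 1ℚ - (a + a)
    0≤1-2a = subst (0ℚ ≤_) (e₂ a) (0≤+ (diff small) 0≤½)
      where
      e₂ : ∀ a → ½ - (1ℚ + 1ℚ) * a + ½ ≡ 1ℚ - (a + a)
      e₂ = solve-∀ ring
    4a : a + a + (a + a) ≡ ι (16 ℕ.* n) * (¼ * y)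
    4a = sym (trans (cong (_* (¼ * y)) (ι-* 16 n)) (e₃ (ι n) y))
      where
      e₃ : ∀ a y → ι 16 * a * (¼ * y) ≡ a * y + a * y + (a * y + a * y)
      e₃ = solve-∀ ring

-- Choice of parameters and iteration of the rounds

module Iteration where

  open import Data.Integer using (+_)
  open import Data.Rational as ℚ using ()
  open Rationals
  open Sums
  open Hypergraphs
  open OneRound
  open Arithmetic

  -- u = 1/S stands for the power D^(-α): a round activates every edge with total probability about ε = u³, z = u⁷ is the
  -- relative error allowed in the concentration bounds, and K is the order of the moments used; (1 + z)^K ≥ 2^S then
  -- exceeds the number Δ₄ of dependent events. The load-to-list ratio of a round is d/l = 1 - g.
  module Constants (G : Instance) (S : ℕ) (u : ℚ) (0<u : 0ℚ < u) (uS≡1 : u * ι S ≡ 1ℚ) (u≤c : u ≤ c)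
    (Ru≤c : ι (Instance.R G) * u ≤ c) (1≤R : 1 ℕ.≤ Instance.R G) (1≤κ : 1 ℕ.≤ Instance.κ G) (Lmax : ℕ) (1≤Δ : 1 ℕ.≤ Instance.Δ₄ G)
    (Δ-small : 4 ℕ.* (Instance.Δ₄ G ℕ.* (1 ℕ.+ Instance.R G ℕ.* Lmax)) ℕ.≤ 2 ℕ.^ S)
    where

    open Instance G

    ρ : ℚ
    ρ = ι R

    0≤u : 0ℚ ≤ u
    0≤u = <⇒≤ 0<u

    u≤1 : u ≤ 1ℚ
    u≤1 = ≤-trans u≤c c≤1

    0≤u^ : ∀ n → 0ℚ ≤ u ^ n
    0≤u^ n = 0≤^ n 0≤u

    u^-anti : ∀ {m n} → m ℕ.≤ n → u ^ n ≤ u ^ m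
    u^-anti = ^-anti 0≤u u≤1

    u^≤c : ∀ n → u ^ suc n ≤ c
    u^≤c n = ≤-trans (u^-anti {1} {suc n} (ℕ.s≤s ℕ.z≤n)) (≤-trans (≤-reflexive (*-identityʳ u)) u≤c)

    1≤ρ : 1ℚ ≤ ρ
    1≤ρ = 1≤ι (1≤R)

    0≤ρ : 0ℚ ≤ ρ
    0≤ρ = 0≤ι R

    u^S^ : ∀ n → u ^ n * ι (S ℕ.^ n) ≡ 1ℚ
    u^S^ n = trans (cong (u ^ n *_) (ι-^ S n)) (trans (sym (*-^ u (ι S) n)) (trans (cong (_^ n) uS≡1) (1^ n)))

    K : ℕ
    K = S ℕ.^ 8

    0<S : 0 ℕ.< S
    0<S = pos S uS≡1
      where
      pos : ∀ n → u * ι n ≡ 1ℚ → 0 ℕ.< n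
      pos zero    e = ⊥-elim (ℚ.<-irrefl (trans (sym (*-zeroʳ u)) e) 0<1)
      pos (suc n) e = ℕ.s≤s ℕ.z≤n

    1≤K : 1 ℕ.≤ K
    1≤K = ℕ.m^n>0 S {{ℕ.>-nonZero 0<S}} 8

    w : ℚ
    w = ½ ^ S

    0≤w : 0ℚ ≤ w
    0≤w = 0≤^ S 0≤½

    w2^S : ι (2 ℕ.^ S) * w ≡ 1ℚ
    w2^S = trans (cong (_* w) (ι-^ 2 S)) (trans (sym (*-^ (ι 2) ½ S)) (1^ S))

    Δ-bound : ∀ {P} → 0ℚ ≤ P → P ≤ 1ℚ + ρ * ι Lmax → ι Δ₄ * (P * w + P * w) ≤ ½
    Δ-bound {P} 0≤P P≤ = begin
      ι Δ₄ * (P * w + P * w) ≡⟨ e (ι Δ₄) P w ⟩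
      ½ * (ι 4 * (ι Δ₄ * P) * w) ≤⟨ *-monoʳ 0≤½ (*-monoˡ 0≤w (*-monoʳ (0≤ι 4) (*-monoʳ (0≤ι Δ₄) P≤))) ⟩
      ½ * (ι 4 * (ι Δ₄ * (1ℚ + ρ * ι Lmax)) * w) ≡⟨ cong (λ x → ½ * (x * w)) (sym conv) ⟩
      ½ * (ι (4 ℕ.* (Δ₄ ℕ.* (1 ℕ.+ R ℕ.* Lmax))) * w) ≤⟨ *-monoʳ 0≤½ (*-monoˡ 0≤w (ι-mono Δ-small)) ⟩
      ½ * (ι (2 ℕ.^ S) * w) ≡⟨ cong (½ *_) w2^S ⟩
      ½ ∎
      where
      open ≤-Reasoning
      e : ∀ d p w → d * (p * w + p * w) ≡ ½ * (ι 4 * (d * p) * w)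
      e = solve-∀ ring
      conv : ι (4 ℕ.* (Δ₄ ℕ.* (1 ℕ.+ R ℕ.* Lmax))) ≡ ι 4 * (ι Δ₄ * (1ℚ + ρ * ι Lmax))
      conv = trans (ι-* 4 (Δ₄ ℕ.* (1 ℕ.+ R ℕ.* Lmax))) (cong (ι 4 *_) (trans (ι-* Δ₄ (1 ℕ.+ R ℕ.* Lmax)) (cong (λ x → ι Δ₄ * (1ℚ + x)) (ι-* R Lmax))))

    z : ℚ
    z = u ^ 7

    0≤z : 0ℚ ≤ z
    0≤z = 0≤u^ 7

    z≤1 : z ≤ 1ℚ
    z≤1 = ^≤1 7 0≤u u≤1

    -- Split K as S times S^7. Since z = S^(-7), Bernoulli gives (1+z)^(S^7) ≥ 2, and the S-th power
    -- of this cancels w = 2^(-S).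
    1≤w[1+z]ᴷ : 1ℚ ≤ w * (1ℚ + z) ^ K
    1≤w[1+z]ᴷ = begin
      1ℚ ≤⟨ 1≤^ S (≤-trans (≤-reflexive two) (*-monoʳ 0≤½ (bernoulli z (S ℕ.^ 7) (0≤+ 0≤1 0≤z)))) ⟩
      (½ * (1ℚ + z) ^ (S ℕ.^ 7)) ^ S ≡⟨ *-^ ½ _ S ⟩
      ½ ^ S * ((1ℚ + z) ^ (S ℕ.^ 7)) ^ S ≡⟨ cong (w *_) (sym (^-* (1ℚ + z) S (S ℕ.^ 7))) ⟩
      w * (1ℚ + z) ^ K ∎
      where
      open ≤-Reasoning
      two : 1ℚ ≡ ½ * (1ℚ + ι (S ℕ.^ 7) * z)
      two = cong (λ x → ½ * (1ℚ + x)) (sym (trans (*-comm (ι (S ℕ.^ 7)) z) (u^S^ 7)))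

    module Round {ℓ l : ℚ} (κ≤ : ι κ ≤ u ^ 20 * ℓ) (ℓ≤l : ℓ ≤ l) where

      κ≤l : ι κ ≤ u ^ 20 * l
      κ≤l = ≤-trans κ≤ (*-monoʳ (0≤u^ 20) ℓ≤l)

      1≤u²⁰l : 1ℚ ≤ u ^ 20 * l
      1≤u²⁰l = ≤-trans (1≤ι (1≤κ)) κ≤l

      0<l : 0ℚ < l
      0<l with 0ℚ ℚ.<? l
      ... | yes p = p
      ... | no ¬p = ⊥-elim (ℚ.<-irrefl refl (<-≤-trans 0<1 (≤-trans 1≤u²⁰l (≤-trans (*-monoʳ (0≤u^ 20) (ℚ.≮⇒≥ ¬p)) (≤-reflexive (*-zeroʳ (u ^ 20)))))))

      0≤l : 0ℚ ≤ l
      0≤l = <⇒≤ 0<l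

      1≤u^l : ∀ {n} → n ℕ.≤ 20 → 1ℚ ≤ u ^ n * l
      1≤u^l n≤20 = ≤-trans 1≤u²⁰l (*-monoˡ 0≤l (u^-anti n≤20))

      -- The budget of the exponent 20: K = u^(-8) consumes eight powers of u. In `B≤` and `O≤` each
      -- further factor R consumes one more, because Ru is small.
      Kκ≤ : ι K * ι κ ≤ u ^ 12 * l
      Kκ≤ = begin
        ι K * ι κ ≤⟨ *-monoʳ (0≤ι K) κ≤l ⟩
        ι K * (u ^ 20 * l) ≡⟨ cong (λ x → ι K * (x * l)) (^-+ u 8 12) ⟩
        ι K * (u ^ 8 * u ^ 12 * l) ≡⟨ e (ι K) (u ^ 8) (u ^ 12) l ⟩
        u ^ 8 * ι K * (u ^ 12 * l) ≡⟨ trans (cong (_* (u ^ 12 * l)) (u^S^ 8)) (*-identityˡ _) ⟩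
        u ^ 12 * l ∎
        where
        open ≤-Reasoning
        e : ∀ k a b l → k * (a * b * l) ≡ a * k * (b * l)
        e = solve-∀ ring

      K≤ : ι K ≤ u ^ 12 * l
      K≤ = ≤-trans (≤-reflexive (sym (*-identityʳ (ι K)))) (≤-trans (*-monoʳ (0≤ι K) (1≤ι (1≤κ))) Kκ≤)

      4K≤lz : (ι K + ι K) + (ι K + ι K) ≤ l * z
      4K≤lz = begin
        (ι K + ι K) + (ι K + ι K) ≡⟨ e (ι K) ⟩
        ι 4 * ι K ≤⟨ *-monoʳ (0≤ι 4) K≤ ⟩
        ι 4 * (u ^ 12 * l) ≡⟨ e₂ (u ^ 4) z l (ι 4) (^-+ u 1 11) (^-+ u 4 7) ⟩
        ι 4 * u ^ 5 * (l * z) ≤⟨ *-monoˡ (0≤* 0≤l 0≤z) (≤-trans (*-monoʳ (0≤ι 4) (u^≤c 4)) (from-yes (ι 4 * c ℚ.≤? 1ℚ))) ⟩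
        1ℚ * (l * z) ≡⟨ *-identityˡ _ ⟩
        l * z ∎
        where
        open ≤-Reasoning
        e : ∀ k → (k + k) + (k + k) ≡ ι 4 * k
        e = solve-∀ ring
        e₂ : ∀ a b l f → u ^ 12 ≡ u ^ 1 * u ^ 11 → u ^ 11 ≡ a * b → f * (u ^ 12 * l) ≡ f * (u * a) * (l * b)
        e₂ a b l f p q = trans (cong (λ x → f * (x * l)) (trans p (cong (u ^ 1 *_) q))) (e₃ u a b l f)
          where
          e₃ : ∀ u a b l f → f * (u * 1ℚ * (a * b) * l) ≡ f * (u * a) * (l * b)
          e₃ = solve-∀ ring

      B≤ : ι (K ℕ.* (1 ℕ.+ R ℕ.* κ)) ≤ u ^ 11 * l
      B≤ = begin
        ι (K ℕ.* (1 ℕ.+ R ℕ.* κ)) ≡⟨ trans (ι-* K _) (cong (λ x → ι K * (1ℚ + x)) (ι-* R κ)) ⟩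
        ι K * (1ℚ + ρ * ι κ) ≡⟨ e (ι K) ρ (ι κ) ⟩
        ι K + ρ * (ι K * ι κ) ≤⟨ +-mono-≤ K≤ (*-monoʳ 0≤ρ Kκ≤) ⟩
        u ^ 12 * l + ρ * (u ^ 12 * l) ≡⟨ e₂ u ρ (u ^ 11) l ⟩
        (u + ρ * u) * (u ^ 11 * l) ≤⟨ *-monoˡ (0≤* (0≤u^ 11) 0≤l) (≤-trans (+-mono-≤ u≤c Ru≤c) 2c≤1) ⟩
        1ℚ * (u ^ 11 * l) ≡⟨ *-identityˡ _ ⟩
        u ^ 11 * l ∎
        where
        open ≤-Reasoning
        e : ∀ k p x → k * (1ℚ + p * x) ≡ k + p * (k * x)
        e = solve-∀ ring
        e₂ : ∀ u p a l → u * a * l + p * (u * a * l) ≡ (u + p * u) * (a * l)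
        e₂ = solve-∀ ring

      O : ℕ
      O = K ℕ.* (R ℕ.* (R ℕ.* κ))

      O≤ : ι O ≤ u ^ 10 * l
      O≤ = begin
        ι O ≡⟨ trans (ι-* K _) (cong (ι K *_) (trans (ι-* R _) (cong (ρ *_) (ι-* R κ)))) ⟩
        ι K * (ρ * (ρ * ι κ)) ≡⟨ e (ι K) ρ (ι κ) ⟩
        ρ * ρ * (ι K * ι κ) ≤⟨ *-monoʳ (0≤* 0≤ρ 0≤ρ) Kκ≤ ⟩
        ρ * ρ * (u ^ 12 * l) ≡⟨ e₂ u ρ (u ^ 10) l ⟩
        (ρ * u) * (ρ * u) * (u ^ 10 * l) ≤⟨ *-monoˡ (0≤* (0≤u^ 10) 0≤l) (*-mono (0≤* 0≤ρ 0≤u) 0≤1 (≤-trans Ru≤c c≤1) (≤-trans Ru≤c c≤1)) ⟩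
        1ℚ * (u ^ 10 * l) ≡⟨ *-identityˡ _ ⟩
        u ^ 10 * l ∎
        where
        open ≤-Reasoning
        e : ∀ k p x → k * (p * (p * x)) ≡ p * p * (k * x)
        e = solve-∀ ring
        e₂ : ∀ u p a l → p * p * (u * (u * a) * l) ≡ p * u * (p * u) * (a * l)
        e₂ = solve-∀ ring

      module At {g : ℚ} (u≤g : u ≤ g) (g≤1 : g ≤ 1ℚ) where

        -- With θ = ε/l, the number λ' = θd bounds the expected activations of a colour at a vertex
        -- and r = Rλ' those around an edge, so survival probabilities can all be lowered to σ = 1 -
        -- r. The first-order relative gain of lists over loads is y.
        γ d ε λ' y r σ : ℚ
        γ  = 1ℚ - g
        d  = γ * l
        ε  = u ^ 3
        λ' = ε * γ
        y  = ε * g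
        r  = ρ * λ'
        σ  = 1ℚ - r

        0≤g : 0ℚ ≤ g
        0≤g = ≤-trans 0≤u u≤g

        0≤γ : 0ℚ ≤ γ
        0≤γ = diff g≤1

        γ≤1 : γ ≤ 1ℚ
        γ≤1 = 1-≤1 0≤g

        0≤ε : 0ℚ ≤ ε
        0≤ε = 0≤u^ 3

        ε≤c : ε ≤ c
        ε≤c = u^≤c 2

        0≤λ : 0ℚ ≤ λ'
        0≤λ = 0≤* 0≤ε 0≤γ

        λ≤ε : λ' ≤ ε
        λ≤ε = ≤-trans (*-monoʳ 0≤ε γ≤1) (≤-reflexive (*-identityʳ ε))

        0≤d : 0ℚ ≤ d
        0≤d = 0≤* 0≤γ 0≤l

        r≤c : r ≤ c
        r≤c = begin
          ρ * (ε * γ) ≤⟨ *-monoʳ 0≤ρ λ≤ε ⟩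
          ρ * u ^ 3 ≡⟨ *-assoc ρ u (u ^ 2) ⟨
          ρ * u * u ^ 2 ≤⟨ *-mono (0≤* 0≤ρ 0≤u) 0≤1 Ru≤c (^≤1 2 0≤u u≤1) ⟩
          c * 1ℚ ≡⟨ *-identityʳ c ⟩
          c ∎
          where open ≤-Reasoning

        0≤r : 0ℚ ≤ r
        0≤r = 0≤* 0≤ρ 0≤λ

        r≤½ : r ≤ ½
        r≤½ = ≤-trans r≤c c≤½

        ½≤σ : ½ ≤ σ
        ½≤σ = 1-anti r≤½

        0≤σ : 0ℚ ≤ σ
        0≤σ = ≤-trans 0≤½ ½≤σ

        σ≤1 : σ ≤ 1ℚ
        σ≤1 = 1-≤1 0≤r

        u⁴≤y : u ^ 4 ≤ y
        u⁴≤y = ≤-trans (≤-reflexive (*-comm u (u ^ 3))) (*-monoʳ 0≤ε u≤g)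

        0≤y : 0ℚ ≤ y
        0≤y = 0≤* 0≤ε 0≤g

        4z≤⅛y : (z + z) + (z + z) ≤ ⅛ * y
        4z≤⅛y = begin
          (z + z) + (z + z) ≡⟨ e z ⟩
          ι 4 * z ≡⟨ cong (ι 4 *_) (^-+ u 3 4) ⟩
          ι 4 * (u ^ 3 * u ^ 4) ≤⟨ *-monoʳ (0≤ι 4) (*-mono (0≤u^ 3) 0≤y ε≤c u⁴≤y) ⟩
          ι 4 * (c * y) ≡⟨ *-assoc (ι 4) c y ⟨
          ⅛ * y ∎
          where
          open ≤-Reasoning
          e : ∀ k → (k + k) + (k + k) ≡ ι 4 * k
          e = solve-∀ ring

        private
          l⁻¹ = inverse 0<l

        θ : ℚ
        θ = ε * proj₁ l⁻¹

        θl≡ε : θ * l ≡ ε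
        θl≡ε = trans (*-assoc ε _ l) (trans (cong (ε *_) (proj₂ (proj₂ l⁻¹))) (*-identityʳ ε))

        0≤θ : 0ℚ ≤ θ
        0≤θ = 0≤* 0≤ε (<⇒≤ (proj₁ (proj₂ l⁻¹)))

        θ-scale : ∀ {a} b → a ≤ b * l → a * θ ≤ b * ε
        θ-scale {a} b h = ≤-trans (*-monoˡ 0≤θ h) (≤-reflexive (trans (*-assoc b l θ) (cong (b *_) (trans (*-comm l θ) θl≡ε))))

        θ≤u^ : ∀ {n} → n ℕ.≤ 20 → θ ≤ u ^ n
        θ≤u^ {n} h = ≤-trans (≤-reflexive (sym (*-identityˡ θ))) (≤-trans (θ-scale (u ^ n) (1≤u^l h)) (≤-trans (*-monoʳ (0≤u^ n) (≤-trans ε≤c c≤1)) (≤-reflexive (*-identityʳ _))))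

        θ≤½ : θ ≤ ½
        θ≤½ = ≤-trans (θ≤u^ {1} (ℕ.s≤s ℕ.z≤n)) (≤-trans (u^≤c 0) c≤½)

        θ≤1 : θ ≤ 1ℚ
        θ≤1 = ≤-trans θ≤½ ½≤1

        0<1-θ : 0ℚ < 1ℚ - θ
        0<1-θ = <-≤-trans (from-yes (0ℚ ℚ.<? 1ℚ - ½)) (1-anti (θ≤½))

        private
          τ⁻¹ = inverse 0<1-θ

        t : ℚ
        t = proj₁ τ⁻¹

        0≤t : 0ℚ ≤ t
        0≤t = <⇒≤ (proj₁ (proj₂ τ⁻¹))

        tτ≡1 : t * (1ℚ - θ) ≡ 1ℚ
        tτ≡1 = proj₂ (proj₂ τ⁻¹)

        e : ℚ
        e = ι O * θ + θ

        0≤Oθ : 0ℚ ≤ ι O * θ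
        0≤Oθ = 0≤* (0≤ι O) 0≤θ

        0≤e : 0ℚ ≤ e
        0≤e = 0≤+ 0≤Oθ 0≤θ

        e≤u⁶ : e ≤ u ^ 6
        e≤u⁶ = begin
          ι O * θ + θ ≤⟨ +-mono-≤ (θ-scale (u ^ 10) O≤) (θ-scale' (u ^ 10) (1≤u^l {10} (ℕ.m≤m+n 10 10))) ⟩
          u ^ 10 * ε + u ^ 10 * ε ≤⟨ *-mono2 ⟩
          u ^ 10 ≤⟨ u^-anti {6} {10} (ℕ.m≤m+n 6 4) ⟩
          u ^ 6 ∎
          where
          open ≤-Reasoning
          θ-scale' : ∀ b → 1ℚ ≤ b * l → θ ≤ b * ε
          θ-scale' b h = ≤-trans (≤-reflexive (sym (*-identityˡ θ))) (θ-scale b h)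
          dbl : ∀ a b → a * b + a * b ≡ a * (b + b)
          dbl = solve-∀ ring
          *-mono2 : u ^ 10 * ε + u ^ 10 * ε ≤ u ^ 10
          *-mono2 = ≤-trans (≤-reflexive (dbl (u ^ 10) ε)) (≤-trans (*-monoʳ (0≤u^ 10) (≤-trans (+-mono-≤ ε≤c ε≤c) 2c≤1)) (≤-reflexive (*-identityʳ _)))

        -- The errors are of second order, of size about R u^6, while y is at least u^4 because g ≥
        -- u. With Ru ≤ 1/32 there is even a power of u to spare.
        errors-small : ρ * (ε * ε) + ε * ε + (e + e + e) ≤ ¼ * y
        errors-small = begin
          ρ * (ε * ε) + ε * ε + (e + e + e) ≤⟨ +-monoʳ-≤ (ρ * (ε * ε) + ε * ε) (+-mono-≤ (+-mono-≤ e≤u⁶ e≤u⁶) e≤u⁶) ⟩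
          ρ * (ε * ε) + ε * ε + (u ^ 6 + u ^ 6 + u ^ 6) ≡⟨ alg ρ u ⟩
          (ρ * u + ι 4 * u) * u ^ 5 ≤⟨ *-mono (0≤+ (0≤* 0≤ρ 0≤u) (0≤* (0≤ι 4) 0≤u)) 0≤y (+-mono-≤ Ru≤c (*-monoʳ (0≤ι 4) u≤c)) (≤-trans (u^-anti {4} {5} (ℕ.m≤m+n 4 1)) u⁴≤y) ⟩
          (c + ι 4 * c) * y ≤⟨ *-monoˡ 0≤y (from-yes (c + ι 4 * c ℚ.≤? ¼)) ⟩
          ¼ * y ∎
          where
          open ≤-Reasoning
          alg : ∀ ρ u → ρ * (u ^ 3 * u ^ 3) + u ^ 3 * u ^ 3 + (u ^ 6 + u ^ 6 + u ^ 6) ≡ (ρ * u + ι 4 * u) * u ^ 5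
          alg ρ u = alg' ρ u
            where
            alg' : ∀ ρ u → ρ * ((u * (u * (u * 1ℚ))) * (u * (u * (u * 1ℚ)))) + (u * (u * (u * 1ℚ))) * (u * (u * (u * 1ℚ)))
               + (u * (u * (u * (u * (u * (u * 1ℚ))))) + u * (u * (u * (u * (u * (u * 1ℚ))))) + u * (u * (u * (u * (u * (u * 1ℚ)))))) ≡ (ρ * u + ι 4 * u) * (u * (u * (u * (u * (u * 1ℚ)))))
            alg' = solve-∀ ring

        H₁ : ∀ n → ι n ≤ ρ * d → σ ≤ (1ℚ - θ) ^ n
        H₁ n h = ≤-trans (1-anti ((≤-trans (θ-scale (ρ * γ) (≤-trans h (≤-reflexive (sym (*-assoc ρ γ l))))) (≤-reflexive (alg ρ γ ε))))) (bernoulli⁻ θ n θ≤1)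
          where
          alg : ∀ a b c → a * b * c ≡ a * (c * b)
          alg = solve-∀ ring

        A : ℚ
        A = 1ℚ - λ' - e

        0<A : 0ℚ < A
        0<A = <-≤-trans (from-yes (0ℚ ℚ.<? 1ℚ - c - c)) (+-mono-≤ (1-anti ((≤-trans λ≤ε ε≤c))) (ℚ.neg-antimono-≤ (≤-trans e≤u⁶ (u^≤c 5))))

        private
          A⁻¹ = inverse 0<A

        -- `A` is a Bernoulli lower bound for (1-θ)^(d+O), so σ/A dominates σ t^(d+O). `T` is a
        -- lower bound for 1 + nθσ when n + 1 ≥ l. `Q` keeps half of the gain y.
        Qc Q T : ℚ
        Qc = σ * proj₁ A⁻¹
        Q  = σ * (1ℚ - ½ * y)
        T  = 1ℚ + ε - ε * (ρ * λ') - e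

        0≤Qc : 0ℚ ≤ Qc
        0≤Qc = 0≤* 0≤σ (<⇒≤ (proj₁ (proj₂ A⁻¹)))

        y≤1 : y ≤ 1ℚ
        y≤1 = ≤-trans (*-mono 0≤ε 0≤1 (≤-trans ε≤c c≤1) g≤1) (≤-reflexive (*-identityˡ 1ℚ))

        0≤Q : 0ℚ ≤ Q
        0≤Q = 0≤* 0≤σ (≤-trans (from-yes (0ℚ ℚ.≤? 1ℚ - ½ * 1ℚ)) (1-anti ((*-monoʳ 0≤½ y≤1))))

        H₂ : ∀ n → ι n ≤ d → σ * t ^ (n ℕ.+ O) ≤ Qc
        H₂ n h = begin
          σ * t ^ m ≡⟨ cong (_* t ^ m) (trans (sym (*-identityʳ σ)) (cong (σ *_) (sym (proj₂ (proj₂ A⁻¹))))) ⟩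
          σ * (proj₁ A⁻¹ * A) * t ^ m ≡⟨ alg σ (proj₁ A⁻¹) A (t ^ m) ⟩
          Qc * (t ^ m * A) ≤⟨ *-monoʳ 0≤Qc (*-monoʳ (0≤^ m 0≤t) (≤-trans A≤ (bernoulli⁻ θ m θ≤1))) ⟩
          Qc * (t ^ m * (1ℚ - θ) ^ m) ≡⟨ cong (Qc *_) (trans (sym (*-^ t (1ℚ - θ) m)) (trans (cong (_^ m) tτ≡1) (1^ m))) ⟩
          Qc * 1ℚ ≡⟨ *-identityʳ Qc ⟩
          Qc ∎
          where
          open ≤-Reasoning
          m = n ℕ.+ O
          alg : ∀ a b c d → a * (b * c) * d ≡ a * b * (d * c)
          alg = solve-∀ ring
          mθ≤ : ι m * θ ≤ λ' + e
          mθ≤ = begin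
            ι m * θ ≡⟨ trans (cong (_* θ) (ι-+ n O)) (*-distribʳ-+ θ (ι n) (ι O)) ⟩
            ι n * θ + ι O * θ ≤⟨ +-mono-≤ (≤-trans (θ-scale γ h) (≤-reflexive (*-comm γ ε))) (a≤a+b 0≤θ) ⟩
            λ' + e ∎
          A≤ : A ≤ 1ℚ - ι m * θ
          A≤ = ≤-trans (≤-reflexive (alg2 λ' e)) (1-anti (mθ≤))
            where
            alg2 : ∀ a b → 1ℚ - a - b ≡ 1ℚ - (a + b)
            alg2 = solve-∀ ring

        -- `decay` trades the overestimate 1/A for T, giving Qc ≤ Q T. Then `^-decay` cancels T
        -- against the chance that none of the n other colours is assigned.
        H₃ : ∀ n → l ≤ ι (suc n) → Qc * (1ℚ - θ * σ) ^ n ≤ Q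
        H₃ n h = begin
          Qc * (1ℚ - x) ^ n ≤⟨ *-monoˡ 0≤pow Qc≤QT ⟩
          Q * T * (1ℚ - x) ^ n ≡⟨ *-assoc Q T _ ⟩
          Q * (T * (1ℚ - x) ^ n) ≤⟨ *-monoʳ 0≤Q (≤-trans (*-monoˡ 0≤pow T≤) (^-decay x n (0≤* 0≤θ 0≤σ) x≤1)) ⟩
          Q * 1ℚ ≡⟨ *-identityʳ Q ⟩
          Q ∎
          where
          open ≤-Reasoning
          x = θ * σ
          x≤1 : x ≤ 1ℚ
          x≤1 = ≤-trans (*-mono 0≤θ 0≤1 θ≤1 σ≤1) (≤-reflexive (*-identityˡ 1ℚ))
          0≤pow : 0ℚ ≤ (1ℚ - x) ^ n
          0≤pow = 0≤^ n (diff x≤1)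
          Qc≤QT : Qc ≤ Q * T
          Qc≤QT = begin
            Qc ≡⟨ sym (*-identityʳ Qc) ⟩
            Qc * 1ℚ ≤⟨ *-monoʳ 0≤Qc (decay 0≤ε (≤-trans ε≤c c≤½) 0≤g g≤1 0≤ρ 0≤e errors-small) ⟩
            Qc * ((1ℚ - ½ * y) * (A * T)) ≡⟨ alg σ (proj₁ A⁻¹) (1ℚ - ½ * y) A T ⟩
            proj₁ A⁻¹ * A * (Q * T) ≡⟨ trans (cong (_* (Q * T)) (proj₂ (proj₂ A⁻¹))) (*-identityˡ _) ⟩
            Q * T ∎
            where
            alg : ∀ s i p a t → s * i * (p * (a * t)) ≡ i * a * (s * p * t)
            alg = solve-∀ ring
          T≤ : T ≤ 1ℚ + ι n * x
          T≤ = begin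
            T ≤⟨ ≤-by (e - θ * σ) (diff (≤-trans (≤-trans (*-monoʳ 0≤θ σ≤1) (≤-reflexive (*-identityʳ θ))) (≤-trans (≤-reflexive (sym (+-identityˡ θ))) (+-monoˡ-≤ θ 0≤Oθ)))) (alg ε r e θ) ⟩
            1ℚ + (ε * σ - θ * σ) ≡⟨ cong (λ a → 1ℚ + (a * σ - θ * σ)) (sym θl≡ε) ⟩
            1ℚ + (θ * l * σ - θ * σ) ≤⟨ +-monoʳ-≤ 1ℚ (+-monoˡ-≤ (- (θ * σ)) (*-monoˡ 0≤σ (*-monoʳ 0≤θ h))) ⟩
            1ℚ + (θ * ι (suc n) * σ - θ * σ) ≡⟨ alg2 θ (ι n) σ ⟩
            1ℚ + ι n * x ∎
            where
            alg : ∀ ε r e θ → 1ℚ + (ε * (1ℚ - r) - θ * (1ℚ - r)) - (1ℚ + ε - ε * r - e) ≡ e - θ * (1ℚ - r)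
            alg = solve-∀ ring
            alg2 : ∀ a n s → 1ℚ + (a * (1ℚ + n) * s - a * s) ≡ 1ℚ + n * (a * s)
            alg2 = solve-∀ ring

        -- `g'` is chosen so that 1 - g' = (1-g)(1-¼y): loads shrink by this second factor in
        -- addition to the shrinking of the lists.
        l' g' : ℚ
        l' = l * (σ - z)
        g' = g * (1ℚ + ¼ * λ')

        H₅ : ∀ k → l ≤ ι k → l' ≤ ι k - (1ℚ + z) * (ι k * (1ℚ - σ) + ι K)
        H₅ k h = ≤-trans (lists-shrink 0≤z z≤1 0≤r r≤½ 0≤l h 4K≤lz (0≤ι K)) (≤-reflexive (cong (λ a → ι k - (1ℚ + z) * (ι k * a + ι K)) (alg r)))
          where
          alg : ∀ r → r ≡ 1ℚ - (1ℚ - r)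
          alg = solve-∀ ring

        module _ (u³≤γ : u ^ 3 ≤ γ) where

          -- The moment error, at most u^11 l, has to be below z d = u^7 d. This is guaranteed while
          -- d is at least u^3 l, whence the stopping rule of `run`.
          H₆ : (1ℚ + z) * (d * Q + ι (K ℕ.* (1 ℕ.+ R ℕ.* κ))) ≤ (1ℚ - g') * l'
          H₆ = ≤-trans (loads-shrink 0≤z z≤1 0≤y ½≤σ σ≤1 4z≤⅛y 0≤d B≤zd) (≤-reflexive (alg ε g l (σ - z)))
            where
            alg : ∀ ε g l s → (1ℚ - ¼ * (ε * g)) * ((1ℚ - g) * l * s) ≡ (1ℚ - g * (1ℚ + ¼ * (ε * (1ℚ - g)))) * (l * s)
            alg = solve-∀ ring
            B≤zd : ι (K ℕ.* (1 ℕ.+ R ℕ.* κ)) ≤ z * d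
            B≤zd = begin
              ι (K ℕ.* (1 ℕ.+ R ℕ.* κ)) ≤⟨ B≤ ⟩
              u ^ 11 * l ≤⟨ *-monoˡ 0≤l (u^-anti {10} {11} (ℕ.m≤m+n 10 1)) ⟩
              u ^ 10 * l ≡⟨ cong (_* l) (^-+ u 7 3) ⟩
              u ^ 7 * u ^ 3 * l ≡⟨ *-assoc z (u ^ 3) l ⟩
              u ^ 7 * (u ^ 3 * l) ≤⟨ *-monoʳ 0≤z (*-monoˡ 0≤l u³≤γ) ⟩
              z * (γ * l) ∎
              where open ≤-Reasoning

          advance-round : ∀ {st} → Good G l d Lmax st → ∃ λ st' → Good G l' ((1ℚ - g') * l') Lmax st' × (Colorable st' → Colorable st)
          advance-round {st} good = Step.Advance.advance G st good θ σ t 0≤θ θ≤1 0≤t tτ≡1 0≤σ 0≤d H₁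
            K 1≤K Qc Q 0≤Qc 0≤Q H₂ H₃ (1ℚ + z) w (<-≤-trans 0<1 (a≤a+b 0≤z)) 0≤w 1≤w[1+z]ᴷ 1≤Δ
            (Δ-bound (0≤+ 0≤1 (0≤* 0≤ρ (0≤ι Lmax))) ≤-refl) l' ((1ℚ - g') * l') H₅ H₆

          u⁶≤λ : u ^ 6 ≤ λ'
          u⁶≤λ = ≤-trans (≤-reflexive (^-+ u 3 3)) (*-monoʳ 0≤ε u³≤γ)

          z≤r : z ≤ r
          z≤r = ≤-trans (u^-anti {6} {7} (ℕ.m≤m+n 6 1)) (≤-trans u⁶≤λ (≤-trans (≤-reflexive (sym (*-identityˡ λ'))) (*-monoˡ 0≤λ 1≤ρ)))

          0≤l' : 0ℚ ≤ l'
          0≤l' = 0≤* 0≤l (≤-trans (from-yes (0ℚ ℚ.≤? ½ - ½)) (+-mono-≤ ½≤σ (ℚ.neg-antimono-≤ (≤-trans z≤r r≤½))))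

          -- From g ≥ u, ¼ ≥ u and λ' ≥ u^6. This additive progress is crude, but it only has to
          -- prove termination; no estimate involves the number of rounds.
          u⁸≤g'-g : g + u ^ 8 ≤ g'
          u⁸≤g'-g = begin
            g + u ^ 8 ≡⟨ cong (λ a → g + u * (u * a)) (sym (*-identityˡ (u ^ 6))) ⟩
            g + u * (u * (1ℚ * u ^ 6)) ≤⟨ +-monoʳ-≤ g (*-mono 0≤u 0≤¼λ' u≤g (≤-trans (≤-reflexive (cong (u *_) (*-identityˡ (u ^ 6)))) (*-mono 0≤u 0≤λ (≤-trans u≤c (from-yes (c ℚ.≤? ¼))) u⁶≤λ))) ⟩
            g + g * (¼ * λ') ≡⟨ alg g (¼ * λ') ⟩
            g' ∎
            where
            open ≤-Reasoning
            0≤¼λ' = 0≤* 0≤¼ 0≤λ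
            alg : ∀ a b → a + a * b ≡ a * (1ℚ + b)
            alg = solve-∀ ring

          g'≤1 : g' ≤ 1ℚ
          g'≤1 = ≤-by (γ * (1ℚ - ¼ * y)) (0≤* 0≤γ (≤-trans (from-yes (0ℚ ℚ.≤? 1ℚ - ¼ * 1ℚ)) (1-anti ((*-monoʳ 0≤¼ y≤1))))) (alg ε g)
            where
            alg : ∀ ε g → 1ℚ - g * (1ℚ + ¼ * (ε * (1ℚ - g))) ≡ (1ℚ - g) * (1ℚ - ¼ * (ε * g))
            alg = solve-∀ ring

          invariant : l * g ^ (16 ℕ.* R) ≤ l' * g' ^ (16 ℕ.* R)
          invariant = begin
            l * g ^ E ≡⟨ *-identityʳ _ ⟨
            l * g ^ E * 1ℚ ≤⟨ *-monoʳ 0≤lgE (potential R 0≤λ (≤-trans (*-monoʳ (0≤+ 0≤1 0≤1) r≤c) (from-yes ((1ℚ + 1ℚ) * c ℚ.≤? ½)))) ⟩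
            l * g ^ E * ((1ℚ - (r + r)) * (1ℚ + ¼ * λ') ^ E) ≤⟨ *-monoʳ 0≤lgE (*-monoˡ (0≤^ E (0≤+ 0≤1 (0≤* 0≤¼ 0≤λ))) (≤-by {1ℚ - (r + r)} {σ - z} (r - z) (diff z≤r) (alg r z))) ⟩
            l * g ^ E * ((σ - z) * (1ℚ + ¼ * λ') ^ E) ≡⟨ alg2 l (g ^ E) (σ - z) ((1ℚ + ¼ * λ') ^ E) ⟩
            l * (σ - z) * (g ^ E * (1ℚ + ¼ * λ') ^ E) ≡⟨ cong (l' *_) (*-^ g _ E) ⟨
            l' * g' ^ E ∎
            where
            open ≤-Reasoning
            E = 16 ℕ.* R
            0≤lgE : 0ℚ ≤ l * g ^ E
            0≤lgE = 0≤* 0≤l (0≤^ E 0≤g)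
            alg : ∀ r z → 1ℚ - r - z - (1ℚ - (r + r)) ≡ r - z
            alg = solve-∀ ring
            alg2 : ∀ a b c d → a * b * (c * d) ≡ a * c * (b * d)
            alg2 = solve-∀ ring

      -- Now d is so small that activation can be bold: θ = 1/j with j near u^2 l. A colour at an
      -- edge meets at most Rd/j ≤ ½ expected activations, so σ = ½ is available and 2j colours all
      -- fail with probability at most ½. A list contains S blocks of 2j colours because 2S u^2 l =
      -- 2ul ≤ l.
      module Last {d : ℚ} (0≤d : 0ℚ ≤ d) (d≤ : d ≤ u ^ 3 * l) {st : State} (good : Good G l d Lmax st) where
        open State st
        open Good good

        q : ℚ
        q = u ^ 2 * l

        0≤q : 0ℚ ≤ q
        0≤q = 0≤* (0≤u^ 2) 0≤l

        1≤cq : 1ℚ ≤ c * q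
        1≤cq = ≤-trans (1≤u^l {3} (ℕ.m≤m+n 3 17)) (≤-trans (≤-reflexive (*-assoc u (u ^ 2) l)) (*-monoˡ 0≤q u≤c))

        last-round-from : ∀ {j} → ι j ≤ q → q ≤ ι (suc j) → Colorable st
        last-round-from {j} j≤q q≤1+j = Step.Finish.finish G st good θ ½ t 0≤θ θ≤1 0≤t (proj₂ (proj₂ τ⁻¹)) 0≤½ 0≤d H₁
          w 0≤w H 1≤Δ (≤-trans (≤-reflexive (cong (λ a → ι Δ₄ * (a + a)) (sym (*-identityˡ w)))) (Δ-bound 0≤1 (a≤a+b (0≤* 0≤ρ (0≤ι Lmax)))))
          where
          q≤2j : q ≤ ι j + ι j
          q≤2j = ≤-by (((1ℚ + ι j) - q + ((1ℚ + ι j) - q)) + ((c * q - 1ℚ) + (c * q - 1ℚ)) + (1ℚ - (c + c)) * q)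
            (0≤+ (0≤+ (0≤+ (diff q≤1+j) (diff q≤1+j)) (0≤+ (diff 1≤cq) (diff 1≤cq))) (0≤* (from-yes (0ℚ ℚ.≤? 1ℚ - (c + c))) 0≤q)) (alg (ι j) q)
            where
            alg : ∀ j q → j + j - q ≡ ((1ℚ + j) - q + ((1ℚ + j) - q)) + ((c * q - 1ℚ) + (c * q - 1ℚ)) + (1ℚ - (c + c)) * q
            alg = solve-∀ ring
          1≤½j : 1ℚ ≤ ½ * ι j
          1≤½j = ≤-trans 1≤cq (≤-trans (*-monoʳ 0≤c q≤2j) (≤-trans (≤-reflexive (alg (ι j))) (*-monoˡ (0≤ι j) (from-yes (c + c ℚ.≤? ½)))))
            where
            alg : ∀ j → c * (j + j) ≡ (c + c) * j
            alg = solve-∀ ring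
          0<j : 0ℚ < ι j
          0<j = <-≤-trans 0<1 (≤-trans 1≤½j (≤-trans (*-monoˡ (0≤ι j) ½≤1) (≤-reflexive (*-identityˡ _))))
          j⁻¹ = inverse 0<j
          θ : ℚ
          θ = proj₁ j⁻¹
          0≤θ : 0ℚ ≤ θ
          0≤θ = <⇒≤ (proj₁ (proj₂ j⁻¹))
          θj≡1 : θ * ι j ≡ 1ℚ
          θj≡1 = proj₂ (proj₂ j⁻¹)
          θ≤½ : θ ≤ ½
          θ≤½ = ≤-trans (≤-reflexive (sym (*-identityʳ θ))) (≤-trans (*-monoʳ 0≤θ 1≤½j) (≤-reflexive (trans (alg θ (ι j)) (trans (cong (½ *_) θj≡1) (*-identityʳ ½)))))
            where
            alg : ∀ a b → a * (½ * b) ≡ ½ * (a * b)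
            alg = solve-∀ ring
          θ≤1 : θ ≤ 1ℚ
          θ≤1 = ≤-trans θ≤½ ½≤1
          τ⁻¹ = inverse {1ℚ - θ} (<-≤-trans (from-yes (0ℚ ℚ.<? 1ℚ - ½)) (1-anti (θ≤½)))
          t : ℚ
          t = proj₁ τ⁻¹
          0≤t : 0ℚ ≤ t
          0≤t = <⇒≤ (proj₁ (proj₂ τ⁻¹))
          H₁ : ∀ n → ι n ≤ ρ * d → ½ ≤ (1ℚ - θ) ^ n
          H₁ n h = ≤-trans (1-anti nθ≤½) (bernoulli⁻ θ n θ≤1)
            where
            open ≤-Reasoning
            alg : ∀ p u a l θ → p * (u * a * l) * θ ≡ p * u * ((a * l) * θ)
            alg = solve-∀ ring
            nθ≤½ : ι n * θ ≤ ½
            nθ≤½ = begin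
              ι n * θ ≤⟨ *-monoˡ 0≤θ (≤-trans h (*-monoʳ 0≤ρ d≤)) ⟩
              ρ * (u ^ 3 * l) * θ ≡⟨ alg ρ u (u ^ 2) l θ ⟩
              ρ * u * (q * θ) ≤⟨ *-mono (0≤* 0≤ρ 0≤u) (0≤+ 0≤1 0≤1) Ru≤c (≤-trans (*-monoˡ 0≤θ q≤2j) (≤-reflexive (trans (*-distribʳ-+ θ (ι j) (ι j)) (cong (λ a → a + a) (trans (*-comm (ι j) θ) θj≡1))))) ⟩
              c * (1ℚ + 1ℚ) ≤⟨ from-yes (c * (1ℚ + 1ℚ) ℚ.≤? ½) ⟩
              ½ ∎
          x : ℚ
          x = θ * ½
          0≤x : 0ℚ ≤ x
          0≤x = 0≤* 0≤θ 0≤½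
          x≤1 : x ≤ 1ℚ
          x≤1 = ≤-trans (*-mono 0≤θ 0≤1 θ≤1 ½≤1) (≤-reflexive (*-identityˡ 1ℚ))
          H : ∀ n → l ≤ ι n → (1ℚ - x) ^ n ≤ w
          H n h = begin
            (1ℚ - x) ^ n ≤⟨ ^-anti (diff x≤1) (1-≤1 0≤x) enough ⟩
            (1ℚ - x) ^ (S ℕ.* (2 ℕ.* j)) ≡⟨ ^-* (1ℚ - x) S (2 ℕ.* j) ⟩
            ((1ℚ - x) ^ (2 ℕ.* j)) ^ S ≤⟨ ^-mono S (0≤^ (2 ℕ.* j) (diff x≤1)) half ⟩
            w ∎
            where
            open ≤-Reasoning
            half : (1ℚ - x) ^ (2 ℕ.* j) ≤ ½
            half = ≤-trans (≤-reflexive (alg2 ((1ℚ - x) ^ (2 ℕ.* j)))) (≤-trans (*-monoʳ 0≤½ (≤-trans (≤-reflexive (cong (λ a → (1ℚ + a) * (1ℚ - x) ^ (2 ℕ.* j)) (sym 2jx≡1))) (^-decay x (2 ℕ.* j) 0≤x x≤1))) (≤-reflexive (*-identityʳ ½)))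
              where
              alg2 : ∀ p → p ≡ ½ * ((1ℚ + 1ℚ) * p)
              alg2 = solve-∀ ring
              alg3 : ∀ j θ → (1ℚ + (1ℚ + 0ℚ)) * j * (θ * ½) ≡ θ * j
              alg3 = solve-∀ ring
              2jx≡1 : ι (2 ℕ.* j) * x ≡ 1ℚ
              2jx≡1 = trans (cong (_* x) (ι-* 2 j)) (trans (alg3 (ι j) θ) θj≡1)
            enough : S ℕ.* (2 ℕ.* j) ℕ.≤ n
            enough = ι-cancel (begin
              ι (S ℕ.* (2 ℕ.* j)) ≡⟨ trans (ι-* S (2 ℕ.* j)) (cong (ι S *_) (ι-* 2 j)) ⟩
              ι S * (ι 2 * ι j) ≤⟨ *-monoʳ (0≤ι S) (*-monoʳ (0≤ι 2) j≤q) ⟩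
              ι S * (ι 2 * (u ^ 2 * l)) ≡⟨ trans (alg4 (ι S) (ι 2) u l) (trans (cong (_* (ι 2 * u * l)) uS≡1) (*-identityˡ _)) ⟩
              ι 2 * u * l ≤⟨ *-monoˡ 0≤l (≤-trans (*-monoʳ (0≤ι 2) u≤c) (from-yes (ι 2 * c ℚ.≤? 1ℚ))) ⟩
              1ℚ * l ≡⟨ *-identityˡ l ⟩
              l ≤⟨ h ⟩
              ι n ∎)
              where
              alg4 : ∀ s a u l → s * (a * (u * (u * 1ℚ) * l)) ≡ u * s * (a * u * l)
              alg4 = solve-∀ ring

        last-round : Colorable st
        last-round = by-cases (any U js) refl
          where
          by-cases : ∀ b → any U js ≡ b → Colorable st
          -- The list of an uncoloured edge supplies the integer above `q` from which the search for
          -- j starts.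
          by-cases true e =
            let j , _ , Uj = any-true U js e
                i , lo , hi = ι-floor (cnt cs (a j)) 0≤q (≤-trans (≤-trans (*-monoˡ 0≤l (^≤1 2 0≤u u≤1)) (≤-reflexive (*-identityˡ l))) (lists j Uj))
            in last-round-from {i} lo hi
          by-cases false e = (λ _ → c₀) , (λ j Uj → true≢false Uj (any-false U e (js-complete j))) , (λ j _ Uj → true≢false Uj (any-false U e (js-complete j)))

    -- As g ≤ 1, the potential keeps l at or above `ℓ`, so a single bound on κ in terms of `ℓ`
    -- serves all rounds. The number `n` is fuel: each round brings g closer to 1 by at least u^8.
    run : ∀ {ℓ} → ι κ ≤ u ^ 20 * ℓ → ∀ n {l g st} → 0ℚ ≤ l → ℓ ≤ l * g ^ (16 ℕ.* R) → u ≤ g → g ≤ 1ℚ → 1ℚ - g ≤ ι n * u ^ 8 →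
          Good G l ((1ℚ - g) * l) Lmax st → Colorable st
    run {ℓ} κ≤ n {l} {g} {st} l≥0 inv u≤g g≤1 fuel good with ℚ.≤-total (1ℚ - g) (u ^ 3)
    ... | inj₁ γ≤u³ = Last.last-round (At.0≤d u≤g g≤1) (*-monoˡ l≥0 γ≤u³) good
      where
      open Round κ≤ (≤-trans inv (≤-trans (*-monoʳ l≥0 (^≤1 (16 ℕ.* R) (≤-trans 0≤u u≤g) g≤1)) (≤-reflexive (*-identityʳ l))))
    ... | inj₂ u³≤γ = continue n fuel
      where
      open Round κ≤ (≤-trans inv (≤-trans (*-monoʳ l≥0 (^≤1 (16 ℕ.* R) (≤-trans 0≤u u≤g) g≤1)) (≤-reflexive (*-identityʳ l))))
      open At u≤g g≤1
      continue : ∀ n → 1ℚ - g ≤ ι n * u ^ 8 → Colorable st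
      continue zero    h = ⊥-elim (ℚ.<-irrefl refl (<-≤-trans (0<^ 3 0<u) (≤-trans u³≤γ (≤-trans h (≤-reflexive (*-zeroˡ (u ^ 8)))))))
      continue (suc m) h =
        let st' , good' , back = advance-round u³≤γ good
        in back (run κ≤ m (0≤l' u³≤γ) (≤-trans inv (invariant u³≤γ))
             (≤-trans u≤g (≤-trans (a≤a+b (0≤u^ 8)) (u⁸≤g'-g u³≤γ)))
             (g'≤1 u³≤γ) fuel' good')
        where
        fuel' : 1ℚ - g' ≤ ι m * u ^ 8
        fuel' = ≤-trans (1-anti ((u⁸≤g'-g u³≤γ)))
          (from-diff (subst (0ℚ ≤_) (alg g (u ^ 8) (ι m)) (diff h)))
          where
          alg : ∀ g a m → (1ℚ + m) * a - (1ℚ - g) ≡ m * a - (1ℚ - (g + a))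
          alg = solve-∀ ring

-- Integer roots and growth estimates for the choice of scale

module Powers where

  open import Data.Nat
  open import Data.Nat.DivMod using (_/_; _%_; m≡m%n+[m/n]*n; m%n<n; /-monoˡ-≤; m*n/n≡m; m/n*n≤m)
  open import Data.Nat.Properties

  ^-distribʳ-* : ∀ m n k → (m * n) ^ k ≡ m ^ k * n ^ k
  ^-distribʳ-* m n zero    = refl
  ^-distribʳ-* m n (suc k) = trans (cong (m * n *_) (^-distribʳ-* m n k)) ([m*n]*[o*p]≡[m*o]*[n*p] m n (m ^ k) (n ^ k))

  ^-cancelˡ-≤ : ∀ {m n} k → 0 < k → m ^ k ≤ n ^ k → m ≤ n
  ^-cancelˡ-≤ {m} {n} k 0<k h with m ≤? n
  ... | yes m≤n = m≤n
  ... | no  m≰n = ⊥-elim (<⇒≱ (^-monoˡ-< k {{>-nonZero 0<k}} (≰⇒> m≰n)) h)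

  n<2^n : ∀ n → n < 2 ^ n
  n<2^n zero    = s≤s z≤n
  n<2^n (suc n) = begin-strict
    suc n <⟨ s≤s (n<2^n n) ⟩
    1 + 2 ^ n ≤⟨ +-monoˡ-≤ (2 ^ n) (m^n>0 2 n) ⟩
    2 ^ n + 2 ^ n ≡⟨ cong (2 ^ n +_) (sym (+-identityʳ (2 ^ n))) ⟩
    2 ^ suc n ∎
    where open ≤-Reasoning

  -- With n = 2Mt + (n mod 2M), both t + 1 and 2M are at most 2 ^ t.
  power≤exponential : ∀ M → 0 < M → ∀ n → 2 * M * (2 * M) ≤ n → n ^ M ≤ 2 ^ n
  power≤exponential M 0<M n big = begin
    n ^ M ≤⟨ ^-monoˡ-≤ M n≤ ⟩
    (2 ^ t * 2 ^ t) ^ M ≡⟨ cong (_^ M) (^-distribˡ-+-* 2 t t) ⟨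
    (2 ^ (t + t)) ^ M ≡⟨ ^-*-assoc 2 (t + t) M ⟩
    2 ^ ((t + t) * M) ≤⟨ ^-monoʳ-≤ 2 t≤ ⟩
    2 ^ n ∎
    where
    open ≤-Reasoning
    instance
      2M≢0 : NonZero (2 * M)
      2M≢0 = >-nonZero (*-mono-≤ (s≤s (z≤n {1})) 0<M)
    t = n / (2 * M)
    split : n ≡ n % (2 * M) + t * (2 * M)
    split = m≡m%n+[m/n]*n n (2 * M)
    2M≤t : 2 * M ≤ t
    2M≤t = ≤-trans (≤-reflexive (sym (m*n/n≡m (2 * M) (2 * M)))) (/-monoˡ-≤ (2 * M) big)
    t≤ : (t + t) * M ≤ n
    t≤ = begin
      (t + t) * M ≡⟨ cong (λ x → (t + x) * M) (sym (+-identityʳ t)) ⟩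
      2 * t * M ≡⟨ cong (_* M) (*-comm 2 t) ⟩
      t * 2 * M ≡⟨ *-assoc t 2 M ⟩
      t * (2 * M) ≤⟨ m/n*n≤m n (2 * M) ⟩
      n ∎
    n≤ : n ≤ 2 ^ t * 2 ^ t
    n≤ = begin
      n ≡⟨ split ⟩
      n % (2 * M) + t * (2 * M) ≤⟨ +-monoˡ-≤ (t * (2 * M)) (<⇒≤ (m%n<n n (2 * M))) ⟩
      suc t * (2 * M) ≤⟨ *-mono-≤ (n<2^n t) (≤-trans 2M≤t (<⇒≤ (n<2^n t))) ⟩
      2 ^ t * 2 ^ t ∎

  root : ∀ b → 0 < b → ∀ D → 0 < D → ∃ λ s → D ≤ suc s ^ b × s ^ b < D
  root b 0<b (suc zero)      _ = 0 , ≤-reflexive (sym (^-zeroˡ b)) , ≤-reflexive (cong suc (0^ b 0<b))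
    where
    0^ : ∀ b → 0 < b → 0 ^ b ≡ 0
    0^ (suc b) _ = refl
  root b 0<b (suc D@(suc _)) _ with root b 0<b D (s≤s z≤n)
  ... | s , D≤ , <D with suc D ≤? suc s ^ b
  ... | yes h = s , h , m≤n⇒m≤1+n <D
  ... | no ¬h = suc s , ≤-trans (s≤s D≤) (^-monoˡ-< b {{>-nonZero 0<b}} (n<1+n (suc s))) , ≰⇒> ¬h

  root-mono : ∀ b {m n} → m ^ b < n ^ b → m < n
  root-mono b {m} {n} h with n ≤? m
  ... | yes n≤m = ⊥-elim (<⇒≱ h (^-monoˡ-≤ b n≤m))
  ... | no  n≰m = ≰⇒> n≰m

  quotient-bound : ∀ {c P D} .{{_ : NonZero P}} → c * P ≤ D → c ≤ D / P
  quotient-bound {c} {P} h = ≤-trans (≤-reflexive (sym (m*n/n≡m c P))) (/-monoˡ-≤ P h)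

  -- The budget for `polynomial≤exponential` with e = 1 + b: four factors RD ≤ S^e on each side of
  -- no subtraction, namely 4e in total, then 1 + 2RD ≤ S^(1+e), and one power for the leading 4 ≤
  -- S.
  Δ-exponent : ℕ → ℕ
  Δ-exponent e = 1 + (((e + e) + (e + e)) + (1 + e))

  polynomial≤exponential : ∀ {R D S b} → suc R ≤ S → 4 ≤ S → D ≤ S ^ b → 2 * Δ-exponent (1 + b) * (2 * Δ-exponent (1 + b)) ≤ S →
    4 * (((R * D * (R * D)) * (R * D * (R * D))) * (1 + R * (2 * D))) ≤ 2 ^ S
  polynomial≤exponential {R} {D} {S} {b} R<S 4≤S D≤S^b big = begin
    4 * (((R * D * (R * D)) * (R * D * (R * D))) * (1 + R * (2 * D)))
      ≤⟨ *-mono-≤ 4≤S (*-mono-≤ (*-mono-≤ (*-mono-≤ RD≤ RD≤) (*-mono-≤ RD≤ RD≤)) last≤) ⟩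
    S * ((X * X * (X * X)) * (S * X))
      ≡⟨ cong (S *_) (trans (cong (_* (S * X)) (trans (cong₂ _*_ dbl dbl) (sym (^-distribˡ-+-* S (e + e) (e + e))))) (sym (^-distribˡ-+-* S (e + e + (e + e)) (1 + e)))) ⟩
    S ^ Δ-exponent e
      ≤⟨ power≤exponential (Δ-exponent e) (s≤s z≤n) S big ⟩
    2 ^ S ∎
    where
    open ≤-Reasoning
    e X : ℕ
    e = 1 + b
    X = S ^ e
    dbl : X * X ≡ S ^ (e + e)
    dbl = sym (^-distribˡ-+-* S e e)
    RD≤ : R * D ≤ X
    RD≤ = *-mono-≤ (≤-trans (n≤1+n R) R<S) D≤S^b
    last≤ : 1 + R * (2 * D) ≤ S * X
    last≤ = ≤-trans (+-mono-≤ (m^n>0 S {{>-nonZero (≤-trans (s≤s z≤n) 4≤S)}} e) (*-monoʳ-≤ R (*-mono-≤ (≤-trans (m≤m+n 2 2) 4≤S) D≤S^b))) (*-monoˡ-≤ X R<S)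

  double≤square : ∀ {n} → 4 ≤ n → 2 * suc n ≤ n * n
  double≤square {n} 4≤n = begin
    2 * suc n ≡⟨ *-suc 2 n ⟩
    2 + 2 * n ≤⟨ +-monoˡ-≤ (2 * n) (≤-trans (m≤m+n 2 6) (*-monoʳ-≤ 2 4≤n)) ⟩
    2 * n + 2 * n ≡⟨ *-distribʳ-+ n 2 2 ⟨
    4 * n ≤⟨ *-monoˡ-≤ n 4≤n ⟩
    n * n ∎
    where open ≤-Reasoning

  -- s is D^(1/b) rounded up.
  record Scale (R B q b D : ℕ) : Set where
    field
      s S      : ℕ
      0<D      : 0 < D
      2s≡S     : 2 * s ≡ S
      32R≤S    : 32 * R ≤ S
      D≤s^b    : D ≤ s ^ b
      S^Bq≤D   : (S ^ B) ^ q ≤ D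
      Δ-small  : 4 * (((R * D * (R * D)) * (R * D * (R * D))) * (1 + R * (2 * D))) ≤ 2 ^ S

  scale : ∀ R B q → 0 < R → 0 < B → 0 < q → ∃ λ b → 0 < b × ∃ λ D₀ → ∀ D → D₀ ≤ D → Scale R B q b D
  scale R B q 0<R 0<B 0<q = b , 0<b , suc (s₀ ^ b) , λ D D₀≤D → build D D₀≤D (root b 0<b D (≤-trans (s≤s z≤n) D₀≤D))
    where
    k b s₀ : ℕ
    -- S = 2(s'+1) is at most s'^2, so S^(Bq) is at most s'^(2Bq), which lies below D for b = 2Bq.
    -- In `s₀` the term 32R secures R/S ≤ 1/32, and the other one is the threshold of
    -- `power≤exponential`.
    k  = B * q
    b  = k + k
    s₀ = 32 * R + 2 * Δ-exponent (1 + b) * (2 * Δ-exponent (1 + b))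
    0<b : 0 < b
    0<b = ≤-trans (*-mono-≤ 0<B 0<q) (m≤m+n k k)
    build : ∀ D → suc (s₀ ^ b) ≤ D → (∃ λ s → D ≤ suc s ^ b × s ^ b < D) → Scale R B q b D
    build D D₀≤D (s' , D≤ , <D) = with-S (2 * suc s') refl
      where
      s₀≤s' : s₀ ≤ s'
      s₀≤s' = s≤s⁻¹ (root-mono b (≤-trans D₀≤D D≤))
      32R≤s' : 32 * R ≤ s'
      32R≤s' = ≤-trans (m≤m+n (32 * R) _) s₀≤s'
      32≤s' : 32 ≤ s'
      32≤s' = ≤-trans (*-monoʳ-≤ 32 {1} {R} 0<R) 32R≤s'
      with-S : ∀ S → 2 * suc s' ≡ S → Scale R B q b D
      with-S S eq = record
        { s = suc s' ; S = S ; 0<D = ≤-trans (s≤s z≤n) D₀≤D ; 2s≡S = eq ; 32R≤S = ≤-trans 32R≤s' s'≤S ; D≤s^b = D≤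
        ; S^Bq≤D = begin
            (S ^ B) ^ q ≡⟨ ^-*-assoc S B q ⟩
            S ^ k ≤⟨ ^-monoˡ-≤ k (≤-trans (≤-reflexive (sym eq)) (double≤square (≤-trans (m≤m+n 4 28) 32≤s'))) ⟩
            (s' * s') ^ k ≡⟨ ^-distribʳ-* s' s' k ⟩
            s' ^ k * s' ^ k ≡⟨ ^-distribˡ-+-* s' k k ⟨
            s' ^ b ≤⟨ <⇒≤ <D ⟩
            D ∎
        ; Δ-small = polynomial≤exponential {R} {D} {S} {b}
            (≤-trans (≤-trans (≤-trans (+-monoˡ-≤ R 0<R) (+-monoʳ-≤ R (m≤m+n R _))) 32R≤s') s'≤S) (≤-trans (m≤m+n 4 28) (≤-trans 32≤s' s'≤S))
            (≤-trans D≤ (^-monoˡ-≤ b s≤S)) (≤-trans (m≤n+m _ (32 * R)) (≤-trans s₀≤s' s'≤S)) }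
        where
        open ≤-Reasoning
        s≤S : suc s' ≤ S
        s≤S = ≤-trans (m≤m+n (suc s') _) (≤-reflexive eq)
        s'≤S : s' ≤ S
        s'≤S = ≤-trans (n≤1+n s') s≤S

-- From disjoint colourings to one colouring of glued copies

module Encoding where

  open import Data.Fin as Fin using (Fin; zero; suc; toℕ; fromℕ<; combine; remQuot)
  open import Data.Fin.Properties as Fin using (remQuot-combine; toℕ-injective; toℕ-fromℕ<)
  open import Data.Fin.Subset as Subset using (Subset; ∣_∣)
  open import Data.Fin.Subset.Properties using (_∈?_)
  open import Data.List using (_++_; map; take; filter; allFin; cartesianProduct; concatMap)
  open import Data.List.Membership.Propositional.Properties using (∈-map⁺; ∈-map⁻; ∈-allFin; ∈-cartesianProduct⁺; ∈-concatMap⁺)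
  open import Data.List.Properties using (length-map; length-tabulate)
  open import Data.List.Relation.Unary.All as All using (All; []; _∷_)
  open import Data.List.Relation.Unary.AllPairs using ([]; _∷_)
  open import Data.List.Relation.Unary.Any as Any using ()
  open import Data.List.Relation.Unary.Unique.Propositional.Properties using (allFin⁺; cartesianProduct⁺)
  open import Data.Nat using (_≤_; _<_; _+_; _*_; z≤n; s≤s)
  open import Data.Nat.Properties using (*-identityʳ; *-identityˡ; *-monoˡ-≤; +-assoc; +-identityʳ; +-mono-≤; +-monoʳ-≤; +-monoˡ-≤; m≤m+n; m≤n+m; ≤-reflexive; ≤-trans; module ≤-Reasoning)
  open import Data.Product.Properties using () renaming (≡-dec to ×-≡-dec)
  open import Data.Sum.Properties using () renaming (≡-dec to ⊎-≡-dec)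
  open import Data.Vec using ([]; _∷_; here; there)
  open import Function using (_⟨_⟩_)
  open import Level using (0ℓ)
  open import Relation.Binary.Definitions using (DecidableEquality)
  open import Relation.Nullary.Decidable using (does; dec-true; _×-dec_)
  open import Relation.Unary using (Pred; Decidable)
  open import Defs
  open Sums
  open Hypergraphs

  private variable
    A B : Set

  cnt-map : (f : A → B) (xs : List A) (p : B → Bool) → cnt (map f xs) p ≡ cnt xs (λ x → p (f x))
  cnt-map f []       p = refl
  cnt-map f (x ∷ xs) p = cong (_ +_) (cnt-map f xs p)

  cnt-++ : (xs ys : List A) (p : A → Bool) → cnt (xs ++ ys) p ≡ cnt xs p + cnt ys p
  cnt-++ []       ys p = refl
  cnt-++ (x ∷ xs) ys p = trans (cong (_ +_) (cnt-++ xs ys p)) (sym (+-assoc _ (cnt xs p) (cnt ys p)))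

  cnt-× : (xs : List A) (ys : List B) (p : A × B → Bool) (q : A → Bool) {k : ℕ} →
          (∀ x → cnt ys (λ y → p (x , y)) ≤ k) → (∀ x y → p (x , y) ≡ true → q x ≡ true) → cnt (cartesianProduct xs ys) p ≤ cnt xs q * k
  cnt-× []       ys p q h g = z≤n
  cnt-× (x ∷ xs) ys p q {k} h g = ≤-trans (≤-reflexive (trans (cnt-++ (map (x ,_) ys) _ p) (cong (_+ _) (cnt-map (x ,_) ys p)))) (row (q x) refl)
    where
    rest = cnt-× xs ys p q h g
    row : ∀ b → q x ≡ b → cnt ys (λ y → p (x , y)) + cnt (cartesianProduct xs ys) p ≤ cnt (x ∷ xs) q * k
    row true  e rewrite e = +-mono-≤ (h x) rest
    row false e rewrite e = ≤-trans (+-monoˡ-≤ _ (≤-trans (cnt-mono ys {q = λ _ → false} λ y r → true≢false (g x y r) e) (≤-reflexive (cnt-false ys)))) rest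

  length-filter : {P : Pred A 0ℓ} (P? : Decidable P) (xs : List A) → length (filter P? xs) ≡ cnt xs (λ x → does (P? x))
  length-filter P? []       = refl
  length-filter P? (x ∷ xs) with does (P? x)
  ... | true  = cong suc (length-filter P? xs)
  ... | false = length-filter P? xs

  elements : ∀ {n} → Subset n → List (Fin n)
  elements []          = []
  elements (true  ∷ p) = zero ∷ map suc (elements p)
  elements (false ∷ p) = map suc (elements p)

  length-elements : ∀ {n} (p : Subset n) → length (elements p) ≡ ∣ p ∣
  length-elements []          = refl
  length-elements (true  ∷ p) = cong suc (trans (length-map suc (elements p)) (length-elements p))
  length-elements (false ∷ p) = trans (length-map suc (elements p)) (length-elements p)

  elements⇒∈ : ∀ {n} (p : Subset n) {v} → v ∈ elements p → v Subset.∈ p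
  elements⇒∈ (true ∷ p)  (here refl) = here
  elements⇒∈ (true ∷ p)  (there i) with ∈-map⁻ suc i
  ... | u , u∈ , refl = there (elements⇒∈ p u∈)
  elements⇒∈ (false ∷ p) i with ∈-map⁻ suc i
  ... | u , u∈ , refl = there (elements⇒∈ p u∈)

  ∈⇒elements : ∀ {n} (p : Subset n) {v} → v Subset.∈ p → v ∈ elements p
  ∈⇒elements (true ∷ p)  here      = here refl
  ∈⇒elements (true ∷ p)  (there i) = there (∈-map⁺ suc (∈⇒elements p i))
  ∈⇒elements (false ∷ p) (there i) = ∈-map⁺ suc (∈⇒elements p i)

  take-⊆ : ∀ k (xs : List A) {x} → x ∈ take k xs → x ∈ xs
  take-⊆ (suc k) (y ∷ ys) (here e)  = here e
  take-⊆ (suc k) (y ∷ ys) (there i) = there (take-⊆ k ys i)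

  length-take≤ : ∀ k (xs : List A) → length (take k xs) ≤ k
  length-take≤ zero    xs       = z≤n
  length-take≤ (suc k) []       = z≤n
  length-take≤ (suc k) (x ∷ xs) = s≤s (length-take≤ k xs)

  length-take≥ : ∀ k (xs : List A) {j} → j ≤ k → j ≤ length xs → j ≤ length (take k xs)
  length-take≥ k       xs       {zero}  _         _         = z≤n
  length-take≥ (suc k) (x ∷ xs) {suc j} (s≤s p) (s≤s q) = s≤s (length-take≥ k xs p q)

  sumList : List ℕ → ℕ
  sumList []       = 0
  sumList (x ∷ xs) = x + sumList xs

  ∈⇒≤sum : ∀ {xs x} → x ∈ xs → x ≤ sumList xs
  ∈⇒≤sum {x ∷ xs} (here refl) = m≤m+n x _
  ∈⇒≤sum {y ∷ xs} (there i)   = ≤-trans (∈⇒≤sum i) (m≤n+m _ y)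

  member : ∀ {N} → List ℕ → Fin N → Bool
  member xs c = any (is ℕ._≟_ (toℕ c)) xs

  cnt-member≥ : ∀ N {xs} → Unique xs → (∀ {x} → x ∈ xs → x < N) → length xs ≤ cnt (allFin N) (member xs)
  cnt-member≥ N []              h = z≤n
  cnt-member≥ N {x ∷ xs} (x∉ ∷ u) h = begin
    suc (length xs) ≤⟨ +-mono-≤ one (cnt-member≥ N u (λ i → h (there i))) ⟩
    cnt cs (λ c → is ℕ._≟_ (toℕ c) x) + cnt cs (member xs) ≤⟨ cnt-∨-∧ cs _ (member xs) ⟩
    cnt cs (member (x ∷ xs)) + cnt cs (λ c → is ℕ._≟_ (toℕ c) x ∧ member xs c)
                                                                       ≤⟨ +-monoʳ-≤ _ (≤-trans (cnt-mono cs {q = λ _ → false} none) (≤-reflexive (cnt-false cs))) ⟩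
    cnt cs (member (x ∷ xs)) + 0 ≡⟨ +-identityʳ _ ⟩
    cnt cs (member (x ∷ xs)) ∎
    where
    open ≤-Reasoning
    cs = allFin N
    x<N = h (here refl)
    one : 1 ≤ cnt cs (λ c → is ℕ._≟_ (toℕ c) x)
    one = cnt-∈ (λ c → is ℕ._≟_ (toℕ c) x) (∈-allFin (fromℕ< x<N)) (subst (λ y → is ℕ._≟_ y x ≡ true) (sym (toℕ-fromℕ< x<N)) (is-refl ℕ._≟_ x))
    none : ∀ c → is ℕ._≟_ (toℕ c) x ∧ member xs c ≡ true → false ≡ true
    none c e = let y , y∈ , q = any-true (is ℕ._≟_ (toℕ c)) xs (∧₂ (is ℕ._≟_ (toℕ c) x) e) in
      ⊥-elim (All.lookup x∉ y∈ (trans (sym (is-true ℕ._≟_ (∧₁ (is ℕ._≟_ (toℕ c) x) e))) (is-true ℕ._≟_ q)))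

  cnt-member≤ : ∀ N xs → cnt (allFin N) (member xs) ≤ length xs
  cnt-member≤ N xs = ≤-trans (cnt-any (allFin N) xs (λ x c → is ℕ._≟_ (toℕ c) x) single) (≤-reflexive (*-identityʳ _))
    where
    single : ∀ x → cnt (allFin N) (λ c → is ℕ._≟_ (toℕ c) x) ≤ 1
    single x with x ℕ.<? N
    ... | yes x<N = ≤-trans (cnt-mono (allFin N) {q = λ c → is Fin._≟_ c (fromℕ< x<N)}
                      λ c e → trans (cong (λ d → is Fin._≟_ d (fromℕ< x<N)) (toℕ-injective (trans (is-true ℕ._≟_ e) (sym (toℕ-fromℕ< x<N))))) (is-refl Fin._≟_ _))
                      (cnt-is≤1 Fin._≟_ (fromℕ< x<N) (allFin⁺ N))
    ... | no x≮N  = ≤-trans (cnt-mono (allFin N) {q = λ _ → false} λ c e → ⊥-elim (x≮N (subst (_< N) (is-true ℕ._≟_ e) (Fin.toℕ<n c))))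
                      (≤-trans (≤-reflexive (cnt-false (allFin N))) z≤n)

  -- Disjoint colorings φ₁,…,φ_D of G are one coloring of the edges (i, e): copy i of e contains copy i of each vertex
  -- of e, and all copies of e share the extra vertex inj₂ e.
  module Copies {n m : ℕ} (G : Hypergraph n m) (r D κ Lmax : ℕ) (L : Fin m → List ℕ)
    (bounded : RBounded r G) (deg : ∀ v → degree G v ≤ D) (codeg : ∀ u v → u ≢ v → codegree G u v ≤ κ) (1≤κ : 1 ≤ κ) where

    J V C : Set
    J = Fin D × Fin m
    V = (Fin n × Fin D) ⊎ Fin m
    -- The colours have to form a finite set; no entry of a list exceeds the sum of all entries.
    N = suc (sumList (concatMap L (allFin m)))
    C = Fin N

    _≟J_ : DecidableEquality J
    _≟J_ = ×-≡-dec Fin._≟_ Fin._≟_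

    _≟V_ : DecidableEquality V
    _≟V_ = ⊎-≡-dec (×-≡-dec Fin._≟_ Fin._≟_) Fin._≟_

    js : List J
    js = cartesianProduct (allFin D) (allFin m)

    vs : J → List V
    vs (i , e) = inj₂ e ∷ map (λ v → inj₁ (v , i)) (elements (edge G e))

    inc : V → J → Bool
    inc v j = any (is _≟V_ v) (vs j)

    inc-copy : ∀ {v i i' e} → inc (inj₁ (v , i)) (i' , e) ≡ true → i' ≡ i × v Subset.∈ edge G e
    inc-copy {v} {i} {i'} {e} q with any-true (is _≟V_ (inj₁ (v , i))) (vs (i' , e)) q
    ... | x , there x∈ , p with ∈-map⁻ (λ v → inj₁ (v , i')) x∈ | is-true _≟V_ p
    ... | u , u∈ , refl | refl = refl , elements⇒∈ (edge G e) u∈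
    inc-copy {v} {i} {i'} {e} q | x , here refl , p with is-true _≟V_ {inj₁ (v , i)} {inj₂ e} p
    ... | ()

    inc-edge : ∀ {e i e'} → inc (inj₂ e) (i , e') ≡ true → e' ≡ e
    inc-edge {e} {i} {e'} q with any-true (is _≟V_ (inj₂ e)) (vs (i , e')) q
    ... | x , here refl , p with is-true _≟V_ p
    ... | refl = refl
    inc-edge {e} {i} {e'} q | x , there x∈ , p with ∈-map⁻ (λ v → inj₁ (v , i)) x∈ | is-true _≟V_ p
    ... | u , u∈ , refl | ()

    is-at : ∀ {k} {x y : Fin k} → x ≡ y → is Fin._≟_ x y ≡ true
    is-at refl = is-refl Fin._≟_ _

    length-allFin : ∀ k → length (allFin k) ≡ k
    length-allFin k = length-tabulate {n = k} (λ i → i)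

    copy-degree : ∀ v → cnt (allFin m) (λ e → does (v ∈? edge G e)) ≤ D
    copy-degree v = ≤-trans (≤-reflexive (sym (length-filter (λ e → v ∈? edge G e) (allFin m)))) (deg v)

    degree≤D : ∀ v → cnt js (inc v) ≤ D
    degree≤D (inj₁ (v , i)) = ≤-trans
      (cnt-× (allFin D) (allFin m) _ (λ i' → is Fin._≟_ i' i)
        (λ i' → ≤-trans (cnt-mono (allFin m) λ e q → dec-true (v ∈? edge G e) (proj₂ (inc-copy {e = e} q))) (copy-degree v))
        (λ i' e q → is-at (proj₁ (inc-copy {e = e} q))))
      (≤-trans (*-monoˡ-≤ D (cnt-is≤1 Fin._≟_ i (allFin⁺ D))) (≤-reflexive (*-identityˡ D)))
    degree≤D (inj₂ e) = ≤-trans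
      (cnt-× (allFin D) (allFin m) _ (λ _ → true)
        (λ i → ≤-trans (cnt-mono (allFin m) λ e' q → is-at (inc-edge {i = i} q)) (cnt-is≤1 Fin._≟_ e (allFin⁺ m)))
        (λ _ _ _ → refl))
      (≤-trans (≤-reflexive (*-identityʳ _)) (≤-trans (cnt≤length (allFin D) _) (≤-reflexive (length-allFin D))))

    one-copy : ∀ (p : J → Bool) i {k} → (∀ i' → cnt (allFin m) (λ e → p (i' , e)) ≤ k) → (∀ i' e → p (i' , e) ≡ true → i' ≡ i) → cnt js p ≤ k
    one-copy p i {k} h g = ≤-trans (cnt-× (allFin D) (allFin m) p (λ i' → is Fin._≟_ i' i) h (λ i' e q → is-at (g i' e q)))
      (≤-trans (*-monoˡ-≤ k (cnt-is≤1 Fin._≟_ i (allFin⁺ D))) (≤-reflexive (*-identityˡ k)))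

    mixed : ∀ v i e → cnt js (λ j → inc (inj₁ (v , i)) j ∧ inc (inj₂ e) j) ≤ κ
    mixed v i e = one-copy _ i
      (λ i' → ≤-trans (cnt-mono (allFin m) λ e' q → is-at (inc-edge {i = i'} (∧₂ (inc (inj₁ (v , i)) (i' , e')) q))) (≤-trans (cnt-is≤1 Fin._≟_ e (allFin⁺ m)) 1≤κ))
      (λ i' e' q → proj₁ (inc-copy {e = e'} (∧₁ (inc (inj₁ (v , i)) (i' , e')) q)))

    impossible : ∀ (p : J → Bool) → (∀ j → p j ≡ true → false ≡ true) → cnt js p ≤ κ
    impossible p h = ≤-trans (cnt-mono js {q = λ _ → false} h) (≤-trans (≤-reflexive (cnt-false js)) z≤n)

    -- Two glue vertices have no common edge, nor do copies of one vertex with different indices. A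
    -- copy and a glue vertex have at most one, which is where 1 ≤ κ enters. Copies of distinct
    -- vertices can meet only inside one copy of `G`, where its codegree bound applies.
    codegree≤κ : ∀ {u v} → u ≢ v → cnt js (λ j → inc u j ∧ inc v j) ≤ κ
    codegree≤κ {inj₂ e} {inj₂ e'} u≢v = impossible _ λ j q →
      ⊥-elim (u≢v (cong inj₂ (trans (sym (inc-edge {i = proj₁ j} (∧₁ (inc (inj₂ e) j) q))) (inc-edge {i = proj₁ j} (∧₂ (inc (inj₂ e) j) q)))))
    codegree≤κ {inj₁ (v , i)} {inj₂ e} u≢v = mixed v i e
    codegree≤κ {inj₂ e} {inj₁ (v , i)} u≢v = ≤-trans (cnt-mono js λ j q → ∧-intro (∧₂ (inc (inj₂ e) j) q) (∧₁ (inc (inj₂ e) j) q)) (mixed v i e)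
    codegree≤κ {inj₁ (u , i)} {inj₁ (v , i')} u≢v with u Fin.≟ v
    ... | yes refl = impossible _ λ j q → ⊥-elim (u≢v (cong (λ z → inj₁ (u , z))
                       (trans (sym (proj₁ (inc-copy {e = proj₂ j} (∧₁ (inc (inj₁ (u , i)) j) q)))) (proj₁ (inc-copy {e = proj₂ j} (∧₂ (inc (inj₁ (u , i)) j) q))))))
    ... | no  p    = one-copy _ i
      (λ k → ≤-trans (cnt-mono (allFin m) λ e q → dec-true ((u ∈? edge G e) ×-dec (v ∈? edge G e))
          (proj₂ (inc-copy {e = e} (∧₁ (inc (inj₁ (u , i)) (k , e)) q)) , proj₂ (inc-copy {e = e} (∧₂ (inc (inj₁ (u , i)) (k , e)) q))))
        (≤-trans (≤-reflexive (sym (length-filter (λ e → (u ∈? edge G e) ×-dec (v ∈? edge G e)) (allFin m)))) (codeg u v p)))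
      (λ k e q → proj₁ (inc-copy {e = e} (∧₁ (inc (inj₁ (u , i)) (k , e)) q)))

    bit⇒fin : Bool → Fin 2
    bit⇒fin false = zero
    bit⇒fin true  = suc zero

    fin⇒bit : Fin 2 → Bool
    fin⇒bit zero    = false
    fin⇒bit (suc _) = true

    encode : J × C × Bool → Fin ((D * m) * (N * 2))
    encode ((i , e) , c , b) = combine (combine i e) (combine c (bit⇒fin b))

    unpack : Fin (D * m) × Fin (N * 2) → J × C × Bool
    unpack (j , y) = remQuot {D} m j , proj₁ (remQuot {N} 2 y) , fin⇒bit (proj₂ (remQuot {N} 2 y))

    decode : Fin ((D * m) * (N * 2)) → J × C × Bool
    decode x = unpack (remQuot {D * m} (N * 2) x)

    decode-encode : ∀ x → decode (encode x) ≡ x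
    decode-encode ((i , e) , c , b) = trans (cong unpack (remQuot-combine {D * m} {N * 2} (combine i e) (combine c (bit⇒fin b))))
      (cong₂ (λ j y → j , proj₁ y , fin⇒bit (proj₂ y)) (remQuot-combine {D} {m} i e) (remQuot-combine {N} {2} c (bit⇒fin b)) ⟨ trans ⟩ cong (λ b → (i , e) , c , b) (bit-round b))
      where
      bit-round : ∀ b → fin⇒bit (bit⇒fin b) ≡ b
      bit-round false = refl
      bit-round true  = refl

    copies : Instance
    copies = record
      { J = J ; V = V ; C = C ; _≟J_ = _≟J_ ; _≟V_ = _≟V_ ; _≟C_ = Fin._≟_
      ; js = js ; js-unique = cartesianProduct⁺ (allFin⁺ D) (allFin⁺ m) ; js-complete = λ { (i , e) → ∈-cartesianProduct⁺ (∈-allFin i) (∈-allFin e) }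
      ; cs = allFin N ; cs-unique = allFin⁺ N ; cs-complete = ∈-allFin ; c₀ = zero
      ; N = (D * m) * (N * 2) ; enc = encode ; dec = decode ; dec-enc = decode-encode
      ; vs = vs ; vs-nonempty = λ { (i , e) → inj₂ e , here refl } ; R = suc r ; κ = κ ; Dg = D
      ; |vs|≤R = λ { (i , e) → s≤s (≤-trans (≤-reflexive (trans (length-map _ (elements (edge G e))) (length-elements (edge G e)))) (bounded e)) }
      ; degree≤Dg = degree≤D ; codegree≤κ = codegree≤κ }

    open Instance copies using (State; Colorable; meet; meet-intro; ∈⇒inc)

    -- Truncation keeps the number of events per edge polynomial in D; arbitrarily long lists would
    -- defeat the union bound.
    lists : Fin m → List ℕ
    lists e = take Lmax (L e)

    start : State
    start = record { U = λ _ → true ; a = λ j c → member (lists (proj₂ j)) c }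

    below : ∀ e {x} → x ∈ lists e → x < N
    below e x∈ = s≤s (∈⇒≤sum (∈-concatMap⁺ L (Any.map (λ { refl → take-⊆ Lmax (L e) x∈ }) (∈-allFin e))))

    colorings : Colorable start → ∃ λ (Φ : Fin D → Fin m → ℕ) → (∀ i → IsLColoring G L (Φ i)) × (∀ i j e → i ≢ j → Φ i e ≢ Φ j e)
    colorings (φ , φ∈ , proper) = (λ i e → toℕ (φ (i , e))) , (λ i → (λ e → in-list i e) , (λ e f e≢f (v , v∈e , v∈f) q →
        proper (i , e) (i , f) refl refl (λ p → e≢f (cong proj₂ p))
          (meet-intro {inj₁ (v , i)} {i , e} {i , f} (has v∈e) (has v∈f)) (toℕ-injective q))) ,
      (λ i j e i≢j q → proper (i , e) (j , e) refl refl (λ p → i≢j (cong proj₁ p))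
          (meet-intro {inj₂ e} {i , e} {j , e} (∈⇒inc {inj₂ e} {i , e} (here refl)) (∈⇒inc {inj₂ e} {j , e} (here refl))) (toℕ-injective q))
      where
      has : ∀ {v i e} → v Subset.∈ edge G e → inc (inj₁ (v , i)) (i , e) ≡ true
      has {v} {i} {e} v∈ = ∈⇒inc {inj₁ (v , i)} {i , e} (there (∈-map⁺ (λ v → inj₁ (v , i)) (∈⇒elements (edge G e) v∈)))
      in-list : ∀ i e → toℕ (φ (i , e)) ∈ L e
      in-list i e = let x , x∈ , q = any-true (is ℕ._≟_ (toℕ (φ (i , e)))) (lists e) (φ∈ (i , e) refl) in
        take-⊆ Lmax (L e) (subst (_∈ lists e) (sym (is-true ℕ._≟_ q)) x∈)

-- Translation of the hypotheses and the initial state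

module Assembly where

  open import Data.Fin using (Fin)
  open import Data.List.Relation.Unary.Unique.Propositional.Properties using (take⁺)
  open import Data.Nat.DivMod as ℕ using ()
  open import Defs
  open Rationals
  open Sums
  open Hypergraphs
  open OneRound
  open Arithmetic
  open Iteration
  open Powers
  open Encoding

  module _ (r p q : ℕ) (0<p : 0 ℕ.< p) (0<q : 0 ℕ.< q) (B b : ℕ) (B≡ : B ≡ 20 ℕ.+ 16 ℕ.* suc r) (0<b : 0 ℕ.< b)
    {D : ℕ} (sc : Scale (suc r) B q b D) where
    open Scale sc

    -- `P` is S^B, and `κ` is the integer part of D/P. The exponent B = 20 + 16R joins the 20 powers
    -- of u required in a round to the 16R powers by which l may shrink while g rises from u to 1.
    module Assembled (P κ : ℕ) (P≡ : S ℕ.^ B ≡ P) (P^q≤D : P ℕ.^ q ℕ.≤ D) (1≤κ : 1 ℕ.≤ κ) (κP≤D : κ ℕ.* P ℕ.≤ D)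
      (κ-max : ∀ {c} → c ℕ.* P ℕ.≤ D → c ℕ.≤ κ)
      where

      R E : ℕ
      R = suc r
      E = 16 ℕ.* R

      32≤S : 32 ℕ.≤ S
      32≤S = ℕ.≤-trans (ℕ.*-monoʳ-≤ 32 {1} {R} (ℕ.s≤s ℕ.z≤n)) 32R≤S

      0<s : 0 ℕ.< s
      0<s = pos s 2s≡S
        where
        pos : ∀ s → 2 ℕ.* s ≡ S → 0 ℕ.< s
        pos zero    e = ⊥-elim (ℕ.<⇒≱ 32≤S (ℕ.≤-trans (ℕ.≤-reflexive (sym e)) ℕ.z≤n))
        pos (suc s) e = ℕ.s≤s ℕ.z≤n

      x≤x^ : ∀ x n → 0 ℕ.< x → 0 ℕ.< n → x ℕ.≤ x ℕ.^ n
      x≤x^ x n 0<x 0<n = ℕ.≤-trans (ℕ.≤-reflexive (sym (ℕ.^-identityʳ x))) (ℕ.^-monoʳ-≤ x {{ℕ.>-nonZero 0<x}} 0<n)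

      -- From P^q ≤ D ≤ D^p the hypothesis yields (cP)^q ≤ D^q, and q-th roots can be taken.
      codegree-bound : ∀ {c} → c ℕ.^ q ℕ.* D ℕ.^ p ℕ.≤ D ℕ.^ q → c ℕ.≤ κ
      codegree-bound {c} h = κ-max (^-cancelˡ-≤ q 0<q (begin
        (c ℕ.* P) ℕ.^ q ≡⟨ ^-distribʳ-* c P q ⟩
        c ℕ.^ q ℕ.* P ℕ.^ q ≤⟨ ℕ.*-monoʳ-≤ (c ℕ.^ q) (ℕ.≤-trans P^q≤D (x≤x^ D p 0<D 0<p)) ⟩
        c ℕ.^ q ℕ.* D ℕ.^ p ≤⟨ h ⟩
        D ℕ.^ q ∎))
        where open ℕ.≤-Reasoning

      -- With α = 1/b and s at least D^(1/b), a surplus of D^(1-α) is at least D/s.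
      surplus : ∀ {x} → D ℕ.^ b ℕ.≤ x ℕ.^ b ℕ.* D ℕ.^ 1 → D ℕ.≤ x ℕ.* s
      surplus {x} h = ^-cancelˡ-≤ b 0<b (begin
        D ℕ.^ b ≤⟨ h ⟩
        x ℕ.^ b ℕ.* D ℕ.^ 1 ≤⟨ ℕ.*-monoʳ-≤ (x ℕ.^ b) (ℕ.≤-trans (ℕ.≤-reflexive (ℕ.^-identityʳ D)) D≤s^b) ⟩
        x ℕ.^ b ℕ.* s ℕ.^ b ≡⟨ ^-distribʳ-* x s b ⟨
        (x ℕ.* s) ℕ.^ b ∎)
        where open ℕ.≤-Reasoning

      module _ {n m : ℕ} (G : Hypergraph n m) (bounded : RBounded r G) (deg : ∀ v → degree G v ℕ.≤ D)
        (codeg : ∀ u v → u ≢ v → codegree G u v ℕ.^ q ℕ.* D ℕ.^ p ℕ.≤ D ℕ.^ q)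
        (L : Fin m → List ℕ) (unique : ∀ e → Unique (L e))
        (long : ∀ e → D ℕ.≤ length (L e) × D ℕ.^ b ℕ.≤ (length (L e) ℕ.∸ D) ℕ.^ b ℕ.* D ℕ.^ 1) where

        open Copies G r D κ (2 ℕ.* D) L bounded deg (λ u v u≢v → codegree-bound (codeg u v u≢v)) 1≤κ

        0<S : 0 ℕ.< S
        0<S = ℕ.≤-trans (ℕ.s≤s ℕ.z≤n) 32≤S

        private
          S⁻¹ = inverse (0<ι 0<S)

        u : ℚ
        u = proj₁ S⁻¹

        0<u : 0ℚ < u
        0<u = proj₁ (proj₂ S⁻¹)

        0≤u : 0ℚ ≤ u
        0≤u = <⇒≤ 0<u

        uS≡1 : u * ι S ≡ 1ℚ
        uS≡1 = proj₂ (proj₂ S⁻¹)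

        Ru≤c : ι R * u ≤ c
        Ru≤c = begin
          ι R * u ≡⟨ alg (ι R) u ⟩
          c * (ι 32 * ι R) * u ≡⟨ cong (λ x → c * x * u) (sym (ι-* 32 R)) ⟩
          c * ι (32 ℕ.* R) * u ≤⟨ *-monoˡ 0≤u (*-monoʳ 0≤c (ι-mono 32R≤S)) ⟩
          c * ι S * u ≡⟨ trans (*-assoc c (ι S) u) (cong (c *_) (trans (*-comm (ι S) u) uS≡1)) ⟩
          c * 1ℚ ≡⟨ *-identityʳ c ⟩
          c ∎
          where
          open ≤-Reasoning
          alg : ∀ a u → a * u ≡ c * (ι 32 * a) * u
          alg = solve-∀ ring

        1≤R : 1 ℕ.≤ R
        1≤R = ℕ.s≤s ℕ.z≤n

        u≤c : u ≤ c
        u≤c = ≤-trans (≤-trans (≤-reflexive (sym (*-identityˡ u))) (*-monoˡ 0≤u (1≤ι (1≤R)))) Ru≤c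

        -- Since 1/s = 2u, this is D(1 + 1/s). The factor 2, which comes from S = 2s, gives D ≤
        -- (1-u) l₀, so the gap can start at exactly u.
        l₀ : ℚ
        l₀ = ι D + ι D * (u + u)

        0≤l₀ : 0ℚ ≤ l₀
        0≤l₀ = 0≤+ (0≤ι D) (0≤* (0≤ι D) (0≤+ 0≤u 0≤u))

        s2u≡1 : ι s * (u + u) ≡ 1ℚ
        s2u≡1 = trans (alg (ι s) u) (trans (cong (u *_) (trans (sym (ι-* 2 s)) (cong ι 2s≡S))) uS≡1)
          where
          alg : ∀ s u → s * (u + u) ≡ u * (ι 2 * s)
          alg = solve-∀ ring

        enough : ∀ e → l₀ ≤ ι (length (lists e))
        enough e = begin
          ι D + ι D * (u + u) ≤⟨ +-monoʳ-≤ (ι D) (*-monoˡ (0≤+ 0≤u 0≤u) (ι-mono D≤xs)) ⟩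
          ι D + ι (x ℕ.* s) * (u + u) ≡⟨ cong (ι D +_) (trans (cong (_* (u + u)) (ι-* x s)) (trans (*-assoc (ι x) _ _) (trans (cong (ι x *_) s2u≡1) (*-identityʳ _)))) ⟩
          ι D + ι x ≡⟨ ι-+ D x ⟨
          ι (D ℕ.+ x) ≤⟨ ι-mono (length-take≥ (2 ℕ.* D) (L e) x+D≤2D x+D≤len) ⟩
          ι (length (lists e)) ∎
          where
          open ≤-Reasoning
          y x : ℕ
          y = length (L e) ℕ.∸ D
          -- The surplus is cut off at D so that D + x colours fit into a list truncated to 2D.
          x = D ℕ.⊓ y
          D≤xs : D ℕ.≤ x ℕ.* s
          D≤xs = ℕ.≤-trans (ℕ.⊓-glb (ℕ.m≤m*n D s {{ℕ.>-nonZero 0<s}}) (surplus (proj₂ (long e)))) (ℕ.≤-reflexive (sym (ℕ.*-distribʳ-⊓ s D y)))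
          x+D≤2D : D ℕ.+ x ℕ.≤ 2 ℕ.* D
          x+D≤2D = ℕ.+-monoʳ-≤ D (ℕ.≤-trans (ℕ.m⊓n≤m D y) (ℕ.m≤m+n D 0))
          x+D≤len : D ℕ.+ x ℕ.≤ length (L e)
          x+D≤len = ℕ.≤-trans (ℕ.+-monoʳ-≤ D (ℕ.m⊓n≤n D y)) (ℕ.≤-reflexive (ℕ.m+[n∸m]≡n (proj₁ (long e))))

        D≤[1-u]l₀ : ι D ≤ (1ℚ - u) * l₀
        D≤[1-u]l₀ = ≤-by (ι D * (u * (1ℚ - (u + u)))) (0≤* (0≤ι D) (0≤* 0≤u (diff (≤-trans (+-mono-≤ u≤c u≤c) 2c≤1)))) (alg (ι D) u)
          where
          alg : ∀ d u → (1ℚ - u) * (d + d * (u + u)) - d ≡ d * (u * (1ℚ - (u + u)))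
          alg = solve-∀ ring

        good : Good copies l₀ ((1ℚ - u) * l₀) (2 ℕ.* D) start
        good = record
          { lists   = λ { (i , e) _ → ≤-trans (enough e) (ι-mono (cnt-member≥ N (take⁺ (2 ℕ.* D) (unique e)) (below e))) }
          ; lists≤  = λ { (i , e) → ℕ.≤-trans (cnt-member≤ N (lists e)) (length-take≤ (2 ℕ.* D) (L e)) }
          ; loads   = λ v c → ≤-trans (ι-mono (ℕ.≤-trans (cnt-mono js λ j q → ∧₁ (inc v j) q) (degree≤D v))) D≤[1-u]l₀
          ; alive⇒U = λ _ _ _ → refl }

        1≤RD : 1 ℕ.≤ R ℕ.* D
        1≤RD = ℕ.*-mono-≤ 1≤R 0<D

        open Constants copies S u 0<u uS≡1 u≤c Ru≤c 1≤R 1≤κ (2 ℕ.* D)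
          (ℕ.*-mono-≤ (ℕ.*-mono-≤ 1≤RD 1≤RD) (ℕ.*-mono-≤ 1≤RD 1≤RD)) Δ-small using (run; u^S^; u≤1)

        κ≤ : ι κ ≤ u ^ 20 * (l₀ * u ^ E)
        κ≤ = begin
          ι κ ≡⟨ *-identityʳ (ι κ) ⟨
          ι κ * 1ℚ ≡⟨ cong (ι κ *_) (trans (cong (λ a → u ^ B * ι a) (sym P≡)) (u^S^ B)) ⟨
          ι κ * (u ^ B * ι P) ≡⟨ alg (ι κ) (u ^ B) (ι P) ⟩
          u ^ B * (ι κ * ι P) ≡⟨ cong (u ^ B *_) (ι-* κ P) ⟨
          u ^ B * ι (κ ℕ.* P) ≤⟨ *-monoʳ (0≤^ B 0≤u) (≤-trans (ι-mono κP≤D) (a≤a+b (0≤* (0≤ι D) (0≤+ 0≤u 0≤u)))) ⟩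
          u ^ B * l₀ ≡⟨ trans (cong (_* l₀) (trans (cong (u ^_) B≡) (^-+ u 20 E))) (alg2 (u ^ 20) (u ^ E) l₀) ⟩
          u ^ 20 * (l₀ * u ^ E) ∎
          where
          open ≤-Reasoning
          alg : ∀ a b c → a * (b * c) ≡ b * (a * c)
          alg = solve-∀ ring
          alg2 : ∀ a b c → a * b * c ≡ a * (c * b)
          alg2 = solve-∀ ring

        disjoint-colorings : ∃ λ (Φ : Fin D → Fin m → ℕ) → (∀ i → IsLColoring G L (Φ i)) × (∀ i j e → i ≢ j → Φ i e ≢ Φ j e)
        disjoint-colorings = colorings (run κ≤ (S ℕ.^ 8) 0≤l₀ ≤-refl ≤-refl u≤1 fuel good)
          where
          -- The whole way is shorter than 1 = S^8 u^8, so S^8 steps of u^8 suffice.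
          fuel : 1ℚ - u ≤ ι (S ℕ.^ 8) * u ^ 8
          fuel = ≤-trans (1-≤1 0≤u) (≤-reflexive (sym (trans (*-comm (ι (S ℕ.^ 8)) (u ^ 8)) (u^S^ 8))))

  quotient : ∀ {R B q b D} (sc : Scale R B q b D) → 0 ℕ.< R → 0 ℕ.< q → let open Scale sc in
             ∃ λ κ → 1 ℕ.≤ κ × κ ℕ.* S ℕ.^ B ℕ.≤ D × (∀ {c} → c ℕ.* S ℕ.^ B ℕ.≤ D → c ℕ.≤ κ)
  quotient {R} {B} {q} {b} {D} sc 0<R 0<q = D ℕ./ P , quotient-bound {1} {P} (ℕ.≤-trans (ℕ.≤-reflexive (ℕ.*-identityˡ P)) P≤D) , ℕ.m/n*n≤m D P , quotient-bound
    where
    open Scale sc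
    P = S ℕ.^ B
    instance
      P≢0 : ℕ.NonZero P
      P≢0 = ℕ.>-nonZero (ℕ.m^n>0 S {{ℕ.>-nonZero (ℕ.≤-trans (ℕ.*-mono-≤ {1} {32} (ℕ.s≤s ℕ.z≤n) 0<R) 32R≤S)}} B)
    P≤D : P ℕ.≤ D
    P≤D = ℕ.≤-trans (ℕ.≤-trans (ℕ.≤-reflexive (sym (ℕ.^-identityʳ P))) (ℕ.^-monoʳ-≤ P 0<q)) S^Bq≤D

  packing : ∀ r p q → 0 ℕ.< p → 0 ℕ.< q → ∀ B → B ≡ 20 ℕ.+ 16 ℕ.* suc r →
    ∃ λ D₀ → ∃ λ a → ∃ λ b → 0 ℕ.< a × 0 ℕ.< b × (∀ D → D₀ ℕ.≤ D → ∀ {n m} (G : Hypergraph n m) → RBounded r G → (∀ v → degree G v ℕ.≤ D) →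
      (∀ u v → u ≢ v → codegree G u v ℕ.^ q ℕ.* D ℕ.^ p ℕ.≤ D ℕ.^ q) → (L : Fin m → List ℕ) → (∀ e → Unique (L e)) →
      (∀ e → D ℕ.≤ length (L e) × D ℕ.^ b ℕ.≤ (length (L e) ℕ.∸ D) ℕ.^ b ℕ.* D ℕ.^ a) →
      ∃ λ (Φ : Fin D → Fin m → ℕ) → (∀ i → IsLColoring G L (Φ i)) × (∀ i j e → i ≢ j → Φ i e ≢ Φ j e))
  packing r p q 0<p 0<q B B≡ =
    let b , 0<b , D₀ , sc = scale (suc r) B q (ℕ.s≤s ℕ.z≤n) (ℕ.≤-trans (ℕ.s≤s ℕ.z≤n) (ℕ.≤-reflexive (sym B≡))) 0<q
    in D₀ , 1 , b , ℕ.s≤s ℕ.z≤n , 0<b , λ D D₀≤D G bounded deg codeg L unique long →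
      let κ , 1≤κ , κP≤D , κ-max = quotient (sc D D₀≤D) (ℕ.s≤s ℕ.z≤n) 0<q
      in Assembled.disjoint-colorings r p q 0<p 0<q B b B≡ 0<b (sc D D₀≤D) _ κ refl (Scale.S^Bq≤D (sc D D₀≤D)) 1≤κ κP≤D κ-max G bounded deg codeg L unique long

open import Defs
open import Data.Nat using (ℕ; _≤_; _<_; _*_; _^_; _∸_)
open import Data.Fin using (Fin)
open import Data.List using (List; length)
open import Data.List.Relation.Unary.Unique.Propositional using (Unique)
open import Data.Product using (_×_; ∃; Σ)
open import Relation.Binary.PropositionalEquality using (_≡_; _≢_)

-- β is given as p/q and α as a/b, with roots cleared: codegrees at most D^(1-p/q), lists of length
-- at least D + D^(1-a/b). A real β may be replaced by a smaller positive rational, which for D ≥ 1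
-- only weakens the codegree condition. `Unique` makes the length of a list its number of colours.
theorem2p5 : ∀ (r : ℕ) → 2 ≤ r →
    ∀ (p q : ℕ) → 0 < p → 0 < q →
    ∃ λ (D₀ : ℕ) → ∃ λ (a : ℕ) → ∃ λ (b : ℕ) → 0 < a × 0 < b ×
    (∀ (D : ℕ) → D₀ ≤ D →
    ∀ {n m : ℕ} (G : Hypergraph n m) →
    RBounded r G →
    (∀ v → degree G v ≤ D) →
    (∀ u v → u ≢ v → codegree G u v ^ q * D ^ p ≤ D ^ q) →
    (L : Fin m → List ℕ) →
    (∀ e → Unique (L e)) →
    (∀ e → D ≤ length (L e) × D ^ b ≤ (length (L e) ∸ D) ^ b * D ^ a) →
    Σ (Fin D → Fin m → ℕ) λ Φ →
    (∀ i → IsLColoring G L (Φ i)) ×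
    (∀ i j e → i ≢ j → Φ i e ≢ Φ j e))
theorem2p5 r _ p q 0<p 0<q = Assembly.packing r p q 0<p 0<q _ refl
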